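{- Let $G$ be a finite simple graph with maximum degree $\Delta(G)\geq 17$ and maximum average degree $\mathrm{mad}(G)<3$. Then $G$ admits a list $2$-distance $(\Delta(G)+2)$-coloring, i.e. for every assignment of a list $L(v)$ of $\Delta(G)+2$ colors to each vertex $v$, there is a choice of colors $c(v)\in L(v)$ such that any two distinct vertices that are adjacent or have a common neighbor receive distinct colors.
   Context: All graphs are finite and simple. The average degree of a graph $H$ is $2|E(H)|/|V(H)|$; the maximum average degree $\mathrm{mad}(G)$ is the maximum of the average degree over all (nonempty) subgraphs $H$ of $G$. -}

module Defs where

open import Data.Nat using (ℕ; zero; suc; _+_; _*_; _⊔_; _<_)
open import Data.Bool using (Bool; true; false; if_then_else_; T)
open import Data.Fin using (Fin)
open import Data.List using (List; map; foldr; allFin)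
open import Data.Nat.ListAction using (sum)
open import Data.Product using (_×_; ∃)
open import Data.Sum using (_⊎_)
open import Relation.Binary.PropositionalEquality using (_≡_)

record Graph (n : ℕ) : Set where
  field
    adj      : Fin n → Fin n → Bool
    adj-sym  : ∀ u v → adj u v ≡ adj v u
    adj-irr  : ∀ v → adj v v ≡ false
open Graph public

ind : Bool → ℕ
ind true  = 1
ind false = 0

countB : {n : ℕ} → (Fin n → Bool) → ℕ
countB {n} p = sum (map (λ u → ind (p u)) (allFin n))

degree : {n : ℕ} → Graph n → Fin n → ℕ
degree G v = countB (adj G v)

maxDegree : {n : ℕ} → Graph n → ℕ
maxDegree {n} G = foldr (λ v m → degree G v ⊔ m) 0 (allFin n)

record Subgraph {n : ℕ} (G : Graph n) : Set where
  field
    vert     : Fin n → Bool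
    edge     : Fin n → Fin n → Bool
    edge-sym : ∀ u v → edge u v ≡ edge v u
    edge-adj : ∀ u v → T (edge u v) → T (adj G u v)
    edge-vl  : ∀ u v → T (edge u v) → T (vert u)
    edge-vr  : ∀ u v → T (edge u v) → T (vert v)
open Subgraph public

numVertices : {n : ℕ} {G : Graph n} → Subgraph G → ℕ
numVertices H = countB (vert H)

twiceNumEdges : {n : ℕ} {G : Graph n} → Subgraph G → ℕ
twiceNumEdges {n} H = sum (map (λ u → countB (edge H u)) (allFin n))

-- mad(G) < 3 : every nonempty subgraph H has average degree
-- 2|E(H)|/|V(H)| < 3, i.e. (clearing the positive denominator) 2|E(H)| < 3|V(H)|.
-- Since there are finitely many subgraphs, the maximum is < 3 iff each is.
madLessThan3 : {n : ℕ} → Graph n → Set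
madLessThan3 G = ∀ (H : Subgraph G) → 0 < numVertices H →
  twiceNumEdges H < 3 * numVertices H

close : {n : ℕ} → Graph n → Fin n → Fin n → Set
close G u v = T (adj G u v) ⊎ ∃ (λ w → T (adj G u w) × T (adj G w v))

{-# OPTIONS --safe #-}
module Submission where

-- Write k for the maximum degree, let a vertex "see" those within distance two, and let G be critical: not
-- colourable, but colourable after the deletion of any edge. Repeatedly set aside ("free") a vertex that sees
-- at most k + 1 vertices of the rest; every colouring of what remains, the core, extends greedily. So no edge
-- joins two free vertices, and a core vertex sees at least k + 2 core vertices.
--
-- Discharging with charge deg - 3, in tenths: a big vertex sends up to 8 to each neighbour, a small vertex
-- feeds its neighbours of degree 2, and each k-vertex has 2k - 30 ≥ 4 left for a common pot (this is where
-- 17 ≤ k is needed). The only vertices that stay short are "bad": they see exactly k + 2 core vertices, all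
-- but two of them through one k-vertex, their hub. Link bad vertices of different hubs that see each other.
-- The pot suffices if there are at most twice as many links (isolated ones counted twice) as hubs.
--
-- To see this, peel off a minimal set K of bad vertices that at most one vertex joins to the others. Either
-- the hubs of K can pay for all links at K, or near K there are two bad vertices u, w that see each other,
-- where u has more bad neighbours than w and its removal disconnects nothing. Since a bad vertex has at
-- least as many colours left as it has uncoloured bad neighbours, u can be given a colour that costs w
-- nothing, and colouring greedily towards w contradicts criticality.

open import Defs
open import Data.Nat using (ℕ; _+_; _≤_)
open import Data.Fin using (Fin)
open import Data.List using (List; length)
open import Data.List.Membership.Propositional using (_∈_)
open import Data.List.Relation.Unary.Unique.Propositional using (Unique)
open import Data.Product using (Σ; _×_)
open import Relation.Binary.PropositionalEquality using (_≡_)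
open import Relation.Nullary using (¬_)

open import Data.Bool using (Bool; true; false; if_then_else_; _∧_; _∨_; not; T)
open import Data.Bool.Properties using (T-≡; ¬-not)
import Data.Bool.Properties as Bool
open import Data.Empty using (⊥; ⊥-elim)
open import Data.Fin using (zero; suc; _≟_)
open import Data.Fin.Patterns using (0F; 1F; 2F; 3F; 4F; 5F)
open import Data.Fin.Properties using (any?; all?; suc-injective)
open import Data.List using ([]; _∷_; _++_; map; filter; foldr; allFin)
open import Data.List.Membership.DecPropositional using () renaming (_∈?_ to member?)
open import Data.List.Membership.Propositional using (_∉_; find; lose)
open import Data.List.Membership.Propositional.Properties using (∈-++⁺ˡ; ∈-++⁺ʳ; ∈-++⁻; ∈-filter⁺; ∈-filter⁻; ∈-map⁺; ∈-map⁻; ∈-allFin)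
open import Data.List.Properties using (map-tabulate; length-map; length-++; filter-all; filter-accept; filter-reject)
open import Data.List.Relation.Unary.All as All using (_∷_)
open import Data.List.Relation.Unary.Any as Any using (here; there)
open import Data.List.Relation.Unary.Unique.Propositional using ([]; _∷_)
open import Data.List.Relation.Unary.Unique.Propositional.Properties using (filter⁺)
import Data.Nat as ℕ
open import Data.Nat using (zero; suc; _*_; _∸_; _⊔_; _⊓_; _<_; z≤n; s≤s; s≤s⁻¹; _≤?_; _≡ᵇ_; _≤ᵇ_)
open import Data.Nat.ListAction using (sum)
open import Data.Nat.Properties hiding (_≟_; suc-injective)
open import Data.Nat.Solver using (module +-*-Solver)
open import Data.Product using (∃; _,_; proj₁; proj₂)
open import Data.Sum using (_⊎_; inj₁; inj₂; [_,_]′)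
open import Data.Vec using ([]; _∷_; lookup)
open import Function using (_∘_; id)
open import Function.Bundles using (Equivalence)
open import Relation.Binary.PropositionalEquality using (_≢_; refl; sym; trans; cong; cong₂; subst; subst₂; module ≡-Reasoning)
open import Relation.Nullary using (Dec; yes; no; does; ¬?; _→-dec_)
open import Relation.Nullary.Decidable using (toWitness)
open import Relation.Unary using (Decidable)
open +-*-Solver using (solve; _:+_; _:*_; _:=_; con)

-- The number `k` and the lists stay fixed while edges are deleted: the induction runs over all
-- graphs of maximum degree at most `k` with lists of size `k + 2`. Deleting an edge loses only
-- distance-two pairs that contain one of its ends, so if both ends are uncoloured, no coloured pair
-- is affected. This is how every reducible configuration is used.
--
-- The obstacle is that a `k`-vertex cannot pay for its bad neighbours one by one: a priori all `k`
-- of them may be bad, each short by up to 2 tenths, against a surplus of 4. A bad vertex is short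
-- by at most its number of links (2 for an isolated link), so, counting links from both ends, a pot
-- of 4 per hub has to suffice on average. A hub with at most two bad vertices pays for all links at
-- them. If links leave the chosen set, they must be paid from both ends; parity gains the missing
-- amount except in one sharp case, and that case, like hubs with three or more bad vertices, is
-- left to the colouring argument or to a smaller set.

private variable
  n : ℕ
  a b : Bool

private
  +-interchange : ∀ a b c d → (a + b) + (c + d) ≡ (a + c) + (b + d)
  +-interchange = solve 4 (λ a b c d → (a :+ b) :+ (c :+ d) := (a :+ c) :+ (b :+ d)) refl

-- The Boolean connectives and the sums are opaque, so that unification can read off their arguments.

infixr 6 _&_
infixr 5 _||_
infix 7 !_

opaque
  _&_ _||_ : Bool → Bool → Bool
  _&_ = _∧_
  _||_ = _∨_

  !_ : Bool → Bool
  !_ = not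

  &⁺ : a ≡ true → b ≡ true → a & b ≡ true
  &⁺ refl refl = refl

  &⁻ : a & b ≡ true → a ≡ true × b ≡ true
  &⁻ {true} {true} refl = refl , refl

  &-falseˡ : a ≡ false → a & b ≡ false
  &-falseˡ refl = refl

  &-trueˡ : a ≡ true → a & b ≡ b
  &-trueˡ refl = refl

  &-falseʳ : b ≡ false → a & b ≡ false
  &-falseʳ {a = a} refl = Bool.∧-zeroʳ a

  &-trueʳ : b ≡ true → a & b ≡ a
  &-trueʳ {a = a} refl = Bool.∧-identityʳ a

  &-comm : (a b : Bool) → a & b ≡ b & a
  &-comm = Bool.∧-comm

  ||⁺ˡ : a ≡ true → a || b ≡ true
  ||⁺ˡ refl = refl

  ||⁺ʳ : b ≡ true → a || b ≡ true
  ||⁺ʳ {a = a} refl = Bool.∨-zeroʳ a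

  ||⁻ : a || b ≡ true → a ≡ true ⊎ b ≡ true
  ||⁻ {true} e = inj₁ refl
  ||⁻ {false} e = inj₂ e

  !⁺ : a ≡ false → ! a ≡ true
  !⁺ refl = refl

  !⁻ : ! a ≡ true → a ≡ false
  !⁻ {false} e = refl

  !-true : a ≡ true → ! a ≡ false
  !-true refl = refl

true≢false : a ≡ true → a ≡ false → ⊥
true≢false refl ()

¬-true : (a ≡ true → ⊥) → a ≡ false
¬-true h = ¬-not h

bool? : (a : Bool) → a ≡ true ⊎ a ≡ false
bool? true = inj₁ refl
bool? false = inj₂ refl

bool-ext : (a ≡ true → b ≡ true) → (b ≡ true → a ≡ true) → a ≡ b
bool-ext {true} f g = sym (f refl)
bool-ext {false} {true} f g = g refl
bool-ext {false} {false} f g = refl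

does⁺ : {P : Set} (d : Dec P) → P → does d ≡ true
does⁺ (yes _) p = refl
does⁺ (no ¬p) p = ⊥-elim (¬p p)

does⁻ : {P : Set} (d : Dec P) → does d ≡ true → P
does⁻ (yes p) e = p

¬does⁺ : {P : Set} (d : Dec P) → ¬ P → does d ≡ false
¬does⁺ (yes p) ¬p = ⊥-elim (¬p p)
¬does⁺ (no _) ¬p = refl

¬does⁻ : {P : Set} (d : Dec P) → does d ≡ false → ¬ P
¬does⁻ (no ¬p) e = ¬p

opaque
  _==_ : Fin n → Fin n → Bool
  i == j = does (i ≟ j)

  ==⁺ : {i j : Fin n} → i ≡ j → i == j ≡ true
  ==⁺ {i = i} {j} = does⁺ (i ≟ j)

  ==⁻ : {i j : Fin n} → i == j ≡ true → i ≡ j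
  ==⁻ {i = i} {j} = does⁻ (i ≟ j)

  ≢⁺ : {i j : Fin n} → i ≢ j → i == j ≡ false
  ≢⁺ {i = i} {j} = ¬does⁺ (i ≟ j)

  ≢⁻ : {i j : Fin n} → i == j ≡ false → i ≢ j
  ≢⁻ {i = i} {j} = ¬does⁻ (i ≟ j)

  some : (Fin n → Bool) → Bool
  some p = does (any? (λ i → p i Bool.≟ true))

  some⁺ : {p : Fin n → Bool} (i : Fin n) → p i ≡ true → some p ≡ true
  some⁺ {p = p} i e = does⁺ (any? (λ i → p i Bool.≟ true)) (i , e)

  some⁻ : {p : Fin n → Bool} → some p ≡ true → ∃ λ i → p i ≡ true
  some⁻ {p = p} = does⁻ (any? (λ i → p i Bool.≟ true))

search : (p : Fin n → Bool) → (∃ λ i → p i ≡ true) ⊎ (∀ i → p i ≡ false)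
search p with any? (λ i → p i Bool.≟ true)
... | yes x = inj₁ x
... | no ¬x = inj₂ λ i → ¬-not (λ e → ¬x (i , e))

infix 20 _==_ _≐_ _≼_

opaque
  _≐_ _≼_ : ℕ → ℕ → Bool
  x ≐ y = x ≡ᵇ y
  x ≼ y = x ≤ᵇ y

  ≐⁺ : {x y : ℕ} → x ≡ y → x ≐ y ≡ true
  ≐⁺ {x} {y} e = T-≡ .Equivalence.to (≡⇒≡ᵇ x y e)

  ≐⁻ : {x y : ℕ} → x ≐ y ≡ true → x ≡ y
  ≐⁻ {x} {y} e = ≡ᵇ⇒≡ x y (T-≡ .Equivalence.from e)

  ≼⁺ : {x y : ℕ} → x ≤ y → x ≼ y ≡ true
  ≼⁺ {x} {y} e = T-≡ .Equivalence.to (≤⇒≤ᵇ e)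

  ≼⁻ : {x y : ℕ} → x ≼ y ≡ true → x ≤ y
  ≼⁻ {x} {y} e = ≤ᵇ⇒≤ x y (T-≡ .Equivalence.from e)

-- Finite sums

opaque
  ∑ : (Fin n → ℕ) → ℕ
  ∑ {zero} f = 0
  ∑ {suc n} f = f zero + ∑ (f ∘ suc)

opaque
  unfolding ∑

  ∑-cong : {f g : Fin n → ℕ} → (∀ i → f i ≡ g i) → ∑ f ≡ ∑ g
  ∑-cong {zero} h = refl
  ∑-cong {suc n} h = cong₂ _+_ (h zero) (∑-cong (h ∘ suc))

  ∑-+ : (f g : Fin n → ℕ) → ∑ (λ i → f i + g i) ≡ ∑ f + ∑ g
  ∑-+ {zero} f g = refl
  ∑-+ {suc n} f g = trans (cong (f zero + g zero +_) (∑-+ (f ∘ suc) (g ∘ suc)))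
    (+-interchange (f zero) (g zero) (∑ (f ∘ suc)) (∑ (g ∘ suc)))

  ∑-mono : (f g : Fin n → ℕ) → (∀ i → f i ≤ g i) → ∑ f ≤ ∑ g
  ∑-mono {zero} f g h = z≤n
  ∑-mono {suc n} f g h = +-mono-≤ (h zero) (∑-mono (f ∘ suc) (g ∘ suc) (h ∘ suc))

  ∑-zero : (f : Fin n → ℕ) → (∀ i → f i ≡ 0) → ∑ f ≡ 0
  ∑-zero {zero} f h = refl
  ∑-zero {suc n} f h = cong₂ _+_ (h zero) (∑-zero (f ∘ suc) (h ∘ suc))

  ∑-swap : {m : ℕ} (f : Fin m → Fin n → ℕ) → ∑ (λ i → ∑ (f i)) ≡ ∑ (λ j → ∑ (λ i → f i j))
  ∑-swap {m = zero} f = sym (∑-zero (λ j → ∑ (λ i → f i j)) (λ _ → refl))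
  ∑-swap {m = suc m} f = trans (cong (∑ (f zero) +_) (∑-swap (f ∘ suc)))
    (sym (∑-+ (f zero) (λ j → ∑ (λ i → f (suc i) j))))

  ∑-*ˡ : (x : ℕ) (f : Fin n → ℕ) → ∑ (λ i → x * f i) ≡ x * ∑ f
  ∑-*ˡ {zero} x f = sym (*-zeroʳ x)
  ∑-*ˡ {suc n} x f = trans (cong (x * f zero +_) (∑-*ˡ x (f ∘ suc))) (sym (*-distribˡ-+ x (f zero) (∑ (f ∘ suc))))

  ∑-tight : (f g : Fin n → ℕ) → (∀ i → f i ≤ g i) → ∑ g ≤ ∑ f → ∀ i → f i ≡ g i
  ∑-tight {suc n} f g h le zero = ≤-antisym (h zero) (+-cancelʳ-≤ _ _ _
    (≤-trans le (+-monoʳ-≤ (f zero) (∑-mono (f ∘ suc) (g ∘ suc) (h ∘ suc)))))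
  ∑-tight {suc n} f g h le (suc i) = ∑-tight (f ∘ suc) (g ∘ suc) (h ∘ suc)
    (+-cancelˡ-≤ _ _ _ (≤-trans le (+-monoˡ-≤ _ (h zero)))) i

  sum-allFin : (f : Fin n → ℕ) → sum (map f (allFin n)) ≡ ∑ f
  sum-allFin {zero} f = refl
  sum-allFin {suc n} f = cong (f zero +_) (trans (cong sum (trans (map-tabulate suc f) (sym (map-tabulate id (f ∘ suc))))) (sum-allFin (f ∘ suc)))

  -- The first row and the first column agree and the corner vanishes, so each induction step adds
  -- twice a row.
  ∑∑-even : (f : Fin n → Fin n → ℕ) → (∀ i j → f i j ≡ f j i) → (∀ i → f i i ≡ 0) →
    ∃ λ h → ∑ (λ i → ∑ (f i)) ≡ 2 * h
  ∑∑-even {zero} f s d = 0 , refl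
  ∑∑-even {suc n} f s d with ∑∑-even (λ i j → f (suc i) (suc j)) (λ i j → s (suc i) (suc j)) (d ∘ suc)
  ... | h , e = r + h , (begin
    (f zero zero + r) + ∑ (λ i → f (suc i) zero + ∑ (λ j → f (suc i) (suc j)))
      ≡⟨ cong₂ _+_ (cong (_+ r) (d zero)) (∑-+ (λ i → f (suc i) zero) (λ i → ∑ (λ j → f (suc i) (suc j)))) ⟩
    r + (∑ (λ i → f (suc i) zero) + ∑ (λ i → ∑ (λ j → f (suc i) (suc j))))
      ≡⟨ cong (r +_) (cong₂ _+_ (∑-cong (λ i → s (suc i) zero)) e) ⟩
    r + (r + 2 * h)
      ≡⟨ solve 2 (λ r h → r :+ (r :+ con 2 :* h) := con 2 :* (r :+ h)) refl r h ⟩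
    2 * (r + h) ∎)
    where
    open ≡-Reasoning
    r : ℕ
    r = ∑ (λ j → f zero (suc j))

  ∑-pick : (i : Fin n) (f : Fin n → ℕ) → (∀ j → j ≢ i → f j ≡ 0) → ∑ f ≡ f i
  ∑-pick {suc n} zero f h = trans (cong (f zero +_) (∑-zero (f ∘ suc) (λ j → h (suc j) λ ()))) (+-identityʳ (f zero))
  ∑-pick {suc n} (suc i) f h = trans (cong (_+ ∑ (f ∘ suc)) (h zero λ ()))
    (∑-pick i (f ∘ suc) (λ j ne → h (suc j) (ne ∘ suc-injective)))

∑-mono-< : (f g : Fin n → ℕ) → (∀ i → f i ≤ g i) → (i : Fin n) → f i < g i → ∑ f < ∑ g
∑-mono-< f g h i lt = ≰⇒> λ le → <⇒≢ lt (∑-tight f g h le i)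

opaque
  guard : Bool → ℕ → ℕ
  guard b x = if b then x else 0

  guard-true : {b : Bool} {x : ℕ} → b ≡ true → guard b x ≡ x
  guard-true refl = refl

  guard-false : {b : Bool} {x : ℕ} → b ≡ false → guard b x ≡ 0
  guard-false refl = refl

  guard-≤ : (b : Bool) {x : ℕ} → guard b x ≤ x
  guard-≤ true = ≤-refl
  guard-≤ false = z≤n

  guard-mono : (b : Bool) {x y : ℕ} → (b ≡ true → x ≤ y) → guard b x ≤ guard b y
  guard-mono true h = h refl
  guard-mono false h = z≤n

  guard-cong : (b : Bool) {x y : ℕ} → (b ≡ true → x ≡ y) → guard b x ≡ guard b y
  guard-cong true h = h refl
  guard-cong false h = refl

  guard-+ : (b : Bool) (x y : ℕ) → guard b (x + y) ≡ guard b x + guard b y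
  guard-+ true x y = refl
  guard-+ false x y = refl

  guard-* : (b : Bool) (x y : ℕ) → guard b (x * y) ≡ x * guard b y
  guard-* true x y = refl
  guard-* false x y = sym (*-zeroʳ x)

  guard-0 : (b : Bool) → guard b 0 ≡ 0
  guard-0 true = refl
  guard-0 false = refl

  guard-swap : (b c : Bool) (x : ℕ) → guard b (guard c x) ≡ guard c (guard b x)
  guard-swap true c x = refl
  guard-swap false c x = sym (guard-0 c)

  guard-& : (b c : Bool) (x : ℕ) → guard (b & c) x ≡ guard b (guard c x)
  guard-& true c x = cong (λ b → guard b x) (&-trueˡ refl)
  guard-& false c x = cong (λ b → guard b x) (&-falseˡ refl)

  guard≡ind* : (b : Bool) (x : ℕ) → guard b x ≡ x * ind b
  guard≡ind* true x = sym (*-identityʳ x)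
  guard≡ind* false x = sym (*-zeroʳ x)

  ind≡guard : (b : Bool) → ind b ≡ guard b 1
  ind≡guard true = refl
  ind≡guard false = refl

  guard-∑ : (b : Bool) (f : Fin n → ℕ) → guard b (∑ f) ≡ ∑ (λ i → guard b (f i))
  guard-∑ true f = refl
  guard-∑ false f = sym (∑-zero (λ _ → 0) (λ _ → refl))

opaque
  ∑⟨_⟩ : (Fin n → Bool) → (Fin n → ℕ) → ℕ
  ∑⟨ p ⟩ f = ∑ (λ i → guard (p i) (f i))

  count : (Fin n → Bool) → ℕ
  count p = ∑ (λ i → ind (p i))

opaque
  unfolding ∑⟨_⟩ count

  _∖_ : (Fin n → Bool) → Fin n → Fin n → Bool
  (p ∖ i) j = p j & ! (j == i)

  ∖⁺ : {p : Fin n → Bool} {i j : Fin n} → p j ≡ true → j ≢ i → (p ∖ i) j ≡ true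
  ∖⁺ e ne = &⁺ e (!⁺ (≢⁺ ne))

  ∖⁻ : {p : Fin n → Bool} {i j : Fin n} → (p ∖ i) j ≡ true → p j ≡ true × j ≢ i
  ∖⁻ e = proj₁ (&⁻ e) , ≢⁻ (!⁻ (proj₂ (&⁻ e)))

  ind≤1 : (b : Bool) → ind b ≤ 1
  ind≤1 true = ≤-refl
  ind≤1 false = z≤n

  ind-mono : {a b : Bool} → (a ≡ true → b ≡ true) → ind a ≤ ind b
  ind-mono {true} h rewrite h refl = ≤-refl
  ind-mono {false} h = z≤n

  count≡∑⟨⟩ : (p : Fin n → Bool) → count p ≡ ∑⟨ p ⟩ (λ _ → 1)
  count≡∑⟨⟩ p = ∑-cong (ind≡guard ∘ p)

  ∑⟨⟩-const : (p : Fin n → Bool) (x : ℕ) → ∑⟨ p ⟩ (λ _ → x) ≡ x * count p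
  ∑⟨⟩-const p x = trans (∑-cong (λ i → guard≡ind* (p i) x)) (∑-*ˡ x (ind ∘ p))

  ∑⟨⟩-* : (p : Fin n → Bool) (x : ℕ) (f : Fin n → ℕ) → ∑⟨ p ⟩ (λ i → x * f i) ≡ x * ∑⟨ p ⟩ f
  ∑⟨⟩-* p x f = trans (∑-cong (λ i → guard-* (p i) x (f i))) (∑-*ˡ x _)

  ∑⟨⟩-+ : (p : Fin n → Bool) (f g : Fin n → ℕ) → ∑⟨ p ⟩ (λ i → f i + g i) ≡ ∑⟨ p ⟩ f + ∑⟨ p ⟩ g
  ∑⟨⟩-+ p f g = trans (∑-cong (λ i → guard-+ (p i) (f i) (g i)))
    (∑-+ (λ i → guard (p i) (f i)) (λ i → guard (p i) (g i)))

  ∑⟨⟩-mono : (p : Fin n → Bool) (f g : Fin n → ℕ) → (∀ i → p i ≡ true → f i ≤ g i) → ∑⟨ p ⟩ f ≤ ∑⟨ p ⟩ g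
  ∑⟨⟩-mono p f g h = ∑-mono _ _ (λ i → guard-mono (p i) (h i))

  ∑⟨⟩-cong : (p : Fin n → Bool) (f g : Fin n → ℕ) → (∀ i → p i ≡ true → f i ≡ g i) → ∑⟨ p ⟩ f ≡ ∑⟨ p ⟩ g
  ∑⟨⟩-cong p f g h = ∑-cong (λ i → guard-cong (p i) (h i))

  ∑⟨⟩-remove : (p : Fin n → Bool) (f : Fin n → ℕ) (i : Fin n) → p i ≡ true →
    ∑⟨ p ⟩ f ≡ f i + ∑⟨ p ∖ i ⟩ f
  ∑⟨⟩-remove p f i pi = trans (∑-cong split) (trans (∑-+ _ _) (cong (_+ ∑⟨ p ∖ i ⟩ f) (trans (∑-pick i _ (λ j ne → guard-false (≢⁺ ne))) (guard-true (==⁺ refl)))))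
    where
    split : ∀ j → guard (p j) (f j) ≡ guard (j == i) (f i) + guard ((p ∖ i) j) (f j)
    split j with bool? (j == i)
    ... | inj₁ e with refl ← ==⁻ {i = j} {i} e = trans (guard-true pi) (sym (trans (cong₂ _+_ (guard-true e) (guard-false (&-falseʳ (!-true e)))) (+-identityʳ (f i))))
    ... | inj₂ e = sym (cong₂ _+_ (guard-false e) (cong (λ b → guard b (f j)) (&-trueʳ (!⁺ e))))

  count-remove : (p : Fin n → Bool) (i : Fin n) → p i ≡ true → count p ≡ suc (count (p ∖ i))
  count-remove p i pi = trans (count≡∑⟨⟩ p) (trans (∑⟨⟩-remove p (λ _ → 1) i pi) (cong suc (sym (count≡∑⟨⟩ (p ∖ i)))))

  count-mono : {p q : Fin n → Bool} → (∀ i → p i ≡ true → q i ≡ true) → count p ≤ count q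
  count-mono h = ∑-mono _ _ (λ i → ind-mono (h i))

  count-mono-< : {p q : Fin n → Bool} → (∀ i → p i ≡ true → q i ≡ true) →
    (i : Fin n) → p i ≡ false → q i ≡ true → count p < count q
  count-mono-< {p = p} {q} h i e e′ = ∑-mono-< _ _ (λ j → ind-mono (h j)) i (strict e e′)
    where
    strict : p i ≡ false → q i ≡ true → ind (p i) < ind (q i)
    strict a b rewrite a | b = ≤-refl

  count≡0 : {p : Fin n → Bool} → (∀ i → p i ≡ false) → count p ≡ 0
  count≡0 h = ∑-zero _ (λ i → cong ind (h i))

  count>0⁻ : (p : Fin n → Bool) → 0 < count p → ∃ λ i → p i ≡ true
  count>0⁻ p lt with search p
  ... | inj₁ x = x
  ... | inj₂ h = ⊥-elim (n≮0 (subst (0 <_) (count≡0 h) lt))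

  count>0⁺ : (p : Fin n → Bool) {i : Fin n} → p i ≡ true → 0 < count p
  count>0⁺ p {i} e = subst (0 <_) (sym (count-remove p i e)) (s≤s z≤n)

  ≤∑⟨⟩ : (p : Fin n → Bool) (f : Fin n → ℕ) {i : Fin n} → p i ≡ true → f i ≤ ∑⟨ p ⟩ f
  ≤∑⟨⟩ p f {i} e = subst (f i ≤_) (sym (∑⟨⟩-remove p f i e)) (m≤m+n _ _)

  count≡1⁻ : (p : Fin n → Bool) → count p ≤ 1 → {i j : Fin n} → p i ≡ true → p j ≡ true → i ≡ j
  count≡1⁻ p le {i} {j} pi pj with i ≟ j
  ... | yes e = e
  ... | no ne = ⊥-elim (<⇒≱ (count>0⁺ (p ∖ i) (∖⁺ {p = p} pj (ne ∘ sym)))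
    (s≤s⁻¹ (subst (_≤ 1) (count-remove p i pi) le)))


  ∑⟨⟩-swap : (p q : Fin n → Bool) (f : Fin n → Fin n → ℕ) →
    ∑⟨ p ⟩ (λ i → ∑⟨ q ⟩ (f i)) ≡ ∑⟨ q ⟩ (λ j → ∑⟨ p ⟩ (λ i → f i j))
  ∑⟨⟩-swap p q f = trans (∑-cong (λ i → guard-∑ (p i) _)) (trans (∑-swap _)
    (∑-cong λ j → trans (∑-cong (λ i → guard-swap (p i) (q j) (f i j))) (sym (guard-∑ (q j) _))))

  ∑⟨⟩-zero : (p : Fin n → Bool) (f : Fin n → ℕ) → (∀ i → p i ≡ true → f i ≡ 0) → ∑⟨ p ⟩ f ≡ 0
  ∑⟨⟩-zero p f h = trans (∑⟨⟩-cong p f (λ _ → 0) h) (∑⟨⟩-const p 0)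

  ∑⟨⟩-even : (p : Fin n → Bool) (f : Fin n → Fin n → ℕ) → (∀ i j → f i j ≡ f j i) → (∀ i → f i i ≡ 0) →
    ∃ λ h → ∑⟨ p ⟩ (λ i → ∑⟨ p ⟩ (f i)) ≡ 2 * h
  ∑⟨⟩-even {n} p f s d with ∑∑-even g g-sym g-diag
    where
    g : Fin n → Fin n → ℕ
    g i j = guard (p i) (guard (p j) (f i j))
    g-sym : ∀ i j → g i j ≡ g j i
    g-sym i j = trans (cong (λ x → guard (p i) (guard (p j) x)) (s i j)) (guard-swap (p i) (p j) (f j i))
    g-diag : ∀ i → g i i ≡ 0
    g-diag i = trans (cong (λ x → guard (p i) (guard (p i) x)) (d i)) (trans (cong (guard (p i)) (guard-0 (p i))) (guard-0 (p i)))
  ... | h , e = h , trans (∑-cong λ i → guard-∑ (p i) _) e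

  _─_ : (Fin n → Bool) → (Fin n → Bool) → Fin n → Bool
  (p ─ q) i = p i & ! (q i)

  ∑⟨⟩-split : (p q : Fin n → Bool) (f : Fin n → ℕ) → (∀ i → q i ≡ true → p i ≡ true) →
    ∑⟨ p ⟩ f ≡ ∑⟨ q ⟩ f + ∑⟨ p ─ q ⟩ f
  ∑⟨⟩-split p q f h = trans (∑-cong split) (∑-+ _ _)
    where
    split : ∀ i → guard (p i) (f i) ≡ guard (q i) (f i) + guard ((p ─ q) i) (f i)
    split i with bool? (q i)
    ... | inj₁ e = trans (guard-true (h i e)) (sym (trans (cong₂ _+_ (guard-true e) (guard-false (&-falseʳ (!-true e)))) (+-identityʳ (f i))))
    ... | inj₂ e = sym (cong₂ _+_ (guard-false e) (cong (λ b → guard b (f i)) (&-trueʳ (!⁺ e))))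

  ∑⟨⟩-⊆ : (p q : Fin n → Bool) (f : Fin n → ℕ) → (∀ i → q i ≡ true → p i ≡ true) → ∑⟨ q ⟩ f ≤ ∑⟨ p ⟩ f
  ∑⟨⟩-⊆ p q f h = subst (∑⟨ q ⟩ f ≤_) (sym (∑⟨⟩-split p q f h)) (m≤m+n _ _)

  ≤∑⟨⟩₂ : (p : Fin n → Bool) (f : Fin n → ℕ) {i j : Fin n} → p i ≡ true → p j ≡ true → i ≢ j →
    f i + f j ≤ ∑⟨ p ⟩ f
  ≤∑⟨⟩₂ p f {i} {j} pi pj ne = subst (f i + f j ≤_) (sym (∑⟨⟩-remove p f i pi))
    (+-monoʳ-≤ (f i) (≤∑⟨⟩ (p ∖ i) f (∖⁺ {p = p} pj (ne ∘ sym))))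

  ≤∑⟨⟩₃ : (p : Fin n → Bool) (f : Fin n → ℕ) {i j k : Fin n} → p i ≡ true → p j ≡ true → p k ≡ true →
    i ≢ j → i ≢ k → j ≢ k → f i + (f j + f k) ≤ ∑⟨ p ⟩ f
  ≤∑⟨⟩₃ p f {i} {j} {k} pi pj pk ij ik jk = subst (f i + (f j + f k) ≤_) (sym (∑⟨⟩-remove p f i pi))
    (+-monoʳ-≤ (f i) (≤∑⟨⟩₂ (p ∖ i) f (∖⁺ {p = p} pj (ij ∘ sym)) (∖⁺ {p = p} pk (ik ∘ sym)) jk))

  count≥2 : (p : Fin n → Bool) {i j : Fin n} → p i ≡ true → p j ≡ true → i ≢ j → 2 ≤ count p
  count≥2 p pi pj ij = subst (2 ≤_) (sym (count≡∑⟨⟩ p)) (≤∑⟨⟩₂ p (λ _ → 1) pi pj ij)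

  count≥3 : (p : Fin n → Bool) {i j k : Fin n} → p i ≡ true → p j ≡ true → p k ≡ true →
    i ≢ j → i ≢ k → j ≢ k → 3 ≤ count p
  count≥3 p pi pj pk ij ik jk = subst (3 ≤_) (sym (count≡∑⟨⟩ p)) (≤∑⟨⟩₃ p (λ _ → 1) pi pj pk ij ik jk)

  count>1⁻ : (p : Fin n → Bool) → 2 ≤ count p → ∃ λ i → ∃ λ j → p i ≡ true × p j ≡ true × i ≢ j
  count>1⁻ p le with count>0⁻ p (≤-trans (s≤s z≤n) le)
  ... | i , pi with count>0⁻ (p ∖ i) (s≤s⁻¹ (subst (2 ≤_) (count-remove p i pi) le))
  ... | j , pj = i , j , pi , proj₁ (∖⁻ {p = p} pj) , proj₂ (∖⁻ {p = p} pj) ∘ sym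

  count>2⁻ : (p : Fin n → Bool) → 3 ≤ count p →
    ∃ λ i → ∃ λ j → ∃ λ k → p i ≡ true × p j ≡ true × p k ≡ true × i ≢ j × i ≢ k × j ≢ k
  count>2⁻ p le with count>0⁻ p (≤-trans (s≤s z≤n) le)
  ... | i , pi with count>1⁻ (p ∖ i) (s≤s⁻¹ (subst (3 ≤_) (count-remove p i pi) le))
  ... | j , k , pj , pk , jk = i , j , k , pi , proj₁ (∖⁻ {p = p} pj) , proj₁ (∖⁻ {p = p} pk)
    , proj₂ (∖⁻ {p = p} pj) ∘ sym , proj₂ (∖⁻ {p = p} pk) ∘ sym , jk

  ∑⟨⟩-def : (p : Fin n → Bool) (f : Fin n → ℕ) → ∑⟨ p ⟩ f ≡ ∑ (λ i → guard (p i) (f i))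
  ∑⟨⟩-def p f = refl

  count-def : (p : Fin n → Bool) → count p ≡ ∑ (λ i → ind (p i))
  count-def p = refl

  ∑⟨⟩≤∑ : (p : Fin n → Bool) (f : Fin n → ℕ) → ∑⟨ p ⟩ f ≤ ∑ f
  ∑⟨⟩≤∑ p f = ∑-mono _ f (λ i → guard-≤ (p i))

  ∑⟨⟩-single : (p : Fin n → Bool) (f : Fin n → ℕ) (j : Fin n) →
    (∀ i → p i ≡ true → i ≢ j → f i ≡ 0) → ∑⟨ p ⟩ f ≤ f j
  ∑⟨⟩-single p f j h = ≤-trans (≤-reflexive (∑-pick j _ vanish)) (guard-≤ (p j))
    where
    vanish : ∀ i → i ≢ j → guard (p i) (f i) ≡ 0
    vanish i ne = trans (guard-cong (p i) (λ e → h i e ne)) (guard-0 (p i))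

  ∑⟨⟩-fibres : {m : ℕ} (h : Fin n → Fin m) (p : Fin n → Bool) (f : Fin n → ℕ) →
    ∑⟨ p ⟩ f ≡ ∑ (λ v → ∑⟨ (λ b → p b & h b == v) ⟩ f)
  ∑⟨⟩-fibres h p f = sym (trans (∑-swap _) (∑-cong λ b → trans (∑-cong (λ v → guard-& (p b) (h b == v) (f b)))
    (trans (∑-pick (h b) _ (λ v ne → trans (cong (guard (p b)) (guard-false (≢⁺ (ne ∘ sym)))) (guard-0 (p b))))
      (cong (guard (p b)) (guard-true (==⁺ refl))))))

  ─⁻ : {p q : Fin n → Bool} {i : Fin n} → (p ─ q) i ≡ true → p i ≡ true × q i ≡ false
  ─⁻ e = proj₁ (&⁻ e) , !⁻ (proj₂ (&⁻ e))

  count-disjoint : {p q s : Fin n → Bool} → (∀ i → p i ≡ true → s i ≡ true) → (∀ i → q i ≡ true → s i ≡ true) →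
    (∀ i → p i ≡ true → q i ≡ true → ⊥) → count p + count q ≤ count s
  count-disjoint {p = p} {q} {s} ps qs dis = ≤-trans (≤-reflexive (sym (∑-+ (ind ∘ p) (ind ∘ q)))) (∑-mono _ _ le)
    where
    le : ∀ i → ind (p i) + ind (q i) ≤ ind (s i)
    le i with bool? (p i)
    ... | inj₁ e rewrite e | ps i e | ¬-true (dis i e) = ≤-refl
    ... | inj₂ e rewrite e = ind-mono (qs i)

  ∑⟨⟩-empty : (p : Fin n → Bool) (f : Fin n → ℕ) → count p ≡ 0 → ∑⟨ p ⟩ f ≡ 0
  ∑⟨⟩-empty p f e = ∑⟨⟩-zero p f (λ i pi → ⊥-elim (n≮0 (≤-trans (count>0⁺ p pi) (≤-reflexive e))))

  ∑⟨⟩-pair : (p : Fin n → Bool) (f : Fin n → ℕ) {i j : Fin n} → count p ≡ 2 → p i ≡ true → p j ≡ true → i ≢ j →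
    ∑⟨ p ⟩ f ≡ f i + f j
  ∑⟨⟩-pair p f {i} {j} c pi pj ij = trans (∑⟨⟩-remove p f i pi) (cong (f i +_) (trans (∑⟨⟩-remove (p ∖ i) f j pj′)
    (trans (cong (f j +_) (∑⟨⟩-empty ((p ∖ i) ∖ j) f rest)) (+-identityʳ (f j)))))
    where
    pj′ : (p ∖ i) j ≡ true
    pj′ = ∖⁺ {p = p} pj (ij ∘ sym)
    rest : count ((p ∖ i) ∖ j) ≡ 0
    rest = cong (_∸ 2) (trans (cong suc (sym (count-remove (p ∖ i) j pj′))) (trans (sym (count-remove p i pi)) c))

  ∑⟨⟩-triple : (p : Fin n → Bool) (f : Fin n → ℕ) {i j k : Fin n} → count p ≡ 3 → p i ≡ true → p j ≡ true → p k ≡ true →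
    i ≢ j → i ≢ k → j ≢ k → ∑⟨ p ⟩ f ≡ f i + (f j + f k)
  ∑⟨⟩-triple p f {i} c pi pj pk ij ik jk = trans (∑⟨⟩-remove p f i pi) (cong (f i +_)
    (∑⟨⟩-pair (p ∖ i) f (cong (_∸ 1) (trans (sym (count-remove p i pi)) c)) (∖⁺ {p = p} pj (ij ∘ sym)) (∖⁺ {p = p} pk (ik ∘ sym)) jk))

  ∑⟨⟩-bound : (p : Fin n → Bool) (f : Fin n → ℕ) (x : ℕ) → (∀ i → p i ≡ true → f i ≤ x) → ∑⟨ p ⟩ f ≤ x * count p
  ∑⟨⟩-bound p f x h = ≤-trans (∑⟨⟩-mono p f (λ _ → x) h) (≤-reflexive (∑⟨⟩-const p x))

  count-&-== : (p : Fin n → Bool) (i : Fin n) → ∑ (λ j → ind (p j & j == i)) ≡ ind (p i)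
  count-&-== p i = trans (∑-pick i _ (λ j ne → cong ind (&-falseʳ (≢⁺ ne)))) (cong ind (&-trueʳ (==⁺ refl)))

  ∑⟨⟩-ind : (p q : Fin n → Bool) → ∑⟨ p ⟩ (λ i → ind (q i)) ≡ count (λ i → p i & q i)
  ∑⟨⟩-ind p q = ∑-cong (λ i → trans (cong (guard (p i)) (ind≡guard (q i))) (trans (sym (guard-& (p i) (q i) 1)) (sym (ind≡guard (p i & q i)))))

  count≤∑⟨⟩ : (p : Fin n → Bool) (f : Fin n → ℕ) → (∀ i → p i ≡ true → 1 ≤ f i) → count p ≤ ∑⟨ p ⟩ f
  count≤∑⟨⟩ p f h = ≤-trans (≤-reflexive (count≡∑⟨⟩ p)) (∑⟨⟩-mono p (λ _ → 1) f h)

  -- A term above 16 still counts 16, and three further terms count at least 1 each; without such a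
  -- term the cap changes nothing. As `16 + 3 = 19`, this is the least cap that works for four
  -- terms.
  ∑⟨⟩-cap : (p : Fin n → Bool) (f : Fin n → ℕ) → 4 ≤ count p → (∀ i → p i ≡ true → 1 ≤ f i) → 19 ≤ ∑⟨ p ⟩ f →
    19 ≤ ∑⟨ p ⟩ (λ i → f i ⊓ 16)
  ∑⟨⟩-cap p f four one le with search (λ i → p i & 17 ≼ f i)
  ... | inj₂ none = ≤-trans le (≤-reflexive (sym (∑⟨⟩-cong p _ f (λ i pi → m≤n⇒m⊓n≡m (s≤s⁻¹ (≰⇒> (λ big → true≢false (&⁺ pi (≼⁺ big)) (none i))))))))
  ... | inj₁ (i , e) with &⁻ e
  ... | pi , big = ≤-trans (+-mono-≤ {16} {f i ⊓ 16} {3} {∑⟨ p ∖ i ⟩ (λ j → f j ⊓ 16)} (≤-reflexive (sym (m≥n⇒m⊓n≡n (≤-trans (m≤m+n 16 1) (≼⁻ big)))))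
      (≤-trans (s≤s⁻¹ (≤-trans four (≤-reflexive (count-remove p i pi)))) (count≤∑⟨⟩ (p ∖ i) (λ j → f j ⊓ 16) (λ j e → ⊓-glb (one j (proj₁ (∖⁻ {p = p} e))) (s≤s z≤n)))))
    (≤-reflexive (sym (∑⟨⟩-remove p (λ j → f j ⊓ 16) i pi)))

-- Sets grown from a root, simple paths and components

opaque
  _∈ᵇ_ : Fin n → List (Fin n) → Bool
  x ∈ᵇ l = does (member? _≟_ x l)

  ∈ᵇ⁺ : {x : Fin n} {l : List (Fin n)} → x ∈ l → x ∈ᵇ l ≡ true
  ∈ᵇ⁺ {x = x} {l} = does⁺ (member? _≟_ x l)

  ∈ᵇ⁻ : {x : Fin n} {l : List (Fin n)} → x ∈ᵇ l ≡ true → x ∈ l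
  ∈ᵇ⁻ {x = x} {l} = does⁻ (member? _≟_ x l)

  ∉ᵇ⁺ : {x : Fin n} {l : List (Fin n)} → x ∉ l → x ∈ᵇ l ≡ false
  ∉ᵇ⁺ {x = x} {l} = ¬does⁺ (member? _≟_ x l)

  ∉ᵇ⁻ : {x : Fin n} {l : List (Fin n)} → x ∈ᵇ l ≡ false → x ∉ l
  ∉ᵇ⁻ {x = x} {l} = ¬does⁻ (member? _≟_ x l)

module _ (R : Fin n → Fin n → Bool) where

  -- Read from the front, such a list is a greedy order: every vertex but the root still has a
  -- related vertex behind it when its turn comes.
  data Grown (w : Fin n) : List (Fin n) → Set where
    root : Grown w (w ∷ [])
    grow : ∀ {x y l} → x ∉ l → y ∈ l → R x y ≡ true → Grown w l → Grown w (x ∷ l)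

  data Chain : Fin n → Fin n → List (Fin n) → Set where
    last : ∀ {x} → Chain x x (x ∷ [])
    link : ∀ {x y z l} → x ∉ l → R x y ≡ true → Chain y z l → Chain x z (x ∷ l)

module _ {R : Fin n → Fin n → Bool} where

  root∈ : ∀ {w l} → Grown R w l → w ∈ l
  root∈ root = here refl
  root∈ (grow _ _ _ g) = there (root∈ g)

  first∈ : ∀ {x y l} → Chain R x y l → x ∈ l
  first∈ last = here refl
  first∈ (link _ _ _) = here refl

  last∈ : ∀ {x y l} → Chain R x y l → y ∈ l
  last∈ last = here refl
  last∈ (link _ _ c) = there (last∈ c)

  chain-to-root : ∀ {w l x} → Grown R w l → x ∈ l →
    ∃ λ l′ → Chain R x w l′ × (∀ {z} → z ∈ l′ → z ∈ l)
  chain-to-root root (here refl) = _ , last , id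
  chain-to-root (grow x∉l y∈l r g) (here refl) with chain-to-root g y∈l
  ... | l′ , c , sub = _ , link (x∉l ∘ sub) r c , λ { (here e) → here e ; (there z) → there (sub z) }
  chain-to-root (grow x∉l y∈l r g) (there x) with chain-to-root g x
  ... | l′ , c , sub = l′ , c , there ∘ sub

  -- Used to shorten a path at `z`. There is no gain in length only if `z` is already the end, so
  -- that case is reported separately.
  prefix : ∀ {x y l z} → Chain R x y l → z ∈ l →
    ∃ λ l′ → Chain R x z l′ × (∀ {t} → t ∈ l′ → t ∈ l) × (length l′ < length l ⊎ z ≡ y)
  prefix last (here refl) = _ , last , id , inj₂ refl
  prefix (link x∉l r c) (here refl) = _ , last , (λ { (here e) → here e }) , inj₁ (s≤s (nonempty c))
    where
    nonempty : ∀ {x y l} → Chain R x y l → 1 ≤ length l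
    nonempty last = s≤s z≤n
    nonempty (link _ _ _) = s≤s z≤n
  prefix (link x∉l r c) (there z) with prefix c z
  ... | l′ , c′ , sub , lt = _ , link (x∉l ∘ sub) r c′
    , (λ { (here e) → here e ; (there t) → there (sub t) }) , [ inj₁ ∘ s≤s , inj₂ ]′ lt

  Closed : (W : Fin n → Bool) → List (Fin n) → Set
  Closed W l = ∀ {x y} → x ∈ l → W y ≡ true → R y x ≡ true → y ∈ l

  closed-chain : ∀ {W l x y l′} → Closed W l → (∀ {z} → z ∈ l′ → W z ≡ true) →
    (∀ a b → R a b ≡ R b a) → Chain R x y l′ → x ∈ l → y ∈ l
  closed-chain cl W′ s last x∈l = x∈l
  closed-chain cl W′ s (link _ r c) x∈l =
    closed-chain cl (W′ ∘ there) s c (cl x∈l (W′ (there (first∈ c))) (trans (s _ _) r))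

  -- The component of `w` in `W`, grown until nothing can be added. The order of growth is kept
  -- because it serves as a greedy order later; `fuel` bounds the vertices of `W` still missing.
  reach : (W : Fin n → Bool) (w : Fin n) → W w ≡ true →
    ∃ λ l → Grown R w l × (∀ {x} → x ∈ l → W x ≡ true) × Closed W l
  reach W w Ww = go (count (λ x → W x & ! (x ∈ᵇ (w ∷ [])))) root (λ { (here refl) → Ww }) ≤-refl
    where
    go : ∀ fuel {l} → Grown R w l → (∀ {x} → x ∈ l → W x ≡ true) → count (λ x → W x & ! (x ∈ᵇ l)) ≤ fuel →
      ∃ λ l → Grown R w l × (∀ {x} → x ∈ l → W x ≡ true) × Closed W l
    go fuel {l} g sub le with search (λ y → (W y & ! (y ∈ᵇ l)) & some (λ x → x ∈ᵇ l & R y x))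
    ... | inj₂ none = l , g , sub , closed
      where
      closed : Closed W l
      closed {x} {y} x∈l Wy r with bool? (y ∈ᵇ l)
      ... | inj₁ e = ∈ᵇ⁻ e
      ... | inj₂ e = ⊥-elim (true≢false (&⁺ (&⁺ Wy (!⁺ e)) (some⁺ x (&⁺ (∈ᵇ⁺ x∈l) r))) (none y))
    go zero {l} g sub le | inj₁ (y , e) = ⊥-elim (n≮0 (≤-trans (count>0⁺ _ (proj₁ (&⁻ e))) le))
    go (suc fuel) {l} g sub le | inj₁ (y , e) with &⁻ e
    ... | e₁ , e₂ with &⁻ e₁ | some⁻ e₂
    ... | Wy , y∉ | x , e₃ = go fuel {y ∷ l} (grow (∉ᵇ⁻ (!⁻ y∉)) (∈ᵇ⁻ (proj₁ (&⁻ e₃))) (proj₂ (&⁻ e₃)) g)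
      (λ { (here refl) → Wy ; (there z) → sub z })
      (s≤s⁻¹ (≤-trans (count-mono-< shrink y
        (&-falseʳ (!-true (∈ᵇ⁺ (here refl)))) e₁) le))
      where
      shrink : ∀ z → W z & ! (z ∈ᵇ (y ∷ l)) ≡ true → W z & ! (z ∈ᵇ l) ≡ true
      shrink z h = &⁺ (proj₁ (&⁻ h)) (!⁺ (∉ᵇ⁺ (∉ᵇ⁻ (!⁻ (proj₂ (&⁻ h))) ∘ there)))

-- Weighing links against hubs

module Bads (T : Fin n → Bool) (hub : Fin n → Fin n) (Q : Fin n → Fin n → Bool)
  (Q-sym : ∀ b c → Q b c ≡ Q c b)
  (Q⇒T : ∀ {b c} → Q b c ≡ true → T b ≡ true)
  (Q⇒hub : ∀ {b c} → Q b c ≡ true → hub b ≢ hub c)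
  (Q-deg : ∀ b → count (Q b) ≤ 2) where

  Q-swap : ∀ {b c} → Q b c ≡ true → Q c b ≡ true
  Q-swap = trans (Q-sym _ _)

  -- On bad vertices this is the relation of seeing each other: those with a common hub see each
  -- other through it.
  γ : Fin n → Fin n → Bool
  γ b c = ! (b == c) & ((hub b == hub c) || Q b c)

  γ-hub : ∀ {b c} → b ≢ c → hub b ≡ hub c → γ b c ≡ true
  γ-hub ne e = &⁺ (!⁺ (≢⁺ ne)) (||⁺ˡ (==⁺ e))

  γ-Q : ∀ {b c} → Q b c ≡ true → γ b c ≡ true
  γ-Q {b} {c} q = &⁺ (!⁺ (≢⁺ λ e → Q⇒hub q (cong hub e))) (||⁺ʳ q)

  γ⁻ : ∀ {b c} → γ b c ≡ true → b ≢ c × (hub b ≡ hub c ⊎ Q b c ≡ true)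
  γ⁻ {b} {c} e with &⁻ e
  ... | ne , h = ≢⁻ (!⁻ ne) , [ inj₁ ∘ ==⁻ , inj₂ ]′ (||⁻ h)

  γ-cross : ∀ {b c} → γ b c ≡ true → hub b ≢ hub c → Q b c ≡ true
  γ-cross g ne with γ⁻ g
  ... | _ , inj₁ e = ⊥-elim (ne e)
  ... | _ , inj₂ q = q

  γ-sym : ∀ b c → γ b c ≡ γ c b
  γ-sym b c = bool-ext (half b c) (half c b)
    where
    half : ∀ b c → γ b c ≡ true → γ c b ≡ true
    half b c g with γ⁻ g
    ... | ne , inj₁ e = γ-hub (ne ∘ sym) (sym e)
    ... | ne , inj₂ q = γ-Q (Q-swap q)

  deg : Fin n → ℕ
  deg b = count (Q b)

  iso : Fin n → Fin n → Bool
  iso b c = (deg b ≐ 1) & (deg c ≐ 1)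

  -- Both ends of an isolated link take two units from the pot, hence the weight 2; rows still sum to at most 2.
  m : Fin n → Fin n → ℕ
  m b c = guard (Q b c) (if iso b c then 2 else 1)

  -- Excluded by a greedy colouring of l in which u comes first and w last: u has three neighbours in l, w at most one.
  GreedyFree : Set
  GreedyFree = ∀ {u w p y z l} → Grown γ w l → (∀ {x} → x ∈ l → T x ≡ true) → T u ≡ true → u ∉ l →
    γ u w ≡ true → y ∈ l → Q u y ≡ true → z ∈ l → γ u z ≡ true → y ≢ z → w ≢ y → w ≢ z →
    (∀ {x} → x ∈ l → γ w x ≡ true → x ≡ p) → ⊥

  m-sym : ∀ b c → m b c ≡ m c b
  m-sym b c rewrite Q-sym b c | &-comm (deg b ≐ 1) (deg c ≐ 1) = refl

  m-no : ∀ {b c} → Q b c ≡ false → m b c ≡ 0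
  m-no e = guard-false e

  m-row : ∀ b → ∑ (m b) ≤ 2
  m-row b = subst (_≤ 2) (∑⟨⟩-def (Q b) _) (le (bool? (deg b ≐ 1)))
    where
    weight≤2 : ∀ x → (if x then 2 else 1) ≤ 2
    weight≤2 true = ≤-refl
    weight≤2 false = s≤s z≤n
    le : deg b ≐ 1 ≡ true ⊎ deg b ≐ 1 ≡ false → ∑⟨ Q b ⟩ (λ c → if iso b c then 2 else 1) ≤ 2
    le (inj₁ e) = ≤-trans (∑⟨⟩-mono (Q b) _ (λ _ → 2) (λ c _ → weight≤2 (iso b c)))
      (≤-reflexive (trans (∑⟨⟩-const (Q b) 2) (cong (2 *_) (≐⁻ e))))
    le (inj₂ e) = subst (_≤ 2) (trans (count≡∑⟨⟩ (Q b)) (∑⟨⟩-cong (Q b) _ _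
      (λ c _ → cong (λ x → if x then 2 else 1) (sym (&-falseˡ e))))) (Q-deg b)

  module _ (greedy : GreedyFree) where

    -- The path closes up at the hub v to a cycle with the chord w; it is shortened until w has no link into it.
    no-path : ∀ fuel {v x y a a′ w l} → Chain γ x y l → length l ≤ fuel →
      (∀ {z} → z ∈ l → T z ≡ true × hub z ≢ v) →
      hub a ≡ v → hub a′ ≡ v → hub w ≡ v → T a ≡ true → T a′ ≡ true → T w ≡ true →
      a ≢ a′ → a ≢ w → a′ ≢ w → Q a′ x ≡ true → Q a y ≡ true → ⊥
    no-path zero last ()
    no-path zero (link _ _ _) ()
    no-path (suc fuel) {v} {x} {y} {a} {a′} {w} {l} c le sub ha ha′ hw Ta Ta′ Tw aa′ aw a′w qx qy
      with search (λ z → z ∈ᵇ l & Q w z)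
    -- Among the uncoloured vertices `a′` sees `x`, `a` and `w`, whereas `w`, having no link into
    -- the path, sees only `a` in the list.
    ... | inj₂ none = greedy {a′} {w} {a} {x} {a} (grown c (proj₂ ∘ sub) (Q-swap qy)) T-all Ta′ a′∉
      (γ-hub a′w (trans ha′ (sym hw))) (∈-++⁺ˡ (first∈ c)) qx (∈-++⁺ʳ l (here refl))
      (γ-hub (aa′ ∘ sym) (trans ha′ (sym ha)))
      (λ e → proj₂ (sub (first∈ c)) (trans (cong hub e) ha)) (λ e → proj₂ (sub (first∈ c)) (trans (cong hub (sym e)) hw))
      (aw ∘ sym) only
      where
      grown : ∀ {x l} → Chain γ x y l → (∀ {z} → z ∈ l → hub z ≢ v) → Q y a ≡ true →
        Grown γ w (l ++ a ∷ w ∷ [])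
      grown last out q = grow (λ { (here e) → out (here refl) (trans (cong hub e) ha)
          ; (there (here e)) → out (here refl) (trans (cong hub e) hw) })
        (here refl) (γ-Q q) (grow (λ { (here e) → aw e }) (here refl) (γ-hub aw (trans ha (sym hw))) root)
      grown (link {x} {l = l} x∉ r c) out q = grow x∉′ (∈-++⁺ˡ (first∈ c)) r (grown c (out ∘ there) q)
        where
        x∉′ : x ∉ (l ++ a ∷ w ∷ [])
        x∉′ i with ∈-++⁻ l i
        ... | inj₁ j = x∉ j
        ... | inj₂ (here e) = out (here refl) (trans (cong hub e) ha)
        ... | inj₂ (there (here e)) = out (here refl) (trans (cong hub e) hw)
      T-all : ∀ {z} → z ∈ l ++ a ∷ w ∷ [] → T z ≡ true
      T-all i with ∈-++⁻ l i
      ... | inj₁ j = proj₁ (sub j)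
      ... | inj₂ (here refl) = Ta
      ... | inj₂ (there (here refl)) = Tw
      a′∉ : a′ ∉ l ++ a ∷ w ∷ []
      a′∉ i with ∈-++⁻ l i
      ... | inj₁ j = proj₂ (sub j) ha′
      ... | inj₂ (here e) = aa′ (sym e)
      ... | inj₂ (there (here e)) = a′w e
      only : ∀ {z} → z ∈ l ++ a ∷ w ∷ [] → γ w z ≡ true → z ≡ a
      only {z} i g with ∈-++⁻ l i
      ... | inj₁ j = ⊥-elim (true≢false (&⁺ (∈ᵇ⁺ j) (γ-cross g λ e → proj₂ (sub j) (trans (sym e) hw))) (none z))
      ... | inj₂ (here e) = e
      ... | inj₂ (there (here e)) = ⊥-elim (proj₁ (γ⁻ g) (sym e))
    ... | inj₁ (z , e) with &⁻ e
    ... | z∈ᵇ , qz with prefix c (∈ᵇ⁻ z∈ᵇ)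
    -- The shorter path joins `a′` to `w`, and `a` takes over as the chord.
    ... | l′ , c′ , sub′ , inj₁ lt = no-path fuel c′ (s≤s⁻¹ (≤-trans lt le)) (sub ∘ sub′) hw ha′ ha Tw Ta′ Ta
      (a′w ∘ sym) (aw ∘ sym) (aa′ ∘ sym) qx qz
    ... | l′ , c′ , sub′ , inj₂ refl with c
    -- The path is one vertex, linked to all of `a′`, `a` and `w`: one link too many.
    ... | last = <⇒≱ (count≥3 (Q x) (Q-swap qx) (Q-swap qy) (Q-swap qz) (aa′ ∘ sym) a′w aw) (Q-deg x)
    -- Here `w` is linked to the last vertex `y`, so `y` alone is a path between `a` and `w`, with
    -- `a′` as the chord. It is shorter since the old path has at least two vertices.
    ... | link _ _ c″ = no-path fuel {l = y ∷ []} last (s≤s⁻¹ (≤-trans (s≤s (len c″)) le)) (λ { (here refl) → sub (there (last∈ c″)) })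
      ha hw ha′ Ta Tw Ta′ aw aa′ (a′w ∘ sym) qz qy
      where
      len : ∀ {x y l} → Chain γ x y l → 1 ≤ length l
      len last = s≤s z≤n
      len (link _ _ _) = s≤s z≤n

  r : (Fin n → Bool) → Fin n → ℕ
  r A b = ∑⟨ A ⟩ (m b)

  E : (Fin n → Bool) → ℕ
  E A = ∑⟨ A ⟩ (r A)

  H : (Fin n → Bool) → Fin n → Bool
  H A v = some (λ b → A b & hub b == v)

  out : (Fin n → Bool) → (Fin n → Bool) → ℕ
  out Y A = ∑⟨ Y ⟩ (r (A ─ Y))

  H⁺ : ∀ {A b} → A b ≡ true → H A (hub b) ≡ true
  H⁺ Ab = some⁺ _ (&⁺ Ab (==⁺ refl))

  H⁻ : ∀ {A v} → H A v ≡ true → ∃ λ b → A b ≡ true × hub b ≡ v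
  H⁻ h with some⁻ h
  ... | b , e = b , proj₁ (&⁻ e) , ==⁻ (proj₂ (&⁻ e))

  r≤2 : ∀ A b → r A b ≤ 2
  r≤2 A b = ≤-trans (∑⟨⟩≤∑ A (m b)) (m-row b)

  m≥1 : ∀ {b c} → Q b c ≡ true → 1 ≤ m b c
  m≥1 {b} {c} q = subst (1 ≤_) (sym (guard-true q)) (weight≥1 (iso b c))
    where
    weight≥1 : ∀ x → 1 ≤ (if x then 2 else 1)
    weight≥1 true = s≤s z≤n
    weight≥1 false = s≤s z≤n

  r-split : ∀ {A Y} → (∀ b → Y b ≡ true → A b ≡ true) → ∀ b → r A b ≡ r Y b + r (A ─ Y) b
  r-split {A} {Y} sub b = ∑⟨⟩-split A Y (m b) sub

  E-split : ∀ {A Y} → (∀ b → Y b ≡ true → A b ≡ true) → E A ≡ (E Y + 2 * out Y A) + E (A ─ Y)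
  E-split {A} {Y} sub = begin
    E A
      ≡⟨ ∑⟨⟩-split A Y (r A) sub ⟩
    ∑⟨ Y ⟩ (r A) + ∑⟨ A ─ Y ⟩ (r A)
      ≡⟨ cong₂ _+_ (∑⟨⟩-cong Y _ _ (λ b _ → r-split sub b)) (∑⟨⟩-cong (A ─ Y) _ _ (λ b _ → r-split sub b)) ⟩
    ∑⟨ Y ⟩ (λ b → r Y b + r (A ─ Y) b) + ∑⟨ A ─ Y ⟩ (λ b → r Y b + r (A ─ Y) b)
      ≡⟨ cong₂ _+_ (∑⟨⟩-+ Y _ _) (∑⟨⟩-+ (A ─ Y) _ _) ⟩
    (E Y + out Y A) + (∑⟨ A ─ Y ⟩ (r Y) + E (A ─ Y))
      ≡⟨ cong (λ x → (E Y + out Y A) + (x + E (A ─ Y))) back ⟩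
    (E Y + out Y A) + (out Y A + E (A ─ Y))
      ≡⟨ solve 3 (λ e o f → (e :+ o) :+ (o :+ f) := (e :+ con 2 :* o) :+ f) refl (E Y) (out Y A) (E (A ─ Y)) ⟩
    (E Y + 2 * out Y A) + E (A ─ Y) ∎
    where
    open ≡-Reasoning
    back : ∑⟨ A ─ Y ⟩ (r Y) ≡ out Y A
    back = trans (∑⟨⟩-swap (A ─ Y) Y m) (∑⟨⟩-cong Y _ _ (λ b _ → ∑⟨⟩-cong (A ─ Y) _ _ (λ c _ → m-sym c b)))

  E-even : ∀ A → ∃ λ h → E A ≡ 2 * h
  E-even A = ∑⟨⟩-even A m m-sym (λ b → m-no (no-loop b))
    where
    no-loop : ∀ b → Q b b ≡ false
    no-loop b with bool? (Q b b)
    ... | inj₁ q = ⊥-elim (Q⇒hub q refl)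
    ... | inj₂ q = q

  -- E counts ordered pairs, so out Y A enters twice.
  record Payable (A : Fin n → Bool) : Set where
    field
      Y : Fin n → Bool
      Y⊆A : ∀ b → Y b ≡ true → A b ≡ true
      inhabited : ∃ λ b → Y b ≡ true
      saturated : ∀ {b c} → Y b ≡ true → A c ≡ true → hub c ≡ hub b → Y c ≡ true
      paid : E Y + 2 * out Y A ≤ 4 * count (H Y)

  fibre : (Fin n → Bool) → Fin n → Fin n → Bool
  fibre A v b = A b & hub b == v

  -- Both `e` and `4 * h` are even. So for `o = 1` the given bound is never sharp, and for `o = 2`
  -- it is sharp or leaves room for 2 more. Apart from the sharp case this yields the second `o`
  -- that a payment requires.
  even-slack : ∀ {e s o h} → e ≡ 2 * s → e + o ≤ 4 * h → o ≤ 2 →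
    e + 2 * o ≤ 4 * h ⊎ (o ≡ 2 × e + o ≡ 4 * h)
  even-slack {e} {o = 0} eq le o≤2 = inj₁ le
  even-slack {s = s} {o = 1} {h} refl le o≤2 = inj₁ (≤-trans (≤-reflexive (solve 1 (λ s → con 2 :* s :+ con 2 := con 2 :* (con 1 :+ s)) refl s))
    (≤-trans (*-monoʳ-≤ 2 (*-cancelˡ-< 2 s (2 * h) (lt le))) (≤-reflexive (solve 1 (λ h → con 2 :* (con 2 :* h) := con 4 :* h) refl h))))
    where
    lt : 2 * s + 1 ≤ 4 * h → 2 * s < 2 * (2 * h)
    lt le = ≤-trans (≤-reflexive (+-comm 1 (2 * s))) (≤-trans le (≤-reflexive (solve 1 (λ h → con 4 :* h := con 2 :* (con 2 :* h)) refl h)))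
  even-slack {s = s} {o = 2} {h} refl le o≤2 with 2 * s + 2 ≟ℕ 4 * h
    where open import Data.Nat using () renaming (_≟_ to _≟ℕ_)
  ... | yes eq = inj₂ (refl , eq)
  ... | no ne = inj₁ (≤-trans (≤-reflexive (solve 1 (λ s → con 2 :* s :+ con 4 := con 2 :* (con 2 :+ s)) refl s))
    (≤-trans (*-monoʳ-≤ 2 (*-cancelˡ-< 2 (suc s) (2 * h) lt)) (≤-reflexive (solve 1 (λ h → con 2 :* (con 2 :* h) := con 4 :* h) refl h))))
    where
    lt : 2 * suc s < 2 * (2 * h)
    lt = ≤-trans (≤-reflexive (cong suc (solve 1 (λ s → con 2 :* (con 1 :+ s) := con 2 :* s :+ con 2) refl s)))
      (≤-trans (≤∧≢⇒< le ne) (≤-reflexive (solve 1 (λ h → con 4 :* h := con 2 :* (con 2 :* h)) refl h)))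
  even-slack {o = suc (suc (suc _))} eq le (s≤s (s≤s ()))

  row-sum : ∀ {A Y} → (∀ b → Y b ≡ true → A b ≡ true) → E Y + out Y A ≡ ∑⟨ Y ⟩ (r A)
  row-sum {A} {Y} sub = trans (sym (∑⟨⟩-+ Y (r Y) (r (A ─ Y)))) (∑⟨⟩-cong Y _ _ (λ b _ → sym (r-split sub b)))

  module _ {A Y : Fin n → Bool} (small : ∀ v → H Y v ≡ true → count (fibre A v) ≤ 2)
    (Y⊆A : ∀ b → Y b ≡ true → A b ≡ true) where

    -- At most two bad vertices per hub, with links of weight at most 2 each.
    fibre-sum : ∀ v → ∑⟨ fibre Y v ⟩ (r A) ≤ 4 * ind (H Y v)
    fibre-sum v with bool? (H Y v)
    ... | inj₂ no-hub = ≤-trans (≤-reflexive (∑⟨⟩-zero (fibre Y v) (r A)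
      (λ b e → ⊥-elim (true≢false (some⁺ b e) no-hub)))) z≤n
    ... | inj₁ h = begin
      ∑⟨ fibre Y v ⟩ (r A)         ≤⟨ ∑⟨⟩-mono (fibre Y v) (r A) (λ _ → 2) (λ b _ → r≤2 A b) ⟩
      ∑⟨ fibre Y v ⟩ (λ _ → 2)     ≡⟨ ∑⟨⟩-const (fibre Y v) 2 ⟩
      2 * count (fibre Y v)        ≤⟨ *-monoʳ-≤ 2 (count-mono (λ b e → &⁺ (Y⊆A b (proj₁ (&⁻ e))) (proj₂ (&⁻ e)))) ⟩
      2 * count (fibre A v)        ≤⟨ *-monoʳ-≤ 2 (small v h) ⟩
      4                            ≡⟨ cong (λ x → 4 * ind x) (sym h) ⟩
      4 * ind (H Y v)              ∎
      where open ≤-Reasoning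

    hubs-sum : ∑ (λ v → 4 * ind (H Y v)) ≡ 4 * count (H Y)
    hubs-sum = trans (∑-*ˡ 4 _) (cong (4 *_) (sym (count-def (H Y))))

    row-sum≤ : E Y + out Y A ≤ 4 * count (H Y)
    row-sum≤ = subst₂ _≤_ (trans (sym (∑⟨⟩-fibres hub Y (r A))) (sym (row-sum Y⊆A))) hubs-sum (∑-mono _ _ fibre-sum)

    -- Equality in total forces equality at every hub, and 4 is reached only by two bad vertices of
    -- weight 2 each.
    tight-fibre : E Y + out Y A ≡ 4 * count (H Y) → ∀ {z} → Y z ≡ true →
      r A z ≡ 2 × ∃ λ z′ → Y z′ ≡ true × hub z′ ≡ hub z × z′ ≢ z
    tight-fibre eq {z} Yz = r≡2 , mate (count>0⁻ (p ∖ z) (≰⇒> λ le → <⇒≱ (s≤s (s≤s (s≤s z≤n)))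
      (≤-trans (≤-reflexive (sym total)) (≤-trans (+-mono-≤ (r≤2 A z) (≤-trans rest-le (*-monoʳ-≤ 2 le))) (≤-reflexive refl)))))
      where
      p : Fin n → Bool
      p = fibre Y (hub z)
      pz : p z ≡ true
      pz = &⁺ Yz (==⁺ refl)
      total : r A z + ∑⟨ p ∖ z ⟩ (r A) ≡ 4
      total = trans (sym (∑⟨⟩-remove p (r A) z pz)) (trans (∑-tight _ _ fibre-sum
        (≤-reflexive (trans hubs-sum (trans (sym eq) (trans (row-sum Y⊆A) (∑⟨⟩-fibres hub Y (r A)))))) (hub z))
        (cong (λ x → 4 * ind x) (H⁺ Yz)))
      rest-le : ∑⟨ p ∖ z ⟩ (r A) ≤ 2 * count (p ∖ z)
      rest-le = ≤-trans (∑⟨⟩-mono (p ∖ z) (r A) (λ _ → 2) (λ b _ → r≤2 A b)) (≤-reflexive (∑⟨⟩-const (p ∖ z) 2))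
      count≤1 : count (p ∖ z) ≤ 1
      count≤1 = s≤s⁻¹ (≤-trans (≤-reflexive (sym (count-remove p z pz)))
        (≤-trans (count-mono (λ b e → &⁺ (Y⊆A b (proj₁ (&⁻ e))) (proj₂ (&⁻ e)))) (small (hub z) (H⁺ Yz))))
      r≡2 : r A z ≡ 2
      r≡2 = ≤-antisym (r≤2 A z) (+-cancelʳ-≤ 2 2 (r A z) (≤-trans (≤-reflexive (sym total))
        (+-monoʳ-≤ (r A z) (≤-trans rest-le (*-monoʳ-≤ 2 count≤1)))))
      mate : (∃ λ z′ → (p ∖ z) z′ ≡ true) → ∃ λ z′ → Y z′ ≡ true × hub z′ ≡ hub z × z′ ≢ z
      mate (z′ , e) with ∖⁻ e
      ... | pz′ , ne = z′ , proj₁ (&⁻ pz′) , ==⁻ (proj₂ (&⁻ pz′)) , ne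

  module Separation (greedy : GreedyFree) {A : Fin n → Bool} (A⊆T : ∀ {b} → A b ≡ true → T b ≡ true)
    (linked : ∀ {b} → A b ≡ true → ∃ λ c → A c ≡ true × Q b c ≡ true) where

    -- β may lie in K, and then nothing joins K to the rest of A.
    record Separated (K : Fin n → Bool) (β : Fin n) : Set where
      field
        K⊆A : ∀ {b} → K b ≡ true → A b ≡ true
        β∈A : A β ≡ true
        member : ∃ λ b → K b ≡ true
        closed : ∀ {b c} → K b ≡ true → A c ≡ true → γ b c ≡ true → K c ≡ true ⊎ c ≡ β

    -- Minimality of `K` enters as an induction hypothesis: any separated set strictly inside `K`
    -- already yields a payable block of the same `A`.
    Smaller : (Fin n → Bool) → Set
    Smaller K = ∀ {K′ β′} → (∀ {b} → K′ b ≡ true → K b ≡ true) → (∃ λ b → K b ≡ true × K′ b ≡ false) →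
      Separated K′ β′ → Payable A

    module _ {K : Fin n → Bool} {β : Fin n} (S : Separated K β) (smaller : Smaller K) where
      open Separated S

      shared : Bool
      shared = some (λ u → K u & hub u == hub β)

      -- Bad vertices with a common hub are related by `γ`, so `β` is the only one outside `K` that
      -- can share a hub with `K`. Adding it in that case makes the set saturated.
      Y : Fin n → Bool
      Y b = K b || (shared & b == β)

      K⊆Y : ∀ {b} → K b ≡ true → Y b ≡ true
      K⊆Y = ||⁺ˡ

      Y⁻ : ∀ {b} → Y b ≡ true → K b ≡ true ⊎ (shared ≡ true × b ≡ β)
      Y⁻ e with ||⁻ e
      ... | inj₁ k = inj₁ k
      ... | inj₂ d = inj₂ (proj₁ (&⁻ d) , ==⁻ (proj₂ (&⁻ d)))

      Y⊆A : ∀ b → Y b ≡ true → A b ≡ true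
      Y⊆A b y with Y⁻ y
      ... | inj₁ k = K⊆A k
      ... | inj₂ (_ , refl) = β∈A

      β∈Y : shared ≡ true → Y β ≡ true
      β∈Y d = ||⁺ʳ (&⁺ d (==⁺ refl))

      saturated-K : ∀ {b c} → K b ≡ true → A c ≡ true → hub c ≡ hub b → Y c ≡ true
      saturated-K {b} {c} k a h with c ≟ b
      ... | yes refl = K⊆Y k
      ... | no ne with closed k a (γ-hub (ne ∘ sym) (sym h))
      ... | inj₁ k′ = K⊆Y k′
      ... | inj₂ refl = β∈Y (some⁺ b (&⁺ k (==⁺ (sym h))))

      saturated : ∀ {b c} → Y b ≡ true → A c ≡ true → hub c ≡ hub b → Y c ≡ true
      saturated y a h with Y⁻ y
      ... | inj₁ k = saturated-K k a h
      ... | inj₂ (d , refl) with some⁻ d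
      ... | u , e = saturated-K (proj₁ (&⁻ e)) a (trans h (sym (==⁻ (proj₂ (&⁻ e)))))

      payable : E Y + 2 * out Y A ≤ 4 * count (H Y) → Payable A
      payable p = record { Y = Y ; Y⊆A = Y⊆A ; inhabited = proj₁ member , K⊆Y (proj₂ member)
        ; saturated = saturated ; paid = p }

      -- Of two bads of the hub that lie in K, the branch of one avoids β and is separated by that bad alone.
      module Crowded {v a₁ a₂ a₃ : Fin n} (K₁ : K a₁ ≡ true) (K₂ : K a₂ ≡ true) (A₃ : A a₃ ≡ true)
        (h₁ : hub a₁ ≡ v) (h₂ : hub a₂ ≡ v) (h₃ : hub a₃ ≡ v) (≢₁₂ : a₁ ≢ a₂) (≢₁₃ : a₁ ≢ a₃) (≢₂₃ : a₂ ≢ a₃) where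

        W : Fin n → Bool
        W x = (A x & (K x || x == β)) & ! (hub x == v)

        W⁺ : ∀ {x} → A x ≡ true → K x ≡ true ⊎ x ≡ β → hub x ≢ v → W x ≡ true
        W⁺ a (inj₁ k) h = &⁺ (&⁺ a (||⁺ˡ k)) (!⁺ (≢⁺ h))
        W⁺ a (inj₂ e) h = &⁺ (&⁺ a (||⁺ʳ (==⁺ e))) (!⁺ (≢⁺ h))

        W⁻ : ∀ {x} → W x ≡ true → A x ≡ true × (K x ≡ true ⊎ x ≡ β) × hub x ≢ v
        W⁻ e with &⁻ e
        ... | e₁ , e₂ with &⁻ e₁
        ... | a , k = a , [ inj₁ , inj₂ ∘ ==⁻ ]′ (||⁻ k) , ≢⁻ (!⁻ e₂)

        third : ∀ {a c} → a ≢ c → A a ≡ true → A c ≡ true → hub a ≡ v → hub c ≡ v →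
          ∃ λ w → A w ≡ true × hub w ≡ v × w ≢ a × w ≢ c
        third {a} {c} ne Aa Ac ha hc = choose (count>0⁻ ((fibre A v ∖ a) ∖ c) (s≤s⁻¹ (s≤s⁻¹ (≤-trans
            (count≥3 (fibre A v) (in-fibre (K⊆A K₁) h₁) (in-fibre (K⊆A K₂) h₂) (in-fibre A₃ h₃) ≢₁₂ ≢₁₃ ≢₂₃)
            (≤-reflexive (trans (count-remove (fibre A v) a (in-fibre Aa ha))
              (cong suc (count-remove (fibre A v ∖ a) c (∖⁺ {p = fibre A v} (in-fibre Ac hc) (ne ∘ sym))))))))))
          where
          in-fibre : ∀ {b} → A b ≡ true → hub b ≡ v → fibre A v b ≡ true
          in-fibre Ab h = &⁺ Ab (==⁺ h)
          choose : (∃ λ w → ((fibre A v ∖ a) ∖ c) w ≡ true) → ∃ λ w → A w ≡ true × hub w ≡ v × w ≢ a × w ≢ c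
          choose (w , e) with ∖⁻ e
          ... | e′ , w≢c with ∖⁻ e′
          ... | e″ , w≢a = w , proj₁ (&⁻ e″) , ==⁻ (proj₂ (&⁻ e″)) , w≢a , w≢c

        record Branch (a : Fin n) : Set where
          field
            z : Fin n
            l : List (Fin n)
            grown : Grown γ z l
            sub : ∀ {x} → x ∈ l → W x ≡ true
            full : Closed {R = γ} W l
            a-z : Q a z ≡ true
            private-to-a : ∀ {x c} → x ∈ l → A c ≡ true → hub c ≡ v → Q x c ≡ true → c ≡ a
            reaches-β : β ∈ l

        -- A link from the branch to a second bad vertex at `v` would give a path that `no-path`
        -- excludes, a third bad vertex at `v` being the chord. Hence a branch that misses `β` is a
        -- smaller set, separated by `a`.
        branch : ∀ {a} → K a ≡ true → hub a ≡ v → Payable A ⊎ Branch a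
        branch {a} Ka ha with linked (K⊆A Ka)
        ... | z , Az , qz with reach {R = γ} W z (W⁺ Az (closed Ka Az (γ-Q qz)) (λ h → Q⇒hub qz (trans ha (sym h))))
        ... | l , grown , sub , full with search (λ x → x ∈ᵇ l & some (λ c → (A c & hub c == v) & (Q x c & ! (c == a))))
        ... | inj₁ (x , e) = ⊥-elim touch
          where
          touch : ⊥
          touch with &⁻ e
          ... | x∈ , e₁ with some⁻ e₁
          ... | c , e₂ with &⁻ e₂
          ... | e₃ , e₄ with &⁻ e₃ | &⁻ e₄ | chain-to-root grown (∈ᵇ⁻ x∈)
          ... | Ac , hc | qxc , c≢a | l′ , chain , sub′ with third (≢⁻ (!⁻ c≢a)) Ac (K⊆A Ka) (==⁻ hc) ha
          ... | w , Aw , hw , w≢c , w≢a = no-path greedy (length l′) chain ≤-refl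
            (λ t → A⊆T (proj₁ (W⁻ (sub (sub′ t)))) , proj₂ (proj₂ (W⁻ (sub (sub′ t)))))
            ha (==⁻ hc) hw (A⊆T (K⊆A Ka)) (A⊆T Ac) (A⊆T Aw) (≢⁻ (!⁻ c≢a) ∘ sym) (w≢a ∘ sym) (w≢c ∘ sym) (Q-swap qxc) qz
        ... | inj₂ none with bool? (β ∈ᵇ l)
        ... | inj₁ β∈ = inj₂ record { z = z ; l = l ; grown = grown ; sub = sub ; full = full ; a-z = qz
            ; private-to-a = private-to-a ; reaches-β = ∈ᵇ⁻ β∈ }
          where
          private-to-a : ∀ {x c} → x ∈ l → A c ≡ true → hub c ≡ v → Q x c ≡ true → c ≡ a
          private-to-a {x} {c} x∈ Ac hc q with c ≟ a
          ... | yes e = e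
          ... | no ne = ⊥-elim (true≢false (&⁺ (∈ᵇ⁺ x∈) (some⁺ c (&⁺ (&⁺ Ac (==⁺ hc)) (&⁺ q (!⁺ (≢⁺ ne)))))) (none x))
        ... | inj₂ β∉ = inj₁ (smaller {λ x → x ∈ᵇ l} {a} (in-K ∘ ∈ᵇ⁻)
            (a , Ka , ∉ᵇ⁺ (λ i → proj₂ (proj₂ (W⁻ (sub i))) ha))
            record { K⊆A = λ x∈ → proj₁ (W⁻ (sub (∈ᵇ⁻ x∈))) ; β∈A = K⊆A Ka ; member = z , ∈ᵇ⁺ (root∈ grown) ; closed = closed′ })
          where
          in-K : ∀ {x} → x ∈ l → K x ≡ true
          in-K i with proj₁ (proj₂ (W⁻ (sub i)))
          ... | inj₁ k = k
          ... | inj₂ refl = ⊥-elim (∉ᵇ⁻ β∉ i)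
          closed′ : ∀ {x c} → x ∈ᵇ l ≡ true → A c ≡ true → γ x c ≡ true → c ∈ᵇ l ≡ true ⊎ c ≡ a
          closed′ {x} {c} x∈ Ac g with hub c ≟ v
          ... | no ne = inj₁ (∈ᵇ⁺ (full (∈ᵇ⁻ x∈) (W⁺ Ac (closed (in-K (∈ᵇ⁻ x∈)) Ac g) ne) (trans (γ-sym c x) g)))
          ... | yes hc with c ≟ a
          ... | yes e = inj₂ e
          ... | no ne = ⊥-elim (true≢false (&⁺ x∈ (some⁺ c (&⁺ (&⁺ Ac (==⁺ hc)) (&⁺
            (γ-cross g (λ h → proj₂ (proj₂ (W⁻ (sub (∈ᵇ⁻ x∈)))) (trans h hc))) (!⁺ (≢⁺ ne)))))) (none x))

        crowded : Payable A
        crowded with branch K₁ h₁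
        ... | inj₁ p = p
        ... | inj₂ B₁ with branch K₂ h₂
        ... | inj₁ p = p
        ... | inj₂ B₂ with chain-to-root (Branch.grown B₂) (Branch.reaches-β B₂)
        -- Two branches that both contain `β` are the same component of `W`, which then has links to
        -- both `a₁` and `a₂`.
        ... | l′ , chain , sub′ = ⊥-elim (≢₁₂ (sym (Branch.private-to-a B₁
          (closed-chain (Branch.full B₁) (Branch.sub B₂ ∘ sub′) γ-sym chain (Branch.reaches-β B₁))
          (K⊆A K₂) h₂ (Q-swap (Branch.a-z B₂)))))

      -- By saturation the three bad vertices at `v` lie in `K` or equal `β`, so at least two of
      -- them lie in `K`.
      crowded-hub : ∀ v → H Y v ≡ true → 3 ≤ count (fibre A v) → Payable A
      crowded-hub v hv three with H⁻ hv | count>2⁻ (fibre A v) three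
      ... | y , Yy , hy | a , b , c , fa , fb , fc , ab , ac , bc = by-cases (in-K∪β fa) (in-K∪β fb)
        where
        A! : ∀ {x} → fibre A v x ≡ true → A x ≡ true
        A! f = proj₁ (&⁻ f)
        hub! : ∀ {x} → fibre A v x ≡ true → hub x ≡ v
        hub! f = ==⁻ (proj₂ (&⁻ f))
        in-K∪β : ∀ {x} → fibre A v x ≡ true → K x ≡ true ⊎ x ≡ β
        in-K∪β f with Y⁻ (saturated Yy (A! f) (trans (hub! f) (sym hy)))
        ... | inj₁ k = inj₁ k
        ... | inj₂ (_ , e) = inj₂ e
        in-K : ∀ {x} → fibre A v x ≡ true → x ≢ β → K x ≡ true
        in-K f ne with in-K∪β f
        ... | inj₁ k = k
        ... | inj₂ e = ⊥-elim (ne e)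
        by-cases : K a ≡ true ⊎ a ≡ β → K b ≡ true ⊎ b ≡ β → Payable A
        by-cases (inj₁ Ka) (inj₁ Kb) = Crowded.crowded Ka Kb (A! fc) (hub! fa) (hub! fb) (hub! fc) ab ac bc
        by-cases (inj₂ refl) _ = Crowded.crowded (in-K fb (ab ∘ sym)) (in-K fc (ac ∘ sym)) (A! fa)
          (hub! fb) (hub! fc) (hub! fa) bc (ab ∘ sym) (ac ∘ sym)
        by-cases (inj₁ Ka) (inj₂ refl) = Crowded.crowded Ka (in-K fc (bc ∘ sym)) (A! fb)
          (hub! fa) (hub! fc) (hub! fb) ac ab (bc ∘ sym)

      module Uncrowded (small : ∀ v → H Y v ≡ true → count (fibre A v) ≤ 2) where

        Q-stays : ∀ {b c} → K b ≡ true → A c ≡ true → Q b c ≡ true → K c ≡ true ⊎ c ≡ β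
        Q-stays k a q = closed k a (γ-Q q)

        r-outside : ∀ {b} → (∀ {c} → A c ≡ true → Q b c ≡ true → Y c ≡ true) → r (A ─ Y) b ≡ 0
        r-outside {b} stays = ∑⟨⟩-zero (A ─ Y) (m b) zero-out
          where
          zero-out : ∀ c → (A ─ Y) c ≡ true → m b c ≡ 0
          zero-out c e with bool? (Q b c)
          ... | inj₂ q = m-no q
          ... | inj₁ q = ⊥-elim (true≢false (stays (proj₁ (─⁻ e)) q) (proj₂ (─⁻ e)))

        no-Q : ∀ {B b c} → r B b ≡ 0 → B c ≡ true → Q b c ≡ true → ⊥
        no-Q {B} {b} r0 Bc q = <⇒≱ (m≥1 q) (≤-trans (≤∑⟨⟩ B (m b) Bc) (≤-reflexive r0))

        -- Lets `u` take over as the vertex that separates the rest of `K`. Only relations to the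
        -- old `β` can prevent this, hence the last hypothesis.
        shrink : ∀ {u} → K u ≡ true → (∃ λ b → (K ∖ u) b ≡ true) →
          (∀ {b} → (K ∖ u) b ≡ true → γ b β ≡ true → β ≡ u ⊎ K β ≡ true) → Payable A
        shrink {u} Ku mem sep = smaller {K ∖ u} {u} (λ e → proj₁ (∖⁻ e)) (u , Ku , ∖-self)
          record { K⊆A = λ e → K⊆A (proj₁ (∖⁻ e)) ; β∈A = K⊆A Ku ; member = mem ; closed = closed′ }
          where
          ∖-self : (K ∖ u) u ≡ false
          ∖-self with bool? ((K ∖ u) u)
          ... | inj₁ e = ⊥-elim (proj₂ (∖⁻ e) refl)
          ... | inj₂ e = e
          in-K′ : ∀ {c} → K c ≡ true → (K ∖ u) c ≡ true ⊎ c ≡ u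
          in-K′ {c} k with c ≟ u
          ... | yes e = inj₂ e
          ... | no ne = inj₁ (∖⁺ k ne)
          closed′ : ∀ {b c} → (K ∖ u) b ≡ true → A c ≡ true → γ b c ≡ true → (K ∖ u) c ≡ true ⊎ c ≡ u
          closed′ e Ac g with closed (proj₁ (∖⁻ e)) Ac g
          ... | inj₁ k = in-K′ k
          ... | inj₂ refl with sep e g
          ... | inj₁ e′ = inj₂ e′
          ... | inj₂ k = in-K′ k

        module Shared (d : shared ≡ true) where

          from-K : ∀ {b} → K b ≡ true → r (A ─ Y) b ≡ 0
          from-K k = r-outside λ a q → [ K⊆Y , (λ { refl → β∈Y d }) ]′ (Q-stays k a q)

          out≤r : out Y A ≤ r (A ─ Y) β
          out≤r = ∑⟨⟩-single Y _ β only-β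
            where
            only-β : ∀ b → Y b ≡ true → b ≢ β → r (A ─ Y) b ≡ 0
            only-β b y ne with Y⁻ y
            ... | inj₁ k = from-K k
            ... | inj₂ (_ , e) = ⊥-elim (ne e)

          -- All the weight of `β` leaves `Y`, so `β` has no link into `K`. It is related to `K`
          -- only through its hub, where `u` is the one other bad vertex; thus `u` separates the
          -- rest of `K`.
          special : out Y A ≡ 2 → Payable A
          special o with some⁻ d
          ... | u , e with &⁻ e
          ... | Ku , hu with linked (K⊆A Ku)
          ... | q , Aq , uq = shrink Ku (q , ∖⁺ Kq (λ e → Q⇒hub uq (cong hub (sym e)))) sep
            where
            β∉K : K β ≡ false
            β∉K with bool? (K β)
            ... | inj₂ e = e
            ... | inj₁ k = ⊥-elim (<⇒≱ (s≤s z≤n) (≤-trans (≤-reflexive (sym o)) (≤-trans out≤r (≤-reflexive (from-K k)))))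
            rY≡0 : r Y β ≡ 0
            rY≡0 = n≤0⇒n≡0 (+-cancelʳ-≤ 2 (r Y β) 0 (≤-trans (+-monoʳ-≤ (r Y β) (≤-trans (≤-reflexive (sym o)) out≤r))
              (≤-trans (≤-reflexive (sym (r-split Y⊆A β))) (r≤2 A β))))
            Kq : K q ≡ true
            Kq with Q-stays Ku Aq uq
            ... | inj₁ k = k
            ... | inj₂ refl = ⊥-elim (Q⇒hub uq (==⁻ hu))
            sep : ∀ {b} → (K ∖ u) b ≡ true → γ b β ≡ true → β ≡ u ⊎ K β ≡ true
            sep {b} e g with ∖⁻ e | hub b ≟ hub β
            ... | Kb , b≢u | no ne = ⊥-elim (no-Q rY≡0 (K⊆Y Kb) (Q-swap (γ-cross g ne)))
            ... | Kb , b≢u | yes hb = ⊥-elim (<⇒≱ (count≥3 (fibre A (hub β)) (&⁺ (K⊆A Kb) (==⁺ hb)) (&⁺ (K⊆A Ku) hu)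
              (&⁺ β∈A (==⁺ refl)) b≢u (λ e → true≢false (subst (λ x → K x ≡ true) e Kb) β∉K)
              (λ e → true≢false (subst (λ x → K x ≡ true) e Ku) β∉K))
              (small (hub β) (H⁺ (β∈Y d))))

        module Unshared (d : shared ≡ false) where

          Y≡K : ∀ {b} → Y b ≡ true → K b ≡ true
          Y≡K y with Y⁻ y
          ... | inj₁ k = k
          ... | inj₂ (d′ , _) = ⊥-elim (true≢false d′ d)

          hub≢ : ∀ {b} → K b ≡ true → hub b ≢ hub β
          hub≢ k h = true≢false (some⁺ _ (&⁺ k (==⁺ h))) d

          -- A link that leaves `K` can only end in `β`, so the outgoing weight is counted at that
          -- end.
          out≤r : out Y A ≤ r Y β
          out≤r = ≤-trans (≤-reflexive (∑⟨⟩-swap Y (A ─ Y) m)) (≤-trans (∑⟨⟩-single (A ─ Y) _ β only-β)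
            (≤-reflexive (∑⟨⟩-cong Y _ _ (λ b _ → m-sym b β))))
            where
            only-β : ∀ c → (A ─ Y) c ≡ true → c ≢ β → ∑⟨ Y ⟩ (λ b → m b c) ≡ 0
            only-β c e ne = ∑⟨⟩-zero Y _ (λ b y → none b y (bool? (Q b c)))
              where
              none : ∀ b → Y b ≡ true → Q b c ≡ true ⊎ Q b c ≡ false → m b c ≡ 0
              none b y (inj₂ q) = m-no q
              none b y (inj₁ q) with Q-stays (Y≡K y) (proj₁ (─⁻ e)) q
              ... | inj₁ k = ⊥-elim (true≢false (K⊆Y k) (proj₂ (─⁻ e)))
              ... | inj₂ e′ = ⊥-elim (ne e′)

          neighbour : out Y A ≡ 2 → ∃ λ z → K z ≡ true × Q β z ≡ true
          neighbour o with search (λ z → Y z & Q β z)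
          ... | inj₁ (z , e) = z , Y≡K (proj₁ (&⁻ e)) , proj₂ (&⁻ e)
          ... | inj₂ none = ⊥-elim (<⇒≱ (s≤s z≤n) (≤-trans (≤-reflexive (sym o)) (≤-trans out≤r (≤-reflexive
            (∑⟨⟩-zero Y (m β) (λ z y → m-no (¬-true (λ q → true≢false (&⁺ y q) (none z)))))))))

          -- In the sharp case a neighbour `z` of `β` in `K` has weight 2 and a companion `z̄` at
          -- its hub. Unless a smaller set is separated by `z`, it sees `β`, `z̄` and the end `y` of
          -- a second link, all still connected without `z`, while `β` then sees only `z′`. This is
          -- the excluded configuration with `z` coloured first and `β` last.
          special : out Y A ≡ 2 → E Y + out Y A ≡ 4 * count (H Y) → Payable A
          special o eq with neighbour o
          ... | z , Kz , βz with tight-fibre small Y⊆A eq (K⊆Y Kz)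
          ... | r≡2 , z̄ , Yz̄ , hz̄ , z̄≢z with search (λ z′ → K z′ & (Q β z′ & ! (z′ == z)))
          ... | inj₂ none = shrink Kz (z̄ , ∖⁺ (Y≡K Yz̄) z̄≢z) λ e g → ⊥-elim (true≢false
            (&⁺ (proj₁ (∖⁻ e)) (&⁺ (Q-swap (γ-cross g (hub≢ (proj₁ (∖⁻ e))))) (!⁺ (≢⁺ (proj₂ (∖⁻ e)))))) (none _))
          ... | inj₁ (z′ , e) with &⁻ e
          ... | Kz′ , e′ with &⁻ e′
          ... | βz′ , z′≢z with search (λ y → A y & (Q z y & ! (y == β)))
          -- Were `β` the only link of `z`, this link would have weight 2 and be isolated; but `β`
          -- has the two links `z` and `z′`.
          ... | inj₂ none = ⊥-elim (<⇒≱ (count≥2 (Q β) βz βz′ (≢⁻ (!⁻ z′≢z) ∘ sym)) (≤-reflexive (deg-β (bool? (iso z β)))))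
            where
            r≡m : 2 ≤ m z β
            r≡m = ≤-trans (≤-reflexive (sym r≡2)) (∑⟨⟩-single A (m z) β (λ y Ay ne →
              m-no (¬-true (λ q → true≢false (&⁺ Ay (&⁺ q (!⁺ (≢⁺ ne)))) (none y)))))
            deg-β : iso z β ≡ true ⊎ iso z β ≡ false → deg β ≡ 1
            deg-β (inj₁ i) = ≐⁻ (proj₂ (&⁻ i))
            deg-β (inj₂ i) = ⊥-elim (<⇒≱ r≡m (≤-reflexive (trans (guard-true (Q-swap βz)) (cong (λ x → if x then 2 else 1) i))))
          ... | inj₁ (y , f) with &⁻ f
          ... | Ay , f′ with &⁻ f′
          ... | zy , y≢β with Q-stays Kz Ay zy
          ... | inj₂ e″ = ⊥-elim (≢⁻ (!⁻ y≢β) e″)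
          -- The list is the component of `β` after the removal of `z`. The vertices of `K` outside
          -- it, other than `z`, are separated by `z`.
          ... | inj₁ Ky with reach {R = γ} (λ x → (K x || x == β) & ! (x == z)) β (&⁺ (||⁺ʳ (==⁺ refl)) (!⁺ (≢⁺ (λ e → hub≢ Kz (cong hub (sym e))))))
          ... | l , grown , sub , full = finish (bool? (z̄ ∈ᵇ l)) (bool? (y ∈ᵇ l))
            where
            W⁻ : ∀ {x} → x ∈ l → (K x ≡ true ⊎ x ≡ β) × x ≢ z
            W⁻ i with &⁻ (sub i)
            ... | e , ne = [ inj₁ , inj₂ ∘ ==⁻ ]′ (||⁻ e) , ≢⁻ (!⁻ ne)
            missing : ∀ {t} → K t ≡ true → t ≢ z → t ∉ l → Payable A
            missing {t} Kt t≢z t∉l = smaller {λ x → (K ∖ z) x & ! (x ∈ᵇ l)} {z} (λ e → proj₁ (∖⁻ (proj₁ (&⁻ e))))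
              (z , Kz , ¬-true (λ e → proj₂ (∖⁻ (proj₁ (&⁻ e))) refl))
              record { K⊆A = λ e → K⊆A (proj₁ (∖⁻ (proj₁ (&⁻ e)))) ; β∈A = K⊆A Kz
                ; member = t , &⁺ (∖⁺ Kt t≢z) (!⁺ (∉ᵇ⁺ t∉l)) ; closed = closed′ }
              where
              closed′ : ∀ {b c} → (K ∖ z) b & ! (b ∈ᵇ l) ≡ true → A c ≡ true → γ b c ≡ true →
                (K ∖ z) c & ! (c ∈ᵇ l) ≡ true ⊎ c ≡ z
              closed′ {b} {c} e Ac g with &⁻ e
              ... | e₁ , b∉ with ∖⁻ e₁ | c ≟ z | bool? (c ∈ᵇ l)
              ... | Kb , b≢z | yes c≡z | _ = inj₂ c≡z
              ... | Kb , b≢z | no _ | inj₁ c∈ = ⊥-elim (∉ᵇ⁻ (!⁻ b∉) (full (∈ᵇ⁻ c∈) (&⁺ (||⁺ˡ Kb) (!⁺ (≢⁺ b≢z))) g))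
              ... | Kb , b≢z | no c≢z | inj₂ c∉ with closed Kb Ac g
              ... | inj₁ Kc = inj₁ (&⁺ (∖⁺ Kc c≢z) (!⁺ c∉))
              ... | inj₂ refl = ⊥-elim (∉ᵇ⁻ c∉ (root∈ grown))
            finish : z̄ ∈ᵇ l ≡ true ⊎ z̄ ∈ᵇ l ≡ false → y ∈ᵇ l ≡ true ⊎ y ∈ᵇ l ≡ false → Payable A
            finish (inj₂ z̄∉) _ = missing (Y≡K Yz̄) z̄≢z (∉ᵇ⁻ z̄∉)
            finish _ (inj₂ y∉) = missing Ky (λ e → Q⇒hub zy (cong hub (sym e))) (∉ᵇ⁻ y∉)
            finish (inj₁ z̄∈) (inj₁ y∈) = ⊥-elim (greedy {z} {β} {z′} {y} {z̄} grown T-all (A⊆T (K⊆A Kz))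
              (λ i → proj₂ (W⁻ i) refl) (γ-Q (Q-swap βz)) (∈ᵇ⁻ y∈) zy (∈ᵇ⁻ z̄∈) (γ-hub (z̄≢z ∘ sym) (sym hz̄))
              (λ e → Q⇒hub zy (trans (sym hz̄) (cong hub (sym e)))) (≢⁻ (!⁻ y≢β) ∘ sym)
              (λ e → hub≢ (Y≡K Yz̄) (cong hub (sym e))) only)
              where
              T-all : ∀ {x} → x ∈ l → T x ≡ true
              T-all i with proj₁ (W⁻ i)
              ... | inj₁ k = A⊆T (K⊆A k)
              ... | inj₂ refl = A⊆T β∈A
              only : ∀ {x} → x ∈ l → γ β x ≡ true → x ≡ z′
              only {x} i g with W⁻ i
              ... | inj₂ refl , _ = ⊥-elim (proj₁ (γ⁻ g) refl)
              ... | inj₁ k , x≢z with x ≟ z′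
              ... | yes e = e
              ... | no ne = ⊥-elim (<⇒≱ (count≥3 (Q β) (γ-cross g (hub≢ k ∘ sym)) βz βz′ x≢z ne (≢⁻ (!⁻ z′≢z) ∘ sym)) (Q-deg β))

        out≤2 : out Y A ≤ 2
        out≤2 with bool? shared
        ... | inj₁ d = ≤-trans (Shared.out≤r d) (r≤2 (A ─ Y) β)
        ... | inj₂ d = ≤-trans (Unshared.out≤r d) (r≤2 Y β)

        uncrowded : Payable A
        uncrowded with even-slack {s = proj₁ (E-even Y)} {h = count (H Y)} (proj₂ (E-even Y)) (row-sum≤ small Y⊆A) out≤2
        ... | inj₁ le = payable le
        ... | inj₂ (o , eq) with bool? shared
        ... | inj₁ d = Shared.special d o
        ... | inj₂ d = Unshared.special d o eq

      step : Payable A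
      step with search (λ v → H Y v & 3 ≼ count (fibre A v))
      ... | inj₁ (v , e) = crowded-hub v (proj₁ (&⁻ e)) (≼⁻ (proj₂ (&⁻ e)))
      ... | inj₂ none = Uncrowded.uncrowded λ v hv → s≤s⁻¹ (≰⇒> λ three → true≢false (&⁺ hv (≼⁺ three)) (none v))

    separated⇒payable : ∀ fuel {K β} → count K ≤ fuel → Separated K β → Payable A
    separated⇒payable zero {K} le S = ⊥-elim (n≮0 (≤-trans (count>0⁺ K (proj₂ (Separated.member S))) le))
    separated⇒payable (suc fuel) {K} le S = step S λ { {K′} sub (u , Ku , K′u) S′ →
      separated⇒payable fuel (s≤s⁻¹ (≤-trans (count-mono-< (λ _ → sub) u K′u Ku) le)) S′ }

  module _ (greedy : GreedyFree) where

    -- By saturation a block and the rest of `A` have disjoint sets of hubs, so the payments add up.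
    -- A bad vertex without links inside `A` costs nothing and is dropped beforehand.
    links-bound : ∀ fuel {A} → count A ≤ fuel → (∀ {b} → A b ≡ true → T b ≡ true) → E A ≤ 4 * count (H A)
    links-bound fuel {A} le sub with search A
    links-bound fuel {A} le sub | inj₂ none = ≤-trans (≤-reflexive (∑⟨⟩-zero A (r A) (λ b e → ⊥-elim (true≢false e (none b))))) z≤n
    links-bound zero {A} le sub | inj₁ (b , Ab) = ⊥-elim (n≮0 (≤-trans (count>0⁺ A Ab) le))
    links-bound (suc fuel) {A} le sub | inj₁ (b , Ab) with search (λ b → A b & ! (some (λ c → A c & Q b c)))
    -- With `K = A` nothing lies outside, so any vertex of `A` can serve as `β`.
    ... | inj₂ none = block (Separation.separated⇒payable greedy sub linked (count A) ≤-refl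
        (record { K⊆A = id ; β∈A = Ab ; member = b , Ab ; closed = λ _ Ac _ → inj₁ Ac }))
      where
      linked : ∀ {b} → A b ≡ true → ∃ λ c → A c ≡ true × Q b c ≡ true
      linked {b} Ab with bool? (some (λ c → A c & Q b c))
      ... | inj₁ e = proj₁ (some⁻ e) , &⁻ (proj₂ (some⁻ e))
      ... | inj₂ e = ⊥-elim (true≢false (&⁺ Ab (!⁺ e)) (none b))
      block : Payable A → E A ≤ 4 * count (H A)
      block P = begin
        E A                                            ≡⟨ E-split Y⊆A ⟩
        (E Y + 2 * out Y A) + E (A ─ Y)                ≤⟨ +-mono-≤ paid (links-bound fuel smaller (sub ∘ proj₁ ∘ ─⁻)) ⟩
        4 * count (H Y) + 4 * count (H (A ─ Y))        ≡⟨ sym (*-distribˡ-+ 4 (count (H Y)) (count (H (A ─ Y)))) ⟩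
        4 * (count (H Y) + count (H (A ─ Y)))          ≤⟨ *-monoʳ-≤ 4 (count-disjoint hubY hubA─Y disjoint) ⟩
        4 * count (H A)                                ∎
        where
        open ≤-Reasoning
        open Payable P
        smaller : count (A ─ Y) ≤ fuel
        smaller = s≤s⁻¹ (≤-trans (count-mono-< (λ _ → proj₁ ∘ ─⁻) (proj₁ inhabited)
          (¬-true (λ e → true≢false (proj₂ inhabited) (proj₂ (─⁻ e)))) (Y⊆A _ (proj₂ inhabited))) le)
        hubY : ∀ v → H Y v ≡ true → H A v ≡ true
        hubY v h with H⁻ h
        ... | b , y , refl = H⁺ (Y⊆A b y)
        hubA─Y : ∀ v → H (A ─ Y) v ≡ true → H A v ≡ true
        hubA─Y v h with H⁻ {A ─ Y} h
        ... | b , y , refl = H⁺ (proj₁ (─⁻ y))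
        disjoint : ∀ v → H Y v ≡ true → H (A ─ Y) v ≡ true → ⊥
        disjoint v h h′ with H⁻ h | H⁻ {A ─ Y} h′
        ... | b , y , refl | c , e , hc = true≢false (saturated y (proj₁ (─⁻ e)) hc) (proj₂ (─⁻ e))
    ... | inj₁ (u , e) with &⁻ e
    ... | Au , free = begin
      E A                                              ≡⟨ E-split single⊆A ⟩
      (E (_== u) + 2 * out (_== u) A) + E (A ─ (_== u)) ≡⟨ cong (_+ E (A ─ (_== u))) alone ⟩
      E (A ─ (_== u))                                   ≤⟨ links-bound fuel smaller (sub ∘ proj₁ ∘ ─⁻) ⟩
      4 * count (H (A ─ (_== u)))                       ≤⟨ *-monoʳ-≤ 4 (count-mono hubs) ⟩
      4 * count (H A)                                  ∎
      where
      open ≤-Reasoning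
      single⊆A : ∀ b → b == u ≡ true → A b ≡ true
      single⊆A b e = subst (λ x → A x ≡ true) (sym (==⁻ e)) Au
      rA≡0 : r A u ≡ 0
      rA≡0 = ∑⟨⟩-zero A (m u) (λ c Ac → m-no (¬-true (λ q → true≢false (some⁺ c (&⁺ Ac q)) (!⁻ free))))
      row≡0 : E (_== u) + out (_== u) A ≡ 0
      row≡0 = trans (row-sum single⊆A) (∑⟨⟩-zero (_== u) (r A) (λ b e → trans (cong (r A) (==⁻ e)) rA≡0))
      alone : E (_== u) + 2 * out (_== u) A ≡ 0
      alone = cong₂ (λ x y → x + 2 * y) (m+n≡0⇒m≡0 (E (_== u)) row≡0) (m+n≡0⇒n≡0 (E (_== u)) row≡0)
      smaller : count (A ─ (_== u)) ≤ fuel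
      smaller = s≤s⁻¹ (≤-trans (count-mono-< (λ _ → proj₁ ∘ ─⁻) u
        (¬-true (λ e → true≢false (==⁺ refl) (proj₂ (─⁻ e)))) Au) le)
      hubs : ∀ v → H (A ─ (_== u)) v ≡ true → H A v ≡ true
      hubs v h with H⁻ {A ─ (_== u)} h
      ... | b , y , refl = H⁺ (proj₁ (─⁻ y))

-- Lists

opaque
  members : (Fin n → Bool) → List (Fin n)
  members p = filter (λ z → p z Bool.≟ true) (allFin _)

  ∈-members : {p : Fin n → Bool} {z : Fin n} → p z ≡ true → z ∈ members p
  ∈-members {p = p} {z} e = ∈-filter⁺ (λ z → p z Bool.≟ true) (∈-allFin z) e

  members-∈ : {p : Fin n → Bool} {z : Fin n} → z ∈ members p → p z ≡ true
  members-∈ {n} {p} z∈ = proj₂ (∈-filter⁻ (λ z → p z Bool.≟ true) {xs = allFin n} z∈)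

  members-length : (p : Fin n → Bool) → length (members p) ≡ count p
  members-length {n} p = trans (length-filter (allFin n)) (trans (sum-allFin (ind ∘ p)) (sym (count-def p)))
    where
    length-filter : (xs : List (Fin n)) → length (filter (λ z → p z Bool.≟ true) xs) ≡ sum (map (ind ∘ p) xs)
    length-filter [] = refl
    length-filter (x ∷ xs) with p x
    ... | true = cong suc (length-filter xs)
    ... | false = length-filter xs

-- Pigeonhole: each entry of `ys` removes at most one element from a list without repetitions.
avoid : {xs : List ℕ} → Unique xs → (ys : List ℕ) → length ys < length xs → ∃ λ x → x ∈ xs × x ∉ ys
avoid {x ∷ xs} u [] lt = x , here refl , λ ()
avoid {xs} u (y ∷ ys) lt with avoid (filter⁺ (λ x → ¬? (x ℕ.≟ y)) u) ys (s≤s⁻¹ (≤-trans lt (drop-one u)))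
  where
  P? : Decidable (λ x → ¬ (x ≡ y))
  P? x = ¬? (x ℕ.≟ y)
  drop-one : {xs : List ℕ} → Unique xs → length xs ≤ suc (length (filter P? xs))
  drop-one [] = z≤n
  drop-one {x ∷ xs} (a ∷ u) with x ℕ.≟ y
  ... | yes refl = s≤s (≤-reflexive (sym (cong length (trans (filter-reject P? (λ ne → ne refl)) (filter-all P? (All.map (_∘ sym) a))))))
  ... | no ne = s≤s (≤-trans (drop-one u) (≤-reflexive (sym (cong length (filter-accept P? ne)))))
... | x , x∈ , x∉ with ∈-filter⁻ (λ x → ¬? (x ℕ.≟ y)) x∈
... | x∈xs , x≢y = x , x∈xs , λ { (here e) → x≢y e ; (there i) → x∉ i }

-- Tries the finitely many choices vertex by vertex. This decides colourability, so that a critical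
-- graph may be assumed constructively; `ext` stands in for function extensionality.
choice? : (L : Fin n → List ℕ) (P : (Fin n → ℕ) → Set) → (∀ {c d} → (∀ v → c v ≡ d v) → P c → P d) →
  Decidable P → Dec (∃ λ c → (∀ v → c v ∈ L v) × P c)
choice? {zero} L P ext P? with P? (λ ())
... | yes p = yes ((λ ()) , (λ ()) , p)
... | no ¬p = no λ { (c , _ , p) → ¬p (ext (λ ()) p) }
choice? {suc n} L P ext P? with Any.any? (λ x → choice? (L ∘ suc) (P ∘ cons x) (λ e → ext (cons-ext x e)) (P? ∘ cons x)) (L zero)
  where
  cons : ℕ → (Fin n → ℕ) → Fin (suc n) → ℕ
  cons x c zero = x
  cons x c (suc v) = c v
  cons-ext : ∀ x {c d : Fin n → ℕ} → (∀ v → c v ≡ d v) → ∀ v → cons x c v ≡ cons x d v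
  cons-ext x e zero = refl
  cons-ext x e (suc v) = e v
... | yes a with find a
... | x , x∈ , c , c∈ , p = yes (_ , (λ { zero → x∈ ; (suc v) → c∈ v }) , p)
choice? {suc n} L P ext P? | no ¬a = no λ { (c , c∈ , p) → ¬a (lose (c∈ zero)
  (c ∘ suc , c∈ ∘ suc , ext (λ { zero → refl ; (suc v) → refl }) p)) }

-- Greedy list colouring at distance two

module Colouring (G : Graph n) where

  opaque
    nb : Fin n → Fin n → Bool
    nb u v = ! (u == v) & (adj G u v || some (λ w → adj G u w & adj G w v))

    nb-adj : ∀ {u v} → u ≢ v → adj G u v ≡ true → nb u v ≡ true
    nb-adj ne a = &⁺ (!⁺ (≢⁺ ne)) (||⁺ˡ a)

    nb-common : ∀ {u v} w → u ≢ v → adj G u w ≡ true → adj G w v ≡ true → nb u v ≡ true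
    nb-common w ne a b = &⁺ (!⁺ (≢⁺ ne)) (||⁺ʳ (some⁺ w (&⁺ a b)))

    nb⁻ : ∀ {u v} → nb u v ≡ true →
      u ≢ v × (adj G u v ≡ true ⊎ ∃ λ w → adj G u w ≡ true × adj G w v ≡ true)
    nb⁻ e with &⁻ e
    ... | ne , e′ = ≢⁻ (!⁻ ne) , [ inj₁ , (λ s → inj₂ (proj₁ (some⁻ s) , &⁻ (proj₂ (some⁻ s)))) ]′ (||⁻ e′)

  adj-swap : ∀ {u v} → adj G u v ≡ true → adj G v u ≡ true
  adj-swap {u} {v} = trans (adj-sym G v u)

  adj⇒≢ : ∀ {u v} → adj G u v ≡ true → u ≢ v
  adj⇒≢ {u} a refl = true≢false a (adj-irr G u)

  nb-sym : ∀ u v → nb u v ≡ nb v u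
  nb-sym u v = bool-ext (half u v) (half v u)
    where
    half : ∀ u v → nb u v ≡ true → nb v u ≡ true
    half u v e with nb⁻ e
    ... | ne , inj₁ a = nb-adj (ne ∘ sym) (adj-swap a)
    ... | ne , inj₂ (w , a , b) = nb-common w (ne ∘ sym) (adj-swap b) (adj-swap a)

  module Lists (k : ℕ) (L : Fin n → List ℕ) (L-unique : ∀ v → Unique (L v))
    (L-length : ∀ v → length (L v) ≡ k + 2) where

    Proper : (Fin n → ℕ) → Set
    Proper c = ∀ u v → nb u v ≡ true → c u ≢ c v

    Colourable : Set
    Colourable = ∃ λ c → (∀ v → c v ∈ L v) × Proper c

    colourable? : Dec Colourable
    colourable? = choice? L Proper (λ e h u v a q → h u v a (trans (e u) (trans q (sym (e v)))))
      (λ c → all? (λ u → all? (λ v → (nb u v Bool.≟ true) →-dec ¬? (c u ℕ.≟ c v))))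

    -- r lists the vertices of U that are still to be coloured.
    record Valid (U : Fin n → Bool) (r : List (Fin n)) (c : Fin n → ℕ) : Set where
      constructor valid
      field
        listed : ∀ v → c v ∈ L v
        proper : ∀ {u v} → U u ≡ true → U v ≡ true → u ∉ r → v ∉ r → nb u v ≡ true → c u ≢ c v
    open Valid public

    -- The colouring obtained is one of the whole graph, including the vertices outside `U`.
    Extends : (Fin n → Bool) → List (Fin n) → Set
    Extends U r = ∀ {c} → Valid U r c → Colourable

    _[_≔_] : (Fin n → ℕ) → Fin n → ℕ → Fin n → ℕ
    (c [ x ≔ i ]) v = if x == v then i else c v

    ≔-same : ∀ c x i → (c [ x ≔ i ]) x ≡ i
    ≔-same c x i = cong (λ b → if b then i else c x) (==⁺ refl)

    ≔-other : ∀ c x i {v} → v ≢ x → (c [ x ≔ i ]) v ≡ c v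
    ≔-other c x i {v} ne = cong (λ b → if b then i else c v) (≢⁺ (ne ∘ sym))

    recolour : ∀ {U x r c i} → Valid U (x ∷ r) c → i ∈ L x →
      (∀ {z} → U z ≡ true → z ∉ r → nb x z ≡ true → c z ≢ i) → Valid U r (c [ x ≔ i ])
    recolour {U} {x} {r} {c} {i} V i∈ free = valid listed′ proper′
      where
      listed′ : ∀ v → (c [ x ≔ i ]) v ∈ L v
      listed′ v with v ≟ x
      ... | yes refl = subst (_∈ L x) (sym (≔-same c x i)) i∈
      ... | no ne = subst (_∈ L v) (sym (≔-other c x i ne)) (listed V v)
      ∉∷ : ∀ {v} → v ≢ x → v ∉ r → v ∉ (x ∷ r)
      ∉∷ ne v∉ (here e) = ne e
      ∉∷ ne v∉ (there j) = v∉ j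
      proper′ : ∀ {u v} → U u ≡ true → U v ≡ true → u ∉ r → v ∉ r → nb u v ≡ true → (c [ x ≔ i ]) u ≢ (c [ x ≔ i ]) v
      proper′ {u} {v} Uu Uv u∉ v∉ e q with u ≟ x | v ≟ x
      ... | yes refl | yes refl = proj₁ (nb⁻ e) refl
      ... | yes refl | no v≢ = free Uv v∉ e (trans (sym (≔-other c x i v≢)) (trans (sym q) (≔-same c x i)))
      ... | no u≢ | yes refl = free Uu u∉ (trans (nb-sym v u) e) (trans (sym (≔-other c x i u≢)) (trans q (≔-same c x i)))
      ... | no u≢ | no v≢ = proper V Uu Uv (∉∷ u≢ u∉) (∉∷ v≢ v∉) e
        (trans (sym (≔-other c x i u≢)) (trans q (≔-other c x i v≢)))

    Nb : (Fin n → Bool) → Fin n → Fin n → Bool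
    Nb U x z = U z & nb x z

    coloured-Nb : (Fin n → Bool) → List (Fin n) → Fin n → Fin n → Bool
    coloured-Nb U r x z = Nb U x z & ! (z ∈ᵇ r)

    -- The extra list `es` lets a vertex also stay away from colours that are to be saved for
    -- another vertex.
    recolour-slack : ∀ {U x r c} → Valid U (x ∷ r) c → (es : List ℕ) →
      count (coloured-Nb U r x) + length es < k + 2 → ∃ λ i → Valid U r (c [ x ≔ i ]) × i ∉ es
    recolour-slack {U} {x} {r} {c} V es lt with avoid (L-unique x) (map c (members (coloured-Nb U r x)) ++ es) short
      where
      short : length (map c (members (coloured-Nb U r x)) ++ es) < length (L x)
      short = ≤-trans (s≤s (≤-reflexive (trans (length-++ (map c (members (coloured-Nb U r x)))) (cong (_+ length es)
        (trans (length-map c (members (coloured-Nb U r x))) (members-length (coloured-Nb U r x))))))) (≤-trans lt (≤-reflexive (sym (L-length x))))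
    ... | i , i∈ , i∉ = i , recolour V i∈ free , λ j → i∉ (∈-++⁺ʳ (map c (members (coloured-Nb U r x))) j)
      where
      free : ∀ {z} → U z ≡ true → z ∉ r → nb x z ≡ true → c z ≢ i
      free {z} Uz z∉ e q = i∉ (∈-++⁺ˡ (subst (_∈ map c (members (coloured-Nb U r x))) q
        (∈-map⁺ c (∈-members {p = coloured-Nb U r x} (&⁺ (&⁺ Uz e) (!⁺ (∉ᵇ⁺ z∉)))))))

    core : ∃ λ U → Extends U [] × (∀ {u} → U u ≡ true → k + 2 ≤ count (Nb U u))
    core = go (count {n} (λ _ → true)) (λ _ → true) ≤-refl
      λ {c} V → c , listed V , λ u v → proper V {u} {v} refl refl (λ ()) (λ ())
      where
      go : ∀ fuel U → count U ≤ fuel → Extends U [] → ∃ λ U → Extends U [] × (∀ {u} → U u ≡ true → k + 2 ≤ count (Nb U u))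
      go fuel U le ext with search (λ u → U u & ! ((k + 2) ≼ count (Nb U u)))
      ... | inj₂ none = U , ext , λ {u} Uu → ≼⁻ (big u Uu (bool? _))
        where
        big : ∀ u → U u ≡ true → (k + 2) ≼ count (Nb U u) ≡ true ⊎ (k + 2) ≼ count (Nb U u) ≡ false → (k + 2) ≼ count (Nb U u) ≡ true
        big u Uu (inj₁ e) = e
        big u Uu (inj₂ e) = ⊥-elim (true≢false (&⁺ Uu (!⁺ e)) (none u))
      go zero U le ext | inj₁ (u , e) = ⊥-elim (n≮0 (≤-trans (count>0⁺ U (proj₁ (&⁻ e))) le))
      go (suc fuel) U le ext | inj₁ (u , e) with &⁻ e
      ... | Uu , few = go fuel (U ∖ u) (s≤s⁻¹ (≤-trans (≤-reflexive (sym (count-remove U u Uu))) le)) λ V →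
        ext (proj₁ (proj₂ (recolour-slack (restore V) [] slack)))
        where
        restore : ∀ {c} → Valid (U ∖ u) [] c → Valid U (u ∷ []) c
        restore V = valid (listed V) λ Ux Uy x∉ y∉ → proper V (∖⁺ Ux (x∉ ∘ here)) (∖⁺ Uy (y∉ ∘ here)) (λ ()) (λ ())
        slack : count (coloured-Nb U [] u) + 0 < k + 2
        slack = ≤-<-trans (≤-trans (≤-reflexive (+-identityʳ _)) (count-mono (λ _ → proj₁ ∘ &⁻)))
          (≰⇒> λ le → true≢false (≼⁺ le) (!⁻ few))

    -- If w has at most two colours left, u avoids them; otherwise w can afford to lose one.
    greedy : ∀ {U} (S : Fin n → Bool) (R : Fin n → Fin n → Bool) →
      (∀ {x} → S x ≡ true → U x ≡ true × count (Nb U x) ≤ k + 2) →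
      (∀ {x y} → S x ≡ true → S y ≡ true → R x y ≡ true → nb x y ≡ true) →
      (∀ {x y} → S x ≡ true → S y ≡ true → nb x y ≡ true → R x y ≡ true) →
      Extends U [] → ∀ {u w p y z l} → Grown R w l → (∀ {x} → x ∈ l → S x ≡ true) → S u ≡ true → u ∉ l →
      R u w ≡ true → y ∈ l → R u y ≡ true → z ∈ l → R u z ≡ true → y ≢ z → w ≢ y → w ≢ z →
      (∀ {x} → x ∈ l → R w x ≡ true → x ≡ p) → Extends U (u ∷ l)
    greedy {U} S R tight R⇒nb nb⇒R ext {u} {w} {p} {y} {z} {l} grown S-all Su u∉l uw y∈ uy z∈ uz y≢z w≢y w≢z only {c} V
      = extend (3 ≤? length A)
      where
      w∈ : w ∈ l
      w∈ = root∈ grown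

      far : Fin n → Bool
      far = coloured-Nb U (u ∷ l) w

      -- The colours that `w` can still use before `u` and the list are coloured.
      A : List ℕ
      A = filter (λ i → ¬? (member? ℕ._≟_ i (map c (members far)))) (L w)

      -- The uncoloured neighbours `w`, `y` and `z` leave at least three colours for `u`, so it can
      -- avoid two more.
      slack-u : count (coloured-Nb U l u) + 2 < k + 2
      slack-u = ≤-trans (≤-reflexive (trans (sym (+-suc (count (coloured-Nb U l u)) 2)) refl))
        (≤-trans (≤-trans (+-monoʳ-≤ (count (coloured-Nb U l u)) (count≥3 later (&⁺ (in-Nb w∈ uw) (∈ᵇ⁺ w∈)) (&⁺ (in-Nb y∈ uy) (∈ᵇ⁺ y∈)) (&⁺ (in-Nb z∈ uz) (∈ᵇ⁺ z∈)) w≢y w≢z y≢z))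
          (count-disjoint (λ _ → proj₁ ∘ &⁻) (λ _ → proj₁ ∘ &⁻) (λ _ e f → true≢false (proj₂ (&⁻ f)) (!⁻ (proj₂ (&⁻ e))))))
          (proj₂ (tight Su)))
        where
        later : Fin n → Bool
        later x = Nb U u x & x ∈ᵇ l
        in-Nb : ∀ {x} → x ∈ l → R u x ≡ true → Nb U u x ≡ true
        in-Nb x∈ r = &⁺ (proj₁ (tight (S-all x∈))) (R⇒nb Su (S-all x∈) r)

      -- Everything but `w` is coloured: each vertex has a neighbour further down the list, so at
      -- most `k + 1` of its neighbours are coloured at its turn.
      branch : ∀ {l c} → Grown R w l → (∀ {x} → x ∈ l → S x ≡ true) → Valid U l c →
        ∃ λ c′ → Valid U (w ∷ []) c′ × (∀ {v} → v ∉ l → c′ v ≡ c v)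
      branch {c = c} root S-all V = c , V , λ _ → refl
      branch {c = c} (grow {x} {y} {l} x∉ y∈ r g) S-all V with recolour-slack V [] slack
        where
        slack : count (coloured-Nb U l x) + 0 < k + 2
        slack = ≤-trans (s≤s (≤-reflexive (+-identityʳ _))) (≤-trans (count-mono-< (λ _ → proj₁ ∘ &⁻) y
          (&-falseʳ (!-true (∈ᵇ⁺ y∈))) (&⁺ (proj₁ (tight (S-all (there y∈)))) (R⇒nb (S-all (here refl)) (S-all (there y∈)) r)))
          (proj₂ (tight (S-all (here refl)))))
      ... | i , V′ , _ with branch g (S-all ∘ there) V′
      ... | c′ , V″ , same = c′ , V″ , λ v∉ → trans (same (v∉ ∘ there)) (≔-other c x i (v∉ ∘ here))

      module _ {i : ℕ} (V₁ : Valid U l (c [ u ≔ i ])) where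

        c₂ : Fin n → ℕ
        c₂ = proj₁ (branch grown S-all V₁)

        V₂ : Valid U (w ∷ []) c₂
        V₂ = proj₁ (proj₂ (branch grown S-all V₁))

        same₂ : ∀ {v} → v ∉ l → c₂ v ≡ (c [ u ≔ i ]) v
        same₂ = proj₂ (proj₂ (branch grown S-all V₁))

        at-u : c₂ u ≡ i
        at-u = trans (same₂ u∉l) (≔-same c u i)

        at-far : ∀ {v} → v ∉ l → v ≢ u → c₂ v ≡ c v
        at-far v∉ v≢u = trans (same₂ v∉) (≔-other c u i v≢u)

        far⁺ : ∀ {v} → U v ≡ true → nb w v ≡ true → v ∉ l → v ≢ u → c v ∈ map c (members far)
        far⁺ Uv e v∉ v≢u = ∈-map⁺ c (∈-members {p = far} (&⁺ (&⁺ Uv e) (!⁺ (∉ᵇ⁺ λ { (here q) → v≢u q ; (there j) → v∉ j }))))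

        finish : ∀ {j} → j ∈ L w → (∀ {v} → U v ≡ true → nb w v ≡ true → c₂ v ≢ j) → Colourable
        finish j∈ free = ext (recolour V₂ j∈ (λ Uv _ e → free Uv e))

      extend : Dec (3 ≤ length A) → Colourable
      -- Of the three or more colours in `A` at most two are lost, to `u` and to `p`.
      extend (yes large) with recolour-slack V [] (≤-<-trans (+-monoʳ-≤ (count (coloured-Nb U l u)) z≤n) slack-u)
      ... | i , V₁ , _ with avoid (filter⁺ (λ i → ¬? (member? ℕ._≟_ i (map c (members far)))) (L-unique w)) (i ∷ c₂ V₁ p ∷ []) large
      ... | j , j∈ , j∉ with ∈-filter⁻ (λ i → ¬? (member? ℕ._≟_ i (map c (members far)))) j∈
      ... | j∈L , j-far = finish V₁ j∈L free
        where
        free : ∀ {v} → U v ≡ true → nb w v ≡ true → c₂ V₁ v ≢ j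
        free {v} Uv e q with v ≟ u | member? _≟_ v l
        ... | yes refl | _ = j∉ (here (trans (sym q) (at-u V₁)))
        ... | no _ | yes v∈ with only v∈ (nb⇒R (S-all w∈) (S-all v∈) e)
        ... | refl = j∉ (there (here (sym q)))
        free {v} Uv e q | no v≢u | no v∉ = j-far (subst (_∈ map c (members far)) (trans (sym (at-far V₁ v∉ v≢u)) q) (far⁺ V₁ Uv e v∉ v≢u))
      -- All of `A` is avoided at `u`. The other neighbours of `w`, at most `k + 1`, leave it a
      -- colour; this colour lies in `A`, so it differs from that of `u`.
      extend (no small) with recolour-slack V A (≤-<-trans (+-monoʳ-≤ (count (coloured-Nb U l u)) (s≤s⁻¹ (≰⇒> small))) slack-u)
      ... | i , V₁ , i∉A with avoid (L-unique w) (map (c₂ V₁) (members (Nb U w ∖ u))) short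
        where
        uw-Nb : Nb U w u ≡ true
        uw-Nb = &⁺ (proj₁ (tight Su)) (trans (nb-sym w u) (R⇒nb Su (S-all w∈) uw))
        short : length (map (c₂ V₁) (members (Nb U w ∖ u))) < length (L w)
        short = ≤-trans (s≤s (≤-reflexive (trans (length-map (c₂ V₁) (members (Nb U w ∖ u))) (members-length (Nb U w ∖ u)))))
          (≤-trans (≤-reflexive (sym (count-remove (Nb U w) u uw-Nb))) (≤-trans (proj₂ (tight (S-all w∈))) (≤-reflexive (sym (L-length w)))))
      ... | j , j∈L , j∉ = finish V₁ j∈L free
        where
        other : ∀ {v} → U v ≡ true → nb w v ≡ true → v ≢ u → c₂ V₁ v ≢ j
        other Uv e v≢u q = j∉ (subst (_∈ map (c₂ V₁) (members (Nb U w ∖ u))) q (∈-map⁺ (c₂ V₁) (∈-members {p = Nb U w ∖ u} (∖⁺ (&⁺ Uv e) v≢u))))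
        j≢i : j ≢ i
        j≢i refl = i∉A (∈-filter⁺ (λ i → ¬? (member? ℕ._≟_ i (map c (members far)))) j∈L not-far)
          where
          not-far : j ∉ map c (members far)
          not-far j∈ with ∈-map⁻ c j∈
          ... | v , v∈ , q with &⁻ (members-∈ {p = far} v∈)
          ... | f₁ , v∉ = other (proj₁ (&⁻ f₁)) (proj₂ (&⁻ f₁)) (λ e → ∉ᵇ⁻ (!⁻ v∉) (here e))
            (trans (at-far V₁ (λ m → ∉ᵇ⁻ (!⁻ v∉) (there m)) (λ e → ∉ᵇ⁻ (!⁻ v∉) (here e))) (sym q))
        free : ∀ {v} → U v ≡ true → nb w v ≡ true → c₂ V₁ v ≢ j
        free {v} Uv e q with v ≟ u
        ... | yes refl = j≢i (trans (sym q) (at-u V₁))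
        ... | no v≢u = other Uv e v≢u q

-- Deleting an edge

deleteEdge : Graph n → Fin n → Fin n → Graph n
deleteEdge {n} G p q = record
  { adj = λ u v → adj G u v & ! (e u v)
  ; adj-sym = λ u v → cong₂ (λ a b → a & ! b) (adj-sym G u v) (bool-ext (e-swap u v) (e-swap v u))
  ; adj-irr = λ v → &-falseˡ (adj-irr G v)
  }
  where
  e : Fin n → Fin n → Bool
  e u v = (u == p & v == q) || (u == q & v == p)
  e-swap : ∀ u v → e u v ≡ true → e v u ≡ true
  e-swap u v h with ||⁻ h
  ... | inj₁ a = ||⁺ʳ (&⁺ (proj₂ (&⁻ a)) (proj₁ (&⁻ a)))
  ... | inj₂ a = ||⁺ˡ (&⁺ (proj₂ (&⁻ a)) (proj₁ (&⁻ a)))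

module Deletion (G : Graph n) (p q : Fin n) where
  open Colouring G
  open Colouring (deleteEdge G p q) using () renaming (nb to nb′; nb-adj to nb′-adj; nb-common to nb′-common)

  delete⁻ : ∀ {u v} → adj (deleteEdge G p q) u v ≡ true → adj G u v ≡ true
  delete⁻ a = proj₁ (&⁻ a)

  delete⁺ : ∀ {u v} → adj G u v ≡ true → ¬ (u ≡ p × v ≡ q) → ¬ (u ≡ q × v ≡ p) →
    adj (deleteEdge G p q) u v ≡ true
  delete⁺ {u} {v} a h h′ = &⁺ a (!⁺ (¬-true λ e → other (||⁻ e)))
    where
    other : (u == p & v == q) ≡ true ⊎ (u == q & v == p) ≡ true → ⊥
    other (inj₁ e) = h (==⁻ (proj₁ (&⁻ e)) , ==⁻ (proj₂ (&⁻ e)))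
    other (inj₂ e) = h′ (==⁻ (proj₁ (&⁻ e)) , ==⁻ (proj₂ (&⁻ e)))

  deleted : adj (deleteEdge G p q) p q ≡ false
  deleted = &-falseʳ (!-true (||⁺ˡ (&⁺ (==⁺ refl) (==⁺ refl))))

  -- A pair lost with the edge contains `p`, or consists of `q` and a neighbour of `p`.
  nb-survives : ∀ {u v} → u ≢ p → v ≢ p → ¬ (u ≡ q × adj G p v ≡ true) → ¬ (v ≡ q × adj G p u ≡ true) →
    nb u v ≡ true → nb′ u v ≡ true
  nb-survives u≢p v≢p h h′ e with nb⁻ e
  ... | ne , inj₁ a = nb′-adj ne (delete⁺ a (u≢p ∘ proj₁) (v≢p ∘ proj₂))
  ... | ne , inj₂ (w , a , b) = nb′-common w ne
    (delete⁺ a (u≢p ∘ proj₁) (λ { (u≡q , refl) → h (u≡q , b) }))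
    (delete⁺ b (λ { (refl , v≡q) → h′ (v≡q , adj-swap a) }) (v≢p ∘ proj₂))

-- Critical graphs, bad vertices and their links

module Structure (G : Graph n) (k : ℕ) (17≤k : 17 ≤ k) (L : Fin n → List ℕ) (L-unique : ∀ v → Unique (L v))
  (L-length : ∀ v → length (L v) ≡ k + 2) where

  open Colouring G
  open Lists k L L-unique L-length
  module After (p q : Fin n) = Colouring.Lists (deleteEdge G p q) k L L-unique L-length

  deg : Fin n → ℕ
  deg v = count (adj G v)

  module Critical (deg≤k : ∀ v → deg v ≤ k) (critical : ¬ Colourable)
    (reduced : ∀ {p q} → adj G p q ≡ true → After.Colourable p q) where

    opaque
      U : Fin n → Bool
      U = proj₁ core

      U-extends : Extends U []
      U-extends = proj₁ (proj₂ core)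

      U-core : ∀ {u} → U u ≡ true → k + 2 ≤ count (Nb U u)
      U-core = proj₂ (proj₂ core)

    -- Every pair lost with this edge contains an uncoloured vertex. Thus a colouring of the reduced
    -- graph is valid off `r` in `G` as well, and can be completed.
    no-edge : ∀ {r} → Extends U r → ∀ {p q} → adj G p q ≡ true → U p ≡ false ⊎ p ∈ r → U q ≡ false ⊎ q ∈ r → ⊥
    no-edge {r} ext {p} {q} a hp hq with reduced a
    ... | c , listed , proper = critical (ext (valid listed λ {u} {v} Uu Uv u∉ v∉ e →
      proper u v (Deletion.nb-survives G p q (away hp Uu u∉) (away hp Uv v∉) (away hq Uu u∉ ∘ proj₁) (away hq Uv v∉ ∘ proj₁) e)))
      where
      away : ∀ {x u} → U x ≡ false ⊎ x ∈ r → U u ≡ true → u ∉ r → u ≢ x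
      away (inj₁ h) Uu u∉ refl = true≢false Uu h
      away (inj₂ i) Uu u∉ refl = u∉ i

    independent : ∀ {p q} → adj G p q ≡ true → U p ≡ false → U q ≡ true
    independent {p} {q} a hp with bool? (U q)
    ... | inj₁ e = e
    ... | inj₂ hq = ⊥-elim (no-edge U-extends a (inj₁ hp) (inj₁ hq))

    -- The number of core vertices that u sees through its neighbour w, counting w.
    contr : Fin n → Fin n → ℕ
    contr u w = ind (U w) + count (λ z → U z & (adj G w z & ! (z == u)))

    -- Splits `contr` by the vertex seen, so that vertices seen through several neighbours can be
    -- counted with multiplicity.
    hit : Fin n → Fin n → Fin n → ℕ
    hit u w z = ind (U z & z == w) + ind (U z & (adj G w z & ! (z == u)))

    contr-hit : ∀ u w → contr u w ≡ ∑ (hit u w)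
    contr-hit u w = sym (trans (∑-+ _ _) (cong₂ _+_ (count-&-== U w) (sym (count-def _))))

    hit-self : ∀ {u w z} → U z ≡ true → z ≡ w → 1 ≤ hit u w z
    hit-self {u} {w} {z} Uz e = ≤-trans (≤-reflexive (sym (cong ind (&⁺ Uz (==⁺ e))))) (m≤m+n (ind (U z & z == w)) _)

    hit-adj : ∀ {u w z} → U z ≡ true → adj G w z ≡ true → z ≢ u → 1 ≤ hit u w z
    hit-adj {u} {w} {z} Uz a ne = ≤-trans (≤-reflexive (sym (cong ind (&⁺ Uz (&⁺ a (!⁺ (≢⁺ ne))))))) (m≤n+m _ (ind (U z & z == w)))

    ∑contr : ∀ u (P : Fin n → Bool) → ∑⟨ P ⟩ (contr u) ≡ ∑ (λ z → ∑⟨ P ⟩ (λ w → hit u w z))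
    ∑contr u P = trans (∑⟨⟩-cong P _ _ (λ w _ → contr-hit u w)) (trans (∑⟨⟩-def P _)
      (trans (∑-cong (λ w → guard-∑ (P w) (hit u w))) (trans (∑-swap _) (∑-cong (λ z → sym (∑⟨⟩-def P _))))))

    cover : ∀ u (P S : Fin n → Bool) → (∀ z → S z ≡ true → ∃ λ w → P w ≡ true × 1 ≤ hit u w z) →
      count S ≤ ∑⟨ P ⟩ (contr u)
    cover u P S h = ≤-trans (≤-reflexive (count-def S)) (≤-trans (∑-mono _ _ λ z → at z (bool? (S z))) (≤-reflexive (sym (∑contr u P))))
      where
      at : ∀ z → S z ≡ true ⊎ S z ≡ false → ind (S z) ≤ ∑⟨ P ⟩ (λ w → hit u w z)
      at z (inj₂ e) = ≤-trans (≤-reflexive (cong ind e)) z≤n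
      at z (inj₁ e) with h z e
      ... | w , Pw , le = ≤-trans (ind≤1 (S z)) (≤-trans le (≤∑⟨⟩ P (λ w → hit u w z) Pw))

    -- The vertex `x` is counted at both `w` and `w′`. For a bad vertex `u`, whose total is at most
    -- `k + 2`, this surplus is a contradiction.
    cover-twice : ∀ u (P S : Fin n → Bool) → (∀ z → S z ≡ true → ∃ λ w → P w ≡ true × 1 ≤ hit u w z) →
      ∀ {x w w′} → P w ≡ true → P w′ ≡ true → w ≢ w′ → 1 ≤ hit u w x → 1 ≤ hit u w′ x → count S < ∑⟨ P ⟩ (contr u)
    cover-twice u P S h {x} {w} {w′} Pw Pw′ ne le le′ = ≤-trans (s≤s (≤-reflexive (count-def S)))
      (≤-trans (∑-mono-< _ _ (λ z → at z (bool? (S z))) x (≤-<-trans (ind≤1 (S x))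
        (≤-trans (+-mono-≤ le le′) (≤∑⟨⟩₂ P (λ w → hit u w x) Pw Pw′ ne)))) (≤-reflexive (sym (∑contr u P))))
      where
      at : ∀ z → S z ≡ true ⊎ S z ≡ false → ind (S z) ≤ ∑⟨ P ⟩ (λ w → hit u w z)
      at z (inj₂ e) = ≤-trans (≤-reflexive (cong ind e)) z≤n
      at z (inj₁ e) with h z e
      ... | w , Pw , le = ≤-trans (ind≤1 (S z)) (≤-trans le (≤∑⟨⟩ P (λ w → hit u w z) Pw))

    Nb-hit : ∀ u z → Nb U u z ≡ true → ∃ λ w → adj G u w ≡ true × 1 ≤ hit u w z
    Nb-hit u z e with &⁻ e
    ... | Uz , e′ with nb⁻ e′
    ... | ne , inj₁ a = z , a , hit-self Uz refl
    ... | ne , inj₂ (w , a , b) = w , a , hit-adj Uz b (ne ∘ sym)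

    contr-total : ∀ {u} → U u ≡ true → k + 2 ≤ ∑⟨ adj G u ⟩ (contr u)
    contr-total {u} Uu = ≤-trans (U-core Uu) (cover u (adj G u) (Nb U u) (Nb-hit u))

    contr< : ∀ {u w} → adj G w u ≡ true → contr u w < ind (U w) + deg w
    contr< {u} {w} a = ≤-trans (≤-reflexive (sym (+-suc (ind (U w)) _)))
      (+-monoʳ-≤ (ind (U w)) (count-mono-< (λ _ → proj₁ ∘ &⁻ ∘ proj₂ ∘ &⁻) u
        (&-falseʳ (&-falseʳ (!-true (==⁺ refl)))) a))

    contr≤deg : ∀ {u w} → adj G w u ≡ true → contr u w ≤ deg w
    contr≤deg {u} {w} a = s≤s⁻¹ (≤-trans (contr< a) (+-monoˡ-≤ (deg w) (ind≤1 (U w))))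

    contr<deg : ∀ {u w} → adj G w u ≡ true → U w ≡ false → contr u w < deg w
    contr<deg {u} {w} a h = ≤-trans (contr< a) (≤-reflexive (cong (λ b → ind b + deg w) h))

    -- A vertex `p` whose only neighbour is `q` sees at most `deg q ≤ k` core vertices and is free.
    -- All pairs lost with its edge contain `p`, so the colouring of the reduced graph carries over
    -- to the core.
    deg≥2 : ∀ {p q} → adj G p q ≡ true → 2 ≤ deg p
    deg≥2 {p} {q} a with 2 ≤? deg p
    ... | yes le = le
    ... | no h with reduced a
    ... | c , listed , proper = ⊥-elim (critical (U-extends (valid listed λ {u} {v} Uu Uv _ _ e →
      proper u v (Deletion.nb-survives G p q (away Uu) (away Uv)
        (λ { (refl , b) → proj₁ (nb⁻ e) (only a b) }) (λ { (refl , b) → proj₁ (nb⁻ e) (only b a) }) e))))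
      where
      only : ∀ {x y} → adj G p x ≡ true → adj G p y ≡ true → x ≡ y
      only = count≡1⁻ (adj G p) (s≤s⁻¹ (≰⇒> h))
      away : ∀ {u} → U u ≡ true → u ≢ p
      away Uu refl = <⇒≱ (≤-trans (s≤s (deg≤k q)) (≤-reflexive (+-comm 1 k))) (≤-trans (+-monoʳ-≤ k (s≤s z≤n))
        (≤-trans (contr-total Uu) (≤-trans (∑⟨⟩-single (adj G p) (contr p) q (λ w b ne → ⊥-elim (ne (only b a)))) (contr≤deg (adj-swap a)))))

    another : ∀ {w u} → adj G w u ≡ true → ∃ λ z → adj G w z ≡ true × z ≢ u
    another {w} {u} a with count>0⁻ (adj G w ∖ u) (s≤s⁻¹ (≤-trans (deg≥2 a) (≤-reflexive (count-remove (adj G w) u a))))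
    ... | z , e = z , ∖⁻ e

    contr≥1 : ∀ {u w} → adj G u w ≡ true → 1 ≤ contr u w
    contr≥1 {u} {w} a with bool? (U w) | another (adj-swap a)
    ... | inj₁ e | _ = ≤-trans (≤-reflexive (sym (cong ind e))) (m≤m+n (ind (U w)) _)
    ... | inj₂ e | z , b , ne = ≤-trans (count>0⁺ (λ z → U z & (adj G w z & ! (z == u))) (&⁺ (independent b e) (&⁺ b (!⁺ (≢⁺ ne))))) (m≤n+m _ (ind (U w)))

    contr-free : ∀ {u w} → adj G u w ≡ true → U w ≡ false → suc (contr u w) ≤ deg w
    contr-free a = contr<deg (adj-swap a)

    -- Otherwise the core vertex `a` sees at most one core vertex through `x` and at most `k`
    -- through its other neighbour.
    free-2-neighbour : ∀ {a x} → adj G a x ≡ true → U x ≡ false → deg x ≡ 2 → 3 ≤ deg a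
    free-2-neighbour {a} {x} e Fx two with 3 ≤? deg a
    ... | yes le = le
    ... | no h = ⊥-elim (<⇒≱ (≤-trans (s≤s bound) (≤-reflexive (sym (+-suc k 1)))) (contr-total (independent (adj-swap e) Fx)))
      where
      open ≤-Reasoning
      rest : count (adj G a ∖ x) ≤ 1
      rest = s≤s⁻¹ (≤-trans (≤-reflexive (sym (count-remove (adj G a) x e))) (s≤s⁻¹ (≰⇒> h)))
      bound : ∑⟨ adj G a ⟩ (contr a) ≤ k + 1
      bound = begin
        ∑⟨ adj G a ⟩ (contr a)                 ≡⟨ ∑⟨⟩-remove (adj G a) (contr a) x e ⟩
        contr a x + ∑⟨ adj G a ∖ x ⟩ (contr a) ≤⟨ +-mono-≤ (s≤s⁻¹ (≤-trans (contr-free e Fx) (≤-reflexive two)))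
          (≤-trans (∑⟨⟩-bound (adj G a ∖ x) (contr a) k (λ w b → ≤-trans (contr≤deg (adj-swap (proj₁ (∖⁻ b)))) (deg≤k w))) (*-monoʳ-≤ k rest)) ⟩
        1 + k * 1                              ≡⟨ cong suc (*-identityʳ k) ⟩
        1 + k                                  ≡⟨ +-comm 1 k ⟩
        k + 1                                  ∎

    opaque
      -- The condition on core neighbours other than `v` serves `greedy-free`: a core vertex in the
      -- middle of a link has no neighbours but its two ends, and then sees too little to be in the
      -- core.
      hubAt : Fin n → Fin n → Bool
      hubAt b v = adj G b v & (∑⟨ adj G b ∖ v ⟩ (contr b) ≼ 2 & ! (some (λ w → (adj G b ∖ v) w & (U w & ! (deg w ≐ 2)))))

      Bad : Fin n → Bool
      Bad b = U b & some (hubAt b)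

      Bad⁺ : ∀ {b v} → U b ≡ true → adj G b v ≡ true → ∑⟨ adj G b ∖ v ⟩ (contr b) ≤ 2 →
        (∀ {w} → adj G b w ≡ true → w ≢ v → U w ≡ true → deg w ≡ 2) → Bad b ≡ true
      Bad⁺ {b} {v} Ub a le two = &⁺ Ub (some⁺ v (&⁺ a (&⁺ (≼⁺ le) (!⁺ (¬-true (none ∘ some⁻))))))
        where
        none : (∃ λ w → (adj G b ∖ v) w & (U w & ! (deg w ≐ 2)) ≡ true) → ⊥
        none (w , e) with &⁻ e
        ... | e₁ , e₂ = true≢false (≐⁺ (two (proj₁ (∖⁻ e₁)) (proj₂ (∖⁻ e₁)) (proj₁ (&⁻ e₂)))) (!⁻ (proj₂ (&⁻ e₂)))

      -- Total for convenience, with `b` as a dummy value off the bad vertices.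
      hub : Fin n → Fin n
      hub b with search (hubAt b)
      ... | inj₁ (v , _) = v
      ... | inj₂ _ = b

      hub-spec : ∀ {b} → Bad b ≡ true → hubAt b (hub b) ≡ true
      hub-spec {b} B with search (hubAt b)
      ... | inj₁ (v , e) = e
      ... | inj₂ none = ⊥-elim (true≢false (proj₂ (some⁻ (proj₂ (&⁻ B)))) (none _))

      Bad⇒U : ∀ {b} → Bad b ≡ true → U b ≡ true
      Bad⇒U B = proj₁ (&⁻ B)

      hub-adj : ∀ {b} → Bad b ≡ true → adj G b (hub b) ≡ true
      hub-adj B = proj₁ (&⁻ (hub-spec B))

      others≤2 : ∀ {b} → Bad b ≡ true → ∑⟨ adj G b ∖ hub b ⟩ (contr b) ≤ 2
      others≤2 B = ≼⁻ (proj₁ (&⁻ (proj₂ (&⁻ (hub-spec B)))))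

      others-2 : ∀ {b w} → Bad b ≡ true → adj G b w ≡ true → w ≢ hub b → U w ≡ true → deg w ≡ 2
      others-2 {b} {w} B a ne Uw with bool? (deg w ≐ 2)
      ... | inj₁ e = ≐⁻ e
      ... | inj₂ e = ⊥-elim (true≢false (some⁺ w (&⁺ (∖⁺ a ne) (&⁺ Uw (!⁺ e)))) (!⁻ (proj₂ (&⁻ (proj₂ (&⁻ (hub-spec B)))))))

    module _ {b : Fin n} (B : Bad b ≡ true) where

      others : ∀ {x} → x + 2 ≤ ∑⟨ adj G b ⟩ (contr b) → x ≤ contr b (hub b)
      others {x} le = +-cancelʳ-≤ 2 x _ (≤-trans le (≤-trans (≤-reflexive (∑⟨⟩-remove (adj G b) (contr b) (hub b) (hub-adj B)))
        (+-monoʳ-≤ (contr b (hub b)) (others≤2 B))))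

      contr-hub : k ≤ contr b (hub b)
      contr-hub = others (contr-total (Bad⇒U B))

      hub-deg : deg (hub b) ≡ k
      hub-deg = ≤-antisym (deg≤k (hub b)) (≤-trans contr-hub (contr≤deg (adj-swap (hub-adj B))))

      contr-sum≤ : ∑⟨ adj G b ⟩ (contr b) ≤ k + 2
      contr-sum≤ = ≤-trans (≤-reflexive (∑⟨⟩-remove (adj G b) (contr b) (hub b) (hub-adj B)))
        (+-mono-≤ (≤-trans (contr≤deg (adj-swap (hub-adj B))) (deg≤k (hub b))) (others≤2 B))

      tight : count (Nb U b) ≤ k + 2
      tight = ≤-trans (cover b (adj G b) (Nb U b) (Nb-hit b)) contr-sum≤

      Bad-deg : deg b ≤ 3
      Bad-deg = ≤-trans (≤-reflexive (count-remove (adj G b) (hub b) (hub-adj B))) (s≤s (≤-trans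
        (≤-trans (≤-reflexive (count≡∑⟨⟩ (adj G b ∖ hub b))) (∑⟨⟩-mono (adj G b ∖ hub b) (λ _ → 1) (contr b) (λ w e → contr≥1 (proj₁ (∖⁻ e))))) (others≤2 B)))

    hub-not-Bad : ∀ {b} → Bad b ≡ true → Bad (hub b) ≡ true → ⊥
    hub-not-Bad B B′ = <⇒≱ (≤-trans (s≤s (s≤s (s≤s (s≤s z≤n)))) 17≤k) (≤-trans (≤-reflexive (sym (hub-deg B))) (Bad-deg B′))

    -- The vertex `hub b` shows each bad neighbour at least `k - 1` core vertices, whereas the
    -- neighbours of `c` other than its hub show at most two.
    hub-unique : ∀ {b c} → Bad b ≡ true → Bad c ≡ true → adj G (hub b) c ≡ true → hub c ≡ hub b
    hub-unique {b} {c} B C a with hub c ≟ hub b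
    ... | yes e = e
    ... | no ne = ⊥-elim (<⇒≱ (≤-trans (s≤s (s≤s (s≤s (s≤s z≤n)))) 17≤k) (≤-trans (contr-hub B) (≤-trans compare
      (s≤s (≤-trans (≤∑⟨⟩ (adj G c ∖ hub c) (contr c) (∖⁺ (adj-swap a) (ne ∘ sym))) (others≤2 C))))))
      where
      v : Fin n
      v = hub b
      near : Fin n → Bool
      near z = U z & adj G v z
      compare : contr b v ≤ suc (contr c v)
      compare = ≤-trans (+-monoʳ-≤ (ind (U v)) (≤-trans (count-mono (λ z e → &⁺ (proj₁ (&⁻ e)) (proj₁ (&⁻ (proj₂ (&⁻ e))))))
          (≤-trans (≤-reflexive (count-remove near c (&⁺ (Bad⇒U C) a)))
            (s≤s (count-mono (λ z e → &⁺ (proj₁ (&⁻ (proj₁ (∖⁻ e)))) (&⁺ (proj₂ (&⁻ (proj₁ (∖⁻ e)))) (!⁺ (≢⁺ (proj₂ (∖⁻ e)))))))))))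
        (≤-reflexive (+-suc (ind (U v)) _))

    opaque
      Q : Fin n → Fin n → Bool
      Q b c = (Bad b & Bad c) & (nb b c & ! (hub b == hub c))

      Q⁺ : ∀ {b c} → Bad b ≡ true → Bad c ≡ true → nb b c ≡ true → hub b ≢ hub c → Q b c ≡ true
      Q⁺ B C e ne = &⁺ (&⁺ B C) (&⁺ e (!⁺ (≢⁺ ne)))

      Q⁻ : ∀ {b c} → Q b c ≡ true → Bad b ≡ true × Bad c ≡ true × nb b c ≡ true × hub b ≢ hub c
      Q⁻ e with &⁻ e
      ... | e₁ , e₂ = proj₁ (&⁻ e₁) , proj₂ (&⁻ e₁) , proj₁ (&⁻ e₂) , ≢⁻ (!⁻ (proj₂ (&⁻ e₂)))

    Q-sym : ∀ b c → Q b c ≡ Q c b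
    Q-sym b c = bool-ext (half b c) (half c b)
      where
      half : ∀ b c → Q b c ≡ true → Q c b ≡ true
      half b c e with Q⁻ e
      ... | B , C , m , ne = Q⁺ C B (trans (nb-sym c b) m) (ne ∘ sym)

    Q-via : ∀ {b c} → Q b c ≡ true → ∃ λ w → adj G b w ≡ true × w ≢ hub b × (w ≡ c ⊎ adj G w c ≡ true)
    Q-via {b} {c} e with Q⁻ e
    ... | B , C , m , ne with nb⁻ m
    ... | _ , inj₁ a = c , a , (λ { refl → hub-not-Bad B C }) , inj₁ refl
    ... | _ , inj₂ (w , a , a′) = w , a , (λ { refl → ne (sym (hub-unique B C a′)) }) , inj₂ a′

    -- With equal hubs, `c` would be seen both through `w` and through the hub, and `b` would see
    -- fewer than `k + 2` core vertices.
    via-Q : ∀ {b c w} → Bad b ≡ true → Bad c ≡ true → b ≢ c → adj G b w ≡ true → w ≢ hub b →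
      w ≡ c ⊎ adj G w c ≡ true → Q b c ≡ true
    via-Q {b} {c} {w} B C ne a w≢ h = Q⁺ B C (near h) distinct
      where
      near : w ≡ c ⊎ adj G w c ≡ true → nb b c ≡ true
      near (inj₁ refl) = nb-adj ne a
      near (inj₂ a′) = nb-common w ne a a′
      hit-w : w ≡ c ⊎ adj G w c ≡ true → 1 ≤ hit b w c
      hit-w (inj₁ e) = hit-self (Bad⇒U C) (sym e)
      hit-w (inj₂ a′) = hit-adj (Bad⇒U C) a′ (ne ∘ sym)
      distinct : hub b ≢ hub c
      distinct e = <⇒≱ (≤-trans (cover-twice b (adj G b) (Nb U b) (Nb-hit b) {c} a (hub-adj B) w≢ (hit-w h)
        (hit-adj (Bad⇒U C) (trans (cong (λ v → adj G v c) e) (adj-swap (hub-adj C))) (ne ∘ sym))) (contr-sum≤ B)) (U-core (Bad⇒U B))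

    Q-deg : ∀ b → count (Q b) ≤ 2
    Q-deg b with bool? (Bad b)
    ... | inj₂ h = ≤-trans (≤-reflexive (count≡0 (λ c → ¬-true (λ e → true≢false (proj₁ (Q⁻ e)) h)))) z≤n
    ... | inj₁ B = ≤-trans (cover b (adj G b ∖ hub b) (Q b) at) (others≤2 B)
      where
      at : ∀ z → Q b z ≡ true → ∃ λ w → (adj G b ∖ hub b) w ≡ true × 1 ≤ hit b w z
      at z e with Q-via e | Q⁻ e
      ... | w , a , ne , inj₁ refl | _ , C , _ = w , ∖⁺ a ne , hit-self (Bad⇒U C) refl
      ... | w , a , ne , inj₂ a′ | _ , C , m , _ = w , ∖⁺ a ne , hit-adj (Bad⇒U C) a′ (proj₁ (nb⁻ m) ∘ sym)

    open Bads Bad hub Q Q-sym (proj₁ ∘ Q⁻) (λ e → proj₂ (proj₂ (proj₂ (Q⁻ e)))) Q-deg public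
      using (m; r; E; H; H⁻; GreedyFree; links-bound; γ; γ-hub; γ-Q; γ⁻; iso; m≥1)

    γ⇒nb : ∀ {b c} → Bad b ≡ true → Bad c ≡ true → γ b c ≡ true → nb b c ≡ true
    γ⇒nb {b} {c} B C e with γ⁻ e
    ... | ne , inj₁ h = nb-common (hub b) ne (hub-adj B) (trans (cong (λ v → adj G v c) h) (adj-swap (hub-adj C)))
    ... | ne , inj₂ q = proj₁ (proj₂ (proj₂ (Q⁻ q)))

    nb⇒γ : ∀ {b c} → Bad b ≡ true → Bad c ≡ true → nb b c ≡ true → γ b c ≡ true
    nb⇒γ {b} {c} B C e with hub b ≟ hub c
    ... | yes h = γ-hub (proj₁ (nb⁻ e)) h
    ... | no ne = γ-Q (Q⁺ B C e ne)

    -- The link from `u` to `y` is an edge or has a middle vertex `x`. Such an `x` is free, since in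
    -- the core it would have degree 2 and see at most `3 + 3` vertices. Either way an edge at `u`
    -- has both ends among the vertices left uncoloured, against `no-edge`.
    greedy-free : GreedyFree
    greedy-free {u} {w} {p} {y} {z} {l} grown all Bu u∉ uw y∈ uy z∈ uz y≢z w≢y w≢z only = inside (Q-via uy) (proj₁ (proj₂ (Q⁻ uy)))
      where
      ext : Extends U (u ∷ l)
      ext = greedy Bad γ (λ B → Bad⇒U B , tight B) γ⇒nb nb⇒γ U-extends grown all Bu u∉ uw y∈ (γ-Q uy) z∈ uz y≢z w≢y w≢z only
      inside : (∃ λ x → adj G u x ≡ true × x ≢ hub u × (x ≡ y ⊎ adj G x y ≡ true)) → Bad y ≡ true → ⊥
      inside (x , a , ne , inj₁ refl) By = no-edge ext a (inj₂ (here refl)) (inj₂ (there y∈))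
      inside (x , a , ne , inj₂ a′) By with bool? (U x)
      ... | inj₂ h = no-edge ext a (inj₂ (here refl)) (inj₁ h)
      ... | inj₁ Ux = <⇒≱ (≤-trans (s≤s few) (≤-trans (≤-trans (m≤m+n 7 10) 17≤k) (m≤m+n k 2))) (contr-total Ux)
        where
        few : ∑⟨ adj G x ⟩ (contr x) ≤ 6
        few = ≤-trans (≤-reflexive (∑⟨⟩-pair (adj G x) (contr x) (others-2 Bu a ne Ux) (adj-swap a) a′ (proj₁ (nb⁻ (proj₁ (proj₂ (proj₂ (Q⁻ uy))))))))
          (+-mono-≤ (≤-trans (contr≤deg a) (Bad-deg Bu)) (≤-trans (contr≤deg (adj-swap a′)) (Bad-deg By)))

    pot : ∑⟨ Bad ⟩ (r Bad) ≤ 4 * count (λ v → deg v ≐ k)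
    pot = ≤-trans (links-bound greedy-free (count Bad) ≤-refl id) (*-monoʳ-≤ 4 (count-mono at))
      where
      at : ∀ v → H Bad v ≡ true → deg v ≐ k ≡ true
      at v h with H⁻ h
      ... | b , B , refl = ≐⁺ (hub-deg B)

-- The six kinds of a neighbour w of a small core vertex v: what v gives to w (at most), what
-- w gives to v (at least), the contribution of w (at most, capped at 19), and whether w is a free 2-vertex.
gives : ℕ → Fin 6 → ℕ
gives g = lookup (6 ∷ g ∷ 0 ∷ 0 ∷ 0 ∷ 0 ∷ [])

receives capacity isFree : Fin 6 → ℕ
receives = lookup (0 ∷ 0 ∷ 0 ∷ 6 ∷ 7 ∷ 8 ∷ [])
capacity = lookup (1 ∷ 2 ∷ 7 ∷ 9 ∷ 14 ∷ 19 ∷ [])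
isFree = lookup (1 ∷ 0 ∷ 0 ∷ 0 ∷ 0 ∷ 0 ∷ [])

-- A finite check. The bound 19 is `17 + 2`, the least total contribution at a core vertex; exactly
-- two free 2-neighbours are excluded because such a 3-vertex is a `star`.
kinds-3 : ∀ i j l → isFree i + (isFree j + isFree l) ≢ 2 → 19 ≤ capacity i + (capacity j + capacity l) →
  gives 2 i + (gives 2 j + gives 2 l) ≤ receives i + (receives j + receives l)
kinds-3 = toWitness {a? = all? λ i → all? λ j → all? λ l →
  ¬? (isFree i + (isFree j + isFree l) ℕ.≟ 2) →-dec ((19 ≤? capacity i + (capacity j + capacity l)) →-dec
  (gives 2 i + (gives 2 j + gives 2 l) ≤? receives i + (receives j + receives l)))} _

-- The line through the tight kinds 0F and 5F of a 4-vertex with three free 2-neighbours.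
kinds-line : ∀ i → 15 * gives 3 i + 14 * (capacity i ⊓ 16) ≤ 15 * receives i + 104
kinds-line = toWitness {a? = all? λ i → 15 * gives 3 i + 14 * (capacity i ⊓ 16) ≤? 15 * receives i + 104} _

-- Discharging rules and the balance at each vertex

module Discharging (G : Graph n) (k : ℕ) (17≤k : 17 ≤ k) (L : Fin n → List ℕ) (L-unique : ∀ v → Unique (L v))
  (L-length : ∀ v → length (L v) ≡ k + 2) (deg≤k : ∀ v → count (adj G v) ≤ k)
  (critical : ¬ Colouring.Lists.Colourable G k L L-unique L-length)
  (reduced : ∀ {p q} → adj G p q ≡ true → Colouring.Lists.Colourable (deleteEdge G p q) k L L-unique L-length) where

  open Colouring G
  open Colouring.Lists G k L L-unique L-length using (Nb)
  open Structure G k 17≤k L L-unique L-length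
  open Critical deg≤k critical reduced

  free2 core2 lone3 star : Fin n → Bool
  free2 x = ! (U x) & deg x ≐ 2
  core2 x = U x & deg x ≐ 2
  -- Such a vertex gives 2 to its single 2-neighbour and gets at least 1 from each of the other two.
  -- The givers can afford it: through a free 3-vertex one sees at most two core vertices, so their
  -- other neighbours contribute much.
  lone3 x = ! (U x) & (deg x ≐ 3 & count (λ y → adj G x y & deg y ≐ 2) ≐ 1)
  star x = deg x ≐ 3 & count (λ y → adj G x y & free2 y) ≐ 2

  pairs : Fin n → ℕ
  pairs x = count (λ y → adj G x y & deg y ≐ 2)

  linked : Fin n → Fin n → Bool
  linked u x = some (λ b → adj G x b & (star b & ! (b == u)))

  -- The charge `10 * d - 30` reaches `8 * d` at 15 and `7 * d` at 10; at 8 it is 50, enough for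
  -- `6 * 8`.
  gift : ℕ → ℕ
  gift d = if 15 ≼ d then 8 else if 10 ≼ d then 7 else 6

  -- A core 2-vertex needs 10, and the degrees of its neighbours add up to at least 19. Next to
  -- degree 5 to 7 the other neighbour has degree at least 12 and gives 7; next to degree 3 or 4 it
  -- has degree at least 15 and gives 8. A free 3-vertex with several 2-neighbours gives nothing:
  -- its 2-neighbours are bad and draw on the pot.
  gift2 : Fin n → ℕ
  gift2 u = if deg u ≼ 3 then (if U u then 2 else if pairs u ≐ 1 then 2 else 0) else if deg u ≼ 4 then 2 else 3

  -- Ten times the charge that u sends to its neighbour v.
  give : Fin n → Fin n → ℕ
  give u v = if 8 ≼ deg u then gift (deg u) else if deg u ≼ 2 then 0 else
    if free2 v then (if star u then 4 + ind (linked u v) else 6) else if core2 v then gift2 u else ind (lone3 v)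

  private
    ≼-no : ∀ {x y} → y < x → x ≼ y ≡ false
    ≼-no lt = ¬-true (λ e → <⇒≱ lt (≼⁻ e))

    ≐-no : ∀ {x y} → x ≢ y → x ≐ y ≡ false
    ≐-no ne = ¬-true (ne ∘ ≐⁻)

  gift≥6 : ∀ d → 6 ≤ gift d
  gift≥6 d with 15 ≼ d | 10 ≼ d
  ... | true | _ = m≤m+n 6 2
  ... | false | true = m≤m+n 6 1
  ... | false | false = ≤-refl

  give-big : ∀ {u v} → 8 ≤ deg u → give u v ≡ gift (deg u)
  give-big le rewrite ≼⁺ le = refl

  give≥6 : ∀ {u v} → 8 ≤ deg u → 6 ≤ give u v
  give≥6 {u} le = ≤-trans (gift≥6 (deg u)) (≤-reflexive (sym (give-big le)))

  give≥7 : ∀ {u v} → 10 ≤ deg u → 7 ≤ give u v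
  give≥7 {u} {v} le = ≤-trans at (≤-reflexive (sym (give-big {u} {v} (≤-trans (m≤m+n 8 2) le))))
    where
    at : 7 ≤ gift (deg u)
    at rewrite ≼⁺ le with 15 ≼ deg u
    ... | true = m≤m+n 7 1
    ... | false = ≤-refl

  give≥8 : ∀ {u v} → 15 ≤ deg u → 8 ≤ give u v
  give≥8 {u} {v} le = ≤-trans at (≤-reflexive (sym (give-big {u} {v} (≤-trans (m≤m+n 8 7) le))))
    where
    at : 8 ≤ gift (deg u)
    at rewrite ≼⁺ le = ≤-refl

  give-2 : ∀ {u v} → deg u ≤ 2 → give u v ≡ 0
  give-2 {u} le rewrite ≼-no {8} (≤-trans (s≤s le) (m≤m+n 3 5)) | ≼⁺ le = refl

  module Small {u : Fin n} (≥3 : 3 ≤ deg u) (≤7 : deg u ≤ 7) where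

    give-small : ∀ v → give u v ≡ (if free2 v then (if star u then 4 + ind (linked u v) else 6) else if core2 v then gift2 u else ind (lone3 v))
    give-small v rewrite ≼-no {8} (s≤s ≤7) | ≼-no {deg u} ≥3 = refl

    give-star : ∀ {v} → free2 v ≡ true → star u ≡ true → give u v ≡ 4 + ind (linked u v)
    give-star {v} f s = trans (give-small v) at
      where
      at : (if free2 v then (if star u then 4 + ind (linked u v) else 6) else if core2 v then gift2 u else ind (lone3 v)) ≡ 4 + ind (linked u v)
      at rewrite f | s = refl

    give-free : ∀ {v} → free2 v ≡ true → star u ≡ false → give u v ≡ 6
    give-free {v} f s = trans (give-small v) at
      where
      at : (if free2 v then (if star u then 4 + ind (linked u v) else 6) else if core2 v then gift2 u else ind (lone3 v)) ≡ 6
      at rewrite f | s = refl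

    give-core2 : ∀ {v} → core2 v ≡ true → give u v ≡ gift2 u
    give-core2 {v} c = trans (give-small v) at
      where
      f : free2 v ≡ false
      f = &-falseˡ (!-true (proj₁ (&⁻ c)))
      at : (if free2 v then (if star u then 4 + ind (linked u v) else 6) else if core2 v then gift2 u else ind (lone3 v)) ≡ gift2 u
      at rewrite f | c = refl

    give-rest : ∀ {v} → free2 v ≡ false → core2 v ≡ false → give u v ≡ ind (lone3 v)
    give-rest {v} f c = trans (give-small v) at
      where
      at : (if free2 v then (if star u then 4 + ind (linked u v) else 6) else if core2 v then gift2 u else ind (lone3 v)) ≡ ind (lone3 v)
      at rewrite f | c = refl

  gift2≤3 : ∀ u → gift2 u ≤ 3
  gift2≤3 u with deg u ≼ 3 | U u | pairs u ≐ 1 | deg u ≼ 4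
  ... | true | true | _ | _ = m≤m+n 2 1
  ... | true | false | true | _ = m≤m+n 2 1
  ... | true | false | false | _ = z≤n
  ... | false | _ | _ | true = m≤m+n 2 1
  ... | false | _ | _ | false = ≤-refl

  gift2-≤4 : ∀ {u} → deg u ≤ 4 → gift2 u ≤ 2
  gift2-≤4 {u} le rewrite ≼⁺ le with deg u ≼ 3 | U u | pairs u ≐ 1
  ... | true | true | _ = ≤-refl
  ... | true | false | true = ≤-refl
  ... | true | false | false = z≤n
  ... | false | _ | _ = ≤-refl

  gift2-5 : ∀ {u} → 5 ≤ deg u → gift2 u ≡ 3
  gift2-5 {u} le rewrite ≼-no {deg u} {3} (≤-trans (m≤m+n 4 1) le) | ≼-no {deg u} {4} le = refl

  gift2-4 : ∀ {u} → deg u ≡ 4 → gift2 u ≡ 2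
  gift2-4 {u} e rewrite ≼-no {deg u} {3} (≤-reflexive (sym e)) | ≼⁺ (≤-reflexive e) = refl

  gift2-core : ∀ {u} → deg u ≡ 3 → U u ≡ true → gift2 u ≡ 2
  gift2-core {u} e Uu rewrite ≼⁺ (≤-reflexive e) | Uu = refl

  gift2-lone : ∀ {u} → deg u ≡ 3 → U u ≡ false → pairs u ≡ 1 → gift2 u ≡ 2
  gift2-lone {u} e Fu p rewrite ≼⁺ (≤-reflexive e) | Fu | ≐⁺ p = refl

  gift2-none : ∀ {u} → deg u ≡ 3 → U u ≡ false → pairs u ≢ 1 → gift2 u ≡ 0
  gift2-none {u} e Fu p rewrite ≼⁺ (≤-reflexive e) | Fu | ≐-no p = refl

  free2⁻ : ∀ {x} → free2 x ≡ true → U x ≡ false × deg x ≡ 2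
  free2⁻ e = !⁻ (proj₁ (&⁻ e)) , ≐⁻ (proj₂ (&⁻ e))

  free2⁺ : ∀ {x} → U x ≡ false → deg x ≡ 2 → free2 x ≡ true
  free2⁺ h e = &⁺ (!⁺ h) (≐⁺ e)

  star⇒U : ∀ {x} → star x ≡ true → U x ≡ true
  star⇒U {x} s with count>0⁻ _ (≤-trans (s≤s z≤n) (≤-reflexive (sym (≐⁻ (proj₂ (&⁻ s))))))
  ... | y , e = independent (adj-swap (proj₁ (&⁻ e))) (proj₁ (free2⁻ (proj₂ (&⁻ e))))

  received : Fin n → ℕ
  received v = ∑⟨ adj G v ⟩ (λ w → give w v)

  sent : Fin n → ℕ
  sent v = ∑⟨ adj G v ⟩ (give v)

  share : Fin n → ℕ
  share v = guard (Bad v) (r Bad v)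

  share-Bad : ∀ {v} → Bad v ≡ true → share v ≡ r Bad v
  share-Bad = guard-true

  -- The 4 is the deposit of a `k`-vertex into the pot and `share v` what a bad vertex draws from
  -- it. Isolated vertices are exempt from the 30, as they are left out of the final subgraph.
  Balanced : Fin n → Set
  Balanced v = 30 * ind (1 ≼ deg v) + (sent v + 4 * ind (deg v ≐ k)) ≤ 10 * deg v + (received v + share v)

  not-k : ∀ {v} → deg v < 17 → ind (deg v ≐ k) ≡ 0
  not-k lt = cong ind (≐-no (λ e → <⇒≱ lt (≤-trans 17≤k (≤-reflexive (sym e)))))

  balance-by : ∀ {v} → deg v < 17 → ∀ {x} → 30 + sent v ≤ 10 * deg v + x → x ≤ received v + share v → Balanced v
  balance-by {v} lt {x} le le′ = begin
    30 * ind (1 ≼ deg v) + (sent v + 4 * ind (deg v ≐ k))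
      ≡⟨ cong (λ y → 30 * ind (1 ≼ deg v) + y) (trans (cong (λ y → sent v + 4 * y) (not-k lt)) (+-identityʳ (sent v))) ⟩
    30 * ind (1 ≼ deg v) + sent v
      ≤⟨ +-monoˡ-≤ (sent v) (*-monoʳ-≤ 30 (ind≤1 (1 ≼ deg v))) ⟩
    30 + sent v
      ≤⟨ le ⟩
    10 * deg v + x
      ≤⟨ +-monoʳ-≤ (10 * deg v) le′ ⟩
    10 * deg v + (received v + share v) ∎
    where open ≤-Reasoning

  balanced-0 : ∀ {v} → deg v ≡ 0 → Balanced v
  balanced-0 {v} e = ≤-trans (≤-reflexive (cong₂ _+_ (cong (λ b → 30 * ind b) (≼-no (≤-reflexive (cong suc e))))
    (cong₂ _+_ (∑⟨⟩-empty (adj G v) (give v) e) (cong (4 *_) (not-k (≤-trans (≤-reflexive (cong suc e)) (m≤m+n 1 16))))))) z≤n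

  balanced-big : ∀ {v} → 8 ≤ deg v → Balanced v
  balanced-big {v} le = ≤-trans (+-mono-≤ (*-monoʳ-≤ 30 (ind≤1 (1 ≼ deg v))) (+-monoˡ-≤ (4 * ind (deg v ≐ k)) out))
    (≤-trans (size (15 ≤? d) (10 ≤? d)) (m≤m+n (10 * d) _))
    where
    d : ℕ
    d = deg v
    out : sent v ≤ gift d * d
    out = ∑⟨⟩-bound (adj G v) (give v) (gift d) (λ w _ → ≤-reflexive (give-big {v} {w} le))
    top : 15 ≤ d → ind (d ≐ k) ≡ 0 ⊎ 17 ≤ d
    top _ with bool? (d ≐ k)
    ... | inj₁ e = inj₂ (≤-trans 17≤k (≤-reflexive (sym (≐⁻ e))))
    ... | inj₂ e = inj₁ (cong ind e)
    size : Dec (15 ≤ d) → Dec (10 ≤ d) → 30 * 1 + (gift d * d + 4 * ind (d ≐ k)) ≤ 10 * d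
    size (yes 15≤d) _ with top 15≤d
    ... | inj₁ e rewrite ≼⁺ 15≤d | e = ≤-trans (≤-reflexive (solve 1 (λ d → con 30 :+ (con 8 :* d :+ con 0) := con 8 :* d :+ con 2 :* con 15) refl d))
      (≤-trans (+-monoʳ-≤ (8 * d) (*-monoʳ-≤ 2 15≤d)) (≤-reflexive (solve 1 (λ d → con 8 :* d :+ con 2 :* d := con 10 :* d) refl d)))
    ... | inj₂ 17≤d rewrite ≼⁺ 15≤d = ≤-trans (+-monoʳ-≤ 30 (+-monoʳ-≤ (8 * d) (*-monoʳ-≤ 4 (ind≤1 (d ≐ k)))))
      (≤-trans (≤-reflexive (solve 1 (λ d → con 30 :+ (con 8 :* d :+ con 4) := con 8 :* d :+ con 2 :* con 17) refl d))
      (≤-trans (+-monoʳ-≤ (8 * d) (*-monoʳ-≤ 2 17≤d)) (≤-reflexive (solve 1 (λ d → con 8 :* d :+ con 2 :* d := con 10 :* d) refl d))))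
    size (no d<15) (yes 10≤d) rewrite ≼-no (≰⇒> d<15) | ≼⁺ 10≤d | not-k {v} (≤-trans (≰⇒> d<15) (m≤m+n 15 2)) =
      ≤-trans (≤-reflexive (solve 1 (λ d → con 30 :+ (con 7 :* d :+ con 0) := con 7 :* d :+ con 3 :* con 10) refl d))
      (≤-trans (+-monoʳ-≤ (7 * d) (*-monoʳ-≤ 3 10≤d)) (≤-reflexive (solve 1 (λ d → con 7 :* d :+ con 3 :* d := con 10 :* d) refl d)))
    size (no d<15) (no d<10) rewrite ≼-no (≰⇒> d<15) | ≼-no (≰⇒> d<10) | not-k {v} (≤-trans (≰⇒> d<15) (m≤m+n 15 2)) =
      ≤-trans (≤-reflexive (solve 1 (λ d → con 30 :+ (con 6 :* d :+ con 0) := con 6 :* d :+ con 30) refl d))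
      (≤-trans (+-monoʳ-≤ (6 * d) (≤-trans (m≤m+n 30 2) (*-monoʳ-≤ 4 le))) (≤-reflexive (solve 1 (λ d → con 6 :* d :+ con 4 :* d := con 10 :* d) refl d)))

  -- Vertices of degree 2

  two-others : ∀ {v a b} → deg v ≡ 2 → adj G v a ≡ true → adj G v b ≡ true → a ≢ b →
    ∀ {w} → adj G v w ≡ true → w ≢ a → w ≡ b
  two-others {v} {a} {b} two va vb ab {w} vw wa with w ≟ b
  ... | yes e = e
  ... | no wb = ⊥-elim (<⇒≱ (count≥3 (adj G v) vw va vb wa wb ab) (≤-reflexive two))

  opaque
    -- The degree of `b` is too small for a hub, so the hub can only be `a`.
    2-bad : ∀ {v a b} → U v ≡ true → deg v ≡ 2 → adj G v a ≡ true → adj G v b ≡ true → a ≢ b →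
      contr v b ≤ 2 → deg b ≤ 3 → (U b ≡ true → deg b ≡ 2) → Bad v ≡ true × hub v ≡ a
    2-bad {v} {a} {b} Uv two va vb ab cb db b2 = B , hub-is (hub v ≟ a)
      where
      B : Bad v ≡ true
      B = Bad⁺ Uv va (≤-trans (∑⟨⟩-single (adj G v ∖ a) (contr v) b
        (λ w e ne → ⊥-elim (ne (two-others two va vb ab (proj₁ (∖⁻ e)) (proj₂ (∖⁻ e)))))) cb)
        (λ vw wa → core-b (two-others two va vb ab vw wa))
        where
        core-b : ∀ {w} → w ≡ b → U w ≡ true → deg w ≡ 2
        core-b refl = b2
      hub-is : Dec (hub v ≡ a) → hub v ≡ a
      hub-is (yes e) = e
      hub-is (no ne) = ⊥-elim (<⇒≱ (≤-trans (m≤m+n 4 13) 17≤k) (≤-trans (≤-reflexive (sym (hub-deg B)))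
        (≤-trans (≤-reflexive (cong deg (two-others two va vb ab (hub-adj B) ne))) db)))

  opaque
    -- If `y` is the only link of `x`, then `x` is the only link of `y`: any other would by `h` be a
    -- link of `x`, hence `y` itself. The link is then isolated and weighs 2.
    r≥2 : ∀ {x y} → Q x y ≡ true → (∀ {z} → Q y z ≡ true → z ≢ x → Q x z ≡ true) → 2 ≤ r Bad x
    r≥2 {x} {y} q h with search (λ z → Q x z & ! (z == y))
    ... | inj₁ (z , e) = ≤-trans (+-mono-≤ (m≥1 q) (m≥1 (proj₁ (&⁻ e)))) (≤∑⟨⟩₂ Bad (m x)
      (proj₁ (proj₂ (Q⁻ q))) (proj₁ (proj₂ (Q⁻ (proj₁ (&⁻ e))))) (≢⁻ (!⁻ (proj₂ (&⁻ e))) ∘ sym))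
    ... | inj₂ none = ≤-trans (≤-reflexive (sym m≡2)) (≤∑⟨⟩ Bad (m x) (proj₁ (proj₂ (Q⁻ q))))
      where
      only-y : ∀ {z} → Q x z ≡ true → z ≡ y
      only-y {z} q′ with z ≟ y
      ... | yes e = e
      ... | no ne = ⊥-elim (true≢false (&⁺ q′ (!⁺ (≢⁺ ne))) (none z))
      only-x : ∀ {z} → Q y z ≡ true → z ≡ x
      only-x {z} q′ with z ≟ x
      ... | yes e = e
      ... | no ne = ⊥-elim (proj₂ (proj₂ (proj₂ (Q⁻ q′))) (cong hub (sym (only-y (h q′ ne)))))
      one : ∀ {u t} → Q u t ≡ true → (∀ {z} → Q u z ≡ true → z ≡ t) → count (Q u) ≡ 1
      one {u} {t} q o = trans (count-remove (Q u) t q) (cong suc (count≡0 (λ z → ¬-true (λ e → proj₂ (∖⁻ e) (o (proj₁ (∖⁻ e)))))))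
      m≡2 : m x y ≡ 2
      m≡2 = trans (guard-true q) (cong (λ b → if b then 2 else 1)
        (&⁺ (≐⁺ (one q only-y)) (≐⁺ (one (trans (Q-sym y x) q) only-x))))

  opaque
    -- Both `v` and `b` are bad, with their hubs on the far sides. The only way out of `b` besides
    -- its hub leads through `v` to the hub of `v`, so `b` has no further link.
    poor-2 : ∀ {v a b} → U v ≡ true → deg v ≡ 2 → adj G v a ≡ true → adj G v b ≡ true → a ≢ b → deg b ≡ 2 → 2 ≤ share v
    poor-2 {v} {a} {b} Uv two va vb ab b2 with bool? (U b)
    ... | inj₂ Fb = ⊥-elim (<⇒≱ ≤-refl (≤-trans (free-2-neighbour vb Fb b2) (≤-reflexive two)))
    ... | inj₁ Ub with another (adj-swap vb)
    ... | c , bc , c≢v with 2-bad Uv two va vb ab (≤-trans (contr≤deg (adj-swap vb)) (≤-reflexive b2)) (≤-trans (≤-reflexive b2) (m≤m+n 2 1)) (λ _ → b2)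
      | 2-bad Ub b2 bc (adj-swap vb) c≢v (≤-trans (contr≤deg vb) (≤-reflexive two)) (≤-trans (≤-reflexive two) (m≤m+n 2 1)) (λ _ → two)
    ... | Bv , hv | Bb , hb = ≤-trans (r≥2 (via-Q Bv Bb (adj⇒≢ vb) vb (λ e → ab (trans (sym hv) (sym e))) (inj₁ refl)) back)
        (≤-reflexive (sym (share-Bad Bv)))
      where
      back : ∀ {z} → Q b z ≡ true → z ≢ v → Q v z ≡ true
      back {z} q z≢v with Q-via q | Q⁻ q
      ... | w , bw , w≢h , h | _ , Bz , _ , hubs with two-others b2 bc (adj-swap vb) c≢v bw (λ e → w≢h (trans e (sym hb)))
      ... | refl with h
      ... | inj₁ e = ⊥-elim (z≢v (sym e))
      ... | inj₂ vz with z ≟ a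
      ... | yes refl = ⊥-elim (hub-not-Bad Bv (subst (λ x → Bad x ≡ true) (sym hv) Bz))
      ... | no z≢a = ⊥-elim (hubs (cong hub (sym (two-others two va vb ab vz z≢a))))

  opaque
    -- Another 2-vertex `x` at `b` is bad as well. All links of `x` run through `b`, so their ends
    -- other than `v` are links of `v` too.
    poor-3 : ∀ {v a b} → U v ≡ true → deg v ≡ 2 → adj G v a ≡ true → adj G v b ≡ true → a ≢ b → deg b ≡ 3 →
      U b ≡ false → pairs b ≢ 1 → 2 ≤ share v
    poor-3 {v} {a} {b} Uv two va vb ab b3 Fb p≢1 with count>0⁻ ((λ y → adj G b y & deg y ≐ 2) ∖ v) (s≤s⁻¹ (≤-trans
        (≤∧≢⇒< (count>0⁺ _ at-v) (p≢1 ∘ sym)) (≤-reflexive (count-remove _ v at-v))))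
      where
      at-v : adj G b v & deg v ≐ 2 ≡ true
      at-v = &⁺ (adj-swap vb) (≐⁺ two)
    ... | x , e with ∖⁻ e
    ... | e′ , x≢v with &⁻ e′
    ... | bx , x2 with another (adj-swap bx)
    ... | c , xc , c≢b with 2-bad Uv two va vb ab (s≤s⁻¹ (≤-trans (contr-free vb Fb) (≤-reflexive b3))) (≤-reflexive b3) (λ Ub → ⊥-elim (true≢false Ub Fb))
      | 2-bad (independent bx Fb) (≐⁻ x2) xc (adj-swap bx) c≢b (s≤s⁻¹ (≤-trans (contr-free (adj-swap bx) Fb) (≤-reflexive b3))) (≤-reflexive b3) (λ Ub → ⊥-elim (true≢false Ub Fb))
    ... | Bv , hv | Bx , hx = ≤-trans (r≥2 (via-Q Bv Bx (x≢v ∘ sym) vb b≢hub (inj₂ bx)) back) (≤-reflexive (sym (share-Bad Bv)))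
      where
      b≢hub : b ≢ hub v
      b≢hub e = ab (trans (sym hv) (sym e))
      back : ∀ {z} → Q x z ≡ true → z ≢ v → Q v z ≡ true
      back {z} q z≢v with Q-via q | Q⁻ q
      ... | w , xw , w≢h , h | _ , Bz , _ with two-others (≐⁻ x2) xc (adj-swap bx) c≢b xw (λ e → w≢h (trans e (sym hx)))
      ... | refl with h
      ... | inj₁ refl = ⊥-elim (true≢false (Bad⇒U Bz) Fb)
      ... | inj₂ bz = via-Q Bv Bz (z≢v ∘ sym) vb b≢hub (inj₂ bz)

  -- 3-vertices with two free neighbours of degree 2

  record Star (v : Fin n) : Set where
    field
      {x x′ p} : Fin n
      vx : adj G v x ≡ true
      vx′ : adj G v x′ ≡ true
      vp : adj G v p ≡ true
      x≢x′ : x ≢ x′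
      x≢p : x ≢ p
      x′≢p : x′ ≢ p
      fx : free2 x ≡ true
      fx′ : free2 x′ ≡ true
      hub≡p : hub v ≡ p
      bad : Bad v ≡ true

  opaque
    -- Each free 2-neighbour shows `v` at most one core vertex, so `v` is bad; only the third
    -- neighbour is large enough to be the hub.
    star-shape : ∀ {v} → star v ≡ true → Star v
    star-shape {v} s with &⁻ s
    ... | s₁ , s₂ with count>1⁻ (λ y → adj G v y & free2 y) (≤-reflexive (sym (≐⁻ s₂)))
    ... | x , x′ , ex , ex′ , x≢x′ with &⁻ ex | &⁻ ex′
    ... | vx , fx | vx′ , fx′ with count>0⁻ ((adj G v ∖ x) ∖ x′) (≤-reflexive (sym rest≡1))
      where
      rest≡1 : count ((adj G v ∖ x) ∖ x′) ≡ 1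
      rest≡1 = cong (ℕ._∸ 2) (trans (cong suc (sym (count-remove (adj G v ∖ x) x′ (∖⁺ vx′ (x≢x′ ∘ sym))))) (trans (sym (count-remove (adj G v) x vx)) (≐⁻ s₁)))
    ... | p , e with ∖⁻ e
    ... | e′ , p≢x′ with ∖⁻ e′
    ... | vp , p≢x = record { vx = vx ; vx′ = vx′ ; vp = vp ; x≢x′ = x≢x′ ; x≢p = p≢x ∘ sym ; x′≢p = p≢x′ ∘ sym
        ; fx = fx ; fx′ = fx′ ; hub≡p = hub-is (hub v ≟ p) ; bad = B }
      where
      sum-of : ∀ f → ∑⟨ adj G v ⟩ f ≡ f p + (f x + f x′)
      sum-of f = ∑⟨⟩-triple (adj G v) f (≐⁻ s₁) vp vx vx′ p≢x p≢x′ x≢x′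
      rest : ∀ {w} → adj G v w ≡ true → w ≢ p → w ≡ x ⊎ w ≡ x′
      rest {w} vw w≢p with w ≟ x | w ≟ x′
      ... | yes e | _ = inj₁ e
      ... | no _ | yes e = inj₂ e
      ... | no w≢x | no w≢x′ = ⊥-elim (<⇒≱ (count>0⁺ _ (∖⁺ (∖⁺ (∖⁺ vw w≢p) w≢x) w≢x′)) (≤-reflexive
        (cong (ℕ._∸ 3) (trans (cong (2 +_) (sym (count-remove ((adj G v ∖ p) ∖ x) x′ (∖⁺ (∖⁺ vx′ (p≢x′ ∘ sym)) (x≢x′ ∘ sym)))))
          (trans (cong suc (sym (count-remove (adj G v ∖ p) x (∖⁺ vx (p≢x ∘ sym))))) (trans (sym (count-remove (adj G v) p vp)) (≐⁻ s₁)))))))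
      contr≤1 : ∀ {y} → adj G v y ≡ true → free2 y ≡ true → contr v y ≤ 1
      contr≤1 vy fy = s≤s⁻¹ (≤-trans (contr-free vy (proj₁ (free2⁻ fy))) (≤-reflexive (proj₂ (free2⁻ fy))))
      B : Bad v ≡ true
      B = Bad⁺ (star⇒U s) vp small (λ vw ne Uw → ⊥-elim (core-other (rest vw ne) Uw))
        where
        small : ∑⟨ adj G v ∖ p ⟩ (contr v) ≤ 2
        small = ≤-trans (≤-reflexive (+-cancelˡ-≡ (contr v p) _ _ (trans (sym (∑⟨⟩-remove (adj G v) (contr v) p vp)) (sum-of (contr v)))))
          (+-mono-≤ (contr≤1 vx fx) (contr≤1 vx′ fx′))
        core-other : ∀ {w} → w ≡ x ⊎ w ≡ x′ → U w ≡ true → ⊥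
        core-other (inj₁ refl) Uw = true≢false Uw (proj₁ (free2⁻ fx))
        core-other (inj₂ refl) Uw = true≢false Uw (proj₁ (free2⁻ fx′))
      hub-is : Dec (hub v ≡ p) → hub v ≡ p
      hub-is (yes e) = e
      hub-is (no ne) = ⊥-elim (<⇒≱ (≤-trans (m≤m+n 3 14) 17≤k) (≤-trans (≤-reflexive (sym (hub-deg B))) (deg2 (rest (hub-adj B) ne))))
        where
        deg2 : hub v ≡ x ⊎ hub v ≡ x′ → deg (hub v) ≤ 2
        deg2 (inj₁ e) = ≤-reflexive (trans (cong deg e) (proj₂ (free2⁻ fx)))
        deg2 (inj₂ e) = ≤-reflexive (trans (cong deg e) (proj₂ (free2⁻ fx′)))

  opaque
    star-partner : ∀ {v} (S : Star v) {y} → adj G v y ≡ true → y ≢ Star.p S → linked v y ≡ true →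
      ∃ λ b → Bad b ≡ true × adj G y b ≡ true × b ≢ v × Q v b ≡ true
    star-partner {v} S {y} vy y≢p e with some⁻ e
    ... | b , e′ with &⁻ e′
    ... | yb , e″ with &⁻ e″
    ... | sb , b≢v = b , Bb , yb , ≢⁻ (!⁻ b≢v) , via-Q (Star.bad S) Bb (≢⁻ (!⁻ b≢v) ∘ sym) vy (λ h → y≢p (trans h (Star.hub≡p S))) (inj₂ yb)
      where
      Bb : Bad b ≡ true
      Bb = Star.bad (star-shape sb)

  opaque
    -- The partners across `x` and `x′` are different: a bad vertex seen through both would be
    -- counted twice, and `v` has no count to spare.
    star-links : ∀ {v} (S : Star v) → ind (linked v (Star.x S)) + ind (linked v (Star.x′ S)) ≤ share v
    star-links {v} S = ≤-trans (by (bool? (linked v x)) (bool? (linked v x′))) (≤-reflexive (sym (share-Bad bad)))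
      where
      open Star S
      single : ∀ {y} → (∃ λ b → Bad b ≡ true × adj G y b ≡ true × b ≢ v × Q v b ≡ true) → 1 ≤ r Bad v
      single (b , Bb , _ , _ , q) = ≤-trans (m≥1 q) (≤∑⟨⟩ Bad (m v) Bb)
      double : (∃ λ b → Bad b ≡ true × adj G x b ≡ true × b ≢ v × Q v b ≡ true) →
        (∃ λ b → Bad b ≡ true × adj G x′ b ≡ true × b ≢ v × Q v b ≡ true) → 2 ≤ r Bad v
      double (b , Bb , xb , b≢v , q) (b′ , Bb′ , x′b′ , _ , q′) = distinct (b ≟ b′)
        where
        distinct : Dec (b ≡ b′) → 2 ≤ r Bad v
        distinct (no ne) = ≤-trans (+-mono-≤ (m≥1 q) (m≥1 q′)) (≤∑⟨⟩₂ Bad (m v) Bb Bb′ ne)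
        distinct (yes refl) = ⊥-elim (<⇒≱ (≤-trans (cover-twice v (adj G v) (Nb U v) (Nb-hit v) {b} vx vx′ x≢x′
          (hit-adj (Bad⇒U Bb) xb b≢v) (hit-adj (Bad⇒U Bb) x′b′ b≢v)) (contr-sum≤ bad)) (U-core (Bad⇒U bad)))
      by : linked v x ≡ true ⊎ linked v x ≡ false → linked v x′ ≡ true ⊎ linked v x′ ≡ false →
        ind (linked v x) + ind (linked v x′) ≤ r Bad v
      by (inj₂ e) (inj₂ e′) = ≤-trans (≤-reflexive (cong₂ (λ a b → ind a + ind b) e e′)) z≤n
      by (inj₂ e) (inj₁ e′) = ≤-trans (≤-reflexive (cong₂ (λ a b → ind a + ind b) e e′)) (single (star-partner S vx′ x′≢p e′))
      by (inj₁ e) (inj₂ e′) = ≤-trans (≤-reflexive (cong₂ (λ a b → ind a + ind b) e e′)) (single (star-partner S vx x≢p e))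
      by (inj₁ e) (inj₁ e′) = ≤-trans (≤-reflexive (cong₂ (λ a b → ind a + ind b) e e′))
        (double (star-partner S vx x≢p e) (star-partner S vx′ x′≢p e′))

  core-sum : ∀ {v} → U v ≡ true → 19 ≤ ∑⟨ adj G v ⟩ (contr v)
  core-sum Uv = ≤-trans (+-monoˡ-≤ 2 17≤k) (contr-total Uv)

  ¬core2 : ∀ {v} → deg v ≢ 2 → core2 v ≡ false
  ¬core2 ne = &-falseʳ (≐-no ne)

  ¬free2 : ∀ {v} → deg v ≢ 2 → free2 v ≡ false
  ¬free2 ne = &-falseʳ (≐-no ne)

  ¬lone3 : ∀ {v} → deg v ≢ 3 → lone3 v ≡ false
  ¬lone3 ne = &-falseʳ (&-falseˡ (≐-no ne))

  opaque
    free-supply : ∀ {a v} → adj G a v ≡ true → free2 v ≡ true →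
      6 ≤ give a v ⊎ (star a ≡ true × give a v ≡ 4 + ind (linked a v))
    free-supply {a} {v} av fv with 8 ≤? deg a | bool? (star a)
    ... | yes big | _ = inj₁ (give≥6 big)
    ... | no small | inj₂ e = inj₁ (≤-reflexive (sym (Small.give-free (free-2-neighbour av (proj₁ (free2⁻ fv)) (proj₂ (free2⁻ fv))) (s≤s⁻¹ (≰⇒> small)) fv e)))
    ... | no small | inj₁ e = inj₂ (e , Small.give-star (free-2-neighbour av (proj₁ (free2⁻ fv)) (proj₂ (free2⁻ fv))) (s≤s⁻¹ (≰⇒> small)) fv e)

    -- One star gives at least 4 beside a 6; two stars are partners across `v` and give 5 each.
    free-income : ∀ {v a b} → free2 v ≡ true → adj G v a ≡ true → adj G v b ≡ true → a ≢ b → 10 ≤ give a v + give b v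
    free-income {v} {a} {b} fv va vb ab with free-supply (adj-swap va) fv | free-supply (adj-swap vb) fv
    ... | inj₁ x | inj₁ y = ≤-trans (m≤m+n 10 2) (+-mono-≤ x y)
    ... | inj₁ x | inj₂ (_ , y) = +-mono-≤ x (≤-trans (m≤m+n 4 _) (≤-reflexive (sym y)))
    ... | inj₂ (_ , x) | inj₁ y = +-mono-≤ (≤-trans (m≤m+n 4 _) (≤-reflexive (sym x))) y
    ... | inj₂ (sa , x) | inj₂ (sb , y) = ≤-reflexive (sym (cong₂ _+_
      (trans x (cong (λ c → 4 + ind c) (some⁺ b (&⁺ vb (&⁺ sb (!⁺ (≢⁺ (ab ∘ sym))))))))
      (trans y (cong (λ c → 4 + ind c) (some⁺ a (&⁺ va (&⁺ sa (!⁺ (≢⁺ ab)))))))))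

    -- The degree of the smaller neighbour decides: it bounds the degree of the other from below,
    -- and where the smaller one gives nothing, `v` is bad and the pot adds 2.
    core-income : ∀ {v a b} → U v ≡ true → deg v ≡ 2 → adj G v a ≡ true → adj G v b ≡ true → a ≢ b → 10 ≤ (give a v + give b v) + share v
    core-income {v} {a} {b} Uv two va vb ab = [ ordered va vb ab , (λ le → ≤-trans (ordered vb va (ab ∘ sym) le) (≤-reflexive (cong (_+ share v) (+-comm (give b v) (give a v))))) ]′ (≤-total (deg b) (deg a))
      where
      c2 : core2 v ≡ true
      c2 = &⁺ Uv (≐⁺ two)
      ordered : ∀ {a b} → adj G v a ≡ true → adj G v b ≡ true → a ≢ b → deg b ≤ deg a → 10 ≤ (give a v + give b v) + share v
      ordered {a} {b} va vb ab le = by (8 ≤? deg b) (5 ≤? deg b) (deg b ℕ.≟ 4) (deg b ℕ.≟ 3)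
        where
        total : 19 ≤ deg a + deg b
        total = ≤-trans (core-sum Uv) (≤-trans (≤-reflexive (∑⟨⟩-pair (adj G v) (contr v) two va vb ab))
          (+-mono-≤ (contr≤deg (adj-swap va)) (contr≤deg (adj-swap vb))))
        large : ∀ {x y} → x + y ≤ 19 → deg b ≤ y → x ≤ deg a
        large {x} {y} s l = +-cancelʳ-≤ y x (deg a) (≤-trans s (≤-trans total (+-monoʳ-≤ (deg a) l)))
        by : Dec (8 ≤ deg b) → Dec (5 ≤ deg b) → Dec (deg b ≡ 4) → Dec (deg b ≡ 3) → 10 ≤ (give a v + give b v) + share v
        by (yes b8) _ _ _ = ≤-trans (m≤m+n 10 2) (≤-trans (+-mono-≤ (give≥6 {a} (≤-trans b8 le)) (give≥6 {b} b8)) (m≤m+n _ _))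
        by (no b<8) (yes b5) _ _ = ≤-trans (+-mono-≤ {7} {give a v} {3} {give b v} (give≥7 {a} (≤-trans (m≤m+n 10 2) (large {12} {7} ≤-refl b≤7)))
          (≤-reflexive (sym (trans (Small.give-core2 (≤-trans (m≤m+n 3 2) b5) b≤7 c2) (gift2-5 b5))))) (m≤m+n _ _)
          where
          b≤7 : deg b ≤ 7
          b≤7 = s≤s⁻¹ (≰⇒> b<8)
        by _ (no _) (yes b4) _ = ≤-trans (+-mono-≤ {8} {give a v} {2} {give b v} (give≥8 {a} (large {15} {4} ≤-refl (≤-reflexive b4)))
          (≤-reflexive (sym (trans (Small.give-core2 (≤-trans (m≤m+n 3 1) (≤-reflexive (sym b4))) (≤-trans (≤-reflexive b4) (m≤m+n 4 3)) c2) (gift2-4 b4))))) (m≤m+n _ _)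
        by _ _ _ (yes b3) with bool? (U b) | pairs b ℕ.≟ 1
        ... | inj₁ Ub | _ = ≤-trans (+-mono-≤ {8} {give a v} {2} {give b v} (give≥8 {a} (≤-trans (m≤m+n 15 1) (large {16} {3} ≤-refl (≤-reflexive b3))))
          (≤-reflexive (sym (trans (Small.give-core2 (≤-reflexive (sym b3)) (≤-trans (≤-reflexive b3) (m≤m+n 3 4)) c2) (gift2-core b3 Ub))))) (m≤m+n _ _)
        ... | inj₂ Fb | yes p = ≤-trans (+-mono-≤ {8} {give a v} {2} {give b v} (give≥8 {a} (≤-trans (m≤m+n 15 1) (large {16} {3} ≤-refl (≤-reflexive b3))))
          (≤-reflexive (sym (trans (Small.give-core2 (≤-reflexive (sym b3)) (≤-trans (≤-reflexive b3) (m≤m+n 3 4)) c2) (gift2-lone b3 Fb p))))) (m≤m+n _ _)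
        ... | inj₂ Fb | no p = +-mono-≤ {8} {give a v + give b v} {2} {share v} (≤-trans (give≥8 {a} (≤-trans (m≤m+n 15 1) (large {16} {3} ≤-refl (≤-reflexive b3)))) (m≤m+n _ _))
          (poor-3 Uv two va vb ab b3 Fb p)
        by _ (no b<5) (no b≢4) (no b≢3) = +-mono-≤ {8} {give a v + give b v} {2} {share v}
          (≤-trans (give≥8 {a} (≤-trans (m≤m+n 15 2) (large {17} {2} ≤-refl b≤2))) (m≤m+n _ _))
          (poor-2 Uv two va vb ab (≤-antisym b≤2 (deg≥2 (adj-swap vb))))
          where
          b≤2 : deg b ≤ 2
          b≤2 = s≤s⁻¹ (≤∧≢⇒< (s≤s⁻¹ (≤∧≢⇒< (s≤s⁻¹ (≰⇒> b<5)) b≢4)) b≢3)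

    balanced-2 : ∀ {v} → deg v ≡ 2 → Balanced v
    balanced-2 {v} two with count>1⁻ (adj G v) (≤-reflexive (sym two))
    ... | a , b , va , vb , ab = balance-by {v} (≤-trans (s≤s (≤-reflexive two)) (m≤m+n 3 14)) {10}
      (≤-reflexive (trans (cong (30 +_) (∑⟨⟩-zero (adj G v) (give v) (λ w _ → give-2 {v} {w} (≤-reflexive two)))) (cong (λ d → 10 * d + 10) (sym two))))
      (income (bool? (U v)))
      where
      sum≡ : received v ≡ give a v + give b v
      sum≡ = ∑⟨⟩-pair (adj G v) (λ w → give w v) two va vb ab
      income : U v ≡ true ⊎ U v ≡ false → 10 ≤ received v + share v
      income (inj₁ Uv) = ≤-trans (core-income Uv two va vb ab) (≤-reflexive (cong (_+ share v) (sym sum≡)))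
      income (inj₂ Fv) = ≤-trans (free-income (free2⁺ Fv two) va vb ab) (≤-trans (≤-reflexive (sym sum≡)) (m≤m+n _ (share v)))

  module Free {v : Fin n} (Fv : U v ≡ false) (≥3 : 3 ≤ deg v) (≤7 : deg v ≤ 7) where

    open Small ≥3 ≤7

    opaque
      -- The neighbours of a free vertex are core vertices, so nothing goes to a free 2-vertex or to
      -- a `lone3` vertex.
      free-gives : ∀ {w} → adj G v w ≡ true → give v w ≤ gift2 v * ind (deg w ≐ 2)
      free-gives {w} vw with bool? (deg w ≐ 2)
      ... | inj₁ e = ≤-trans (≤-reflexive (give-core2 (&⁺ (independent vw Fv) e)))
        (≤-reflexive (sym (trans (cong (λ b → gift2 v * ind b) e) (*-identityʳ (gift2 v)))))
      ... | inj₂ e = ≤-trans (≤-reflexive (trans (give-rest (&-falseʳ e) (&-falseʳ e))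
        (cong ind (&-falseˡ (!-true (independent vw Fv)))))) z≤n

      free-sent : sent v ≤ gift2 v * pairs v
      free-sent = ≤-trans (∑⟨⟩-mono (adj G v) (give v) (λ w → gift2 v * ind (deg w ≐ 2)) (λ w → free-gives))
        (≤-reflexive (trans (∑⟨⟩-* (adj G v) (gift2 v) (λ w → ind (deg w ≐ 2))) (cong (gift2 v *_) (∑⟨⟩-ind (adj G v) (λ w → deg w ≐ 2)))))

  opaque
    lone-income : ∀ {v} → U v ≡ false → deg v ≡ 3 → pairs v ≡ 1 → 2 ≤ received v
    lone-income {v} Fv three p with count>0⁻ (λ y → adj G v y & deg y ≐ 2) (≤-reflexive (sym p))
    ... | x , e = ≤-trans (≤-trans (≤-reflexive (cong (ℕ._∸ 1) (trans (sym three) (count-remove (adj G v) x (proj₁ (&⁻ e))))))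
        (count≤∑⟨⟩ (adj G v ∖ x) (λ w → give w v) supply)) (∑⟨⟩-⊆ (adj G v) (adj G v ∖ x) (λ w → give w v) (λ w → proj₁ ∘ ∖⁻))
      where
      lone : lone3 v ≡ true
      lone = &⁺ (!⁺ Fv) (&⁺ (≐⁺ three) (≐⁺ p))
      not2 : deg v ≢ 2
      not2 two = m+1+n≢m 2 (trans (sym three) two)
      supply : ∀ w → (adj G v ∖ x) w ≡ true → 1 ≤ give w v
      supply w f with ∖⁻ f | 8 ≤? deg w
      ... | vw , w≢x | yes big = ≤-trans (s≤s z≤n) (give≥6 {w} big)
      ... | vw , w≢x | no small = ≤-reflexive (sym (trans (Small.give-rest (≤∧≢⇒< (deg≥2 (adj-swap vw)) w≢2)
          (s≤s⁻¹ (≰⇒> small)) (¬free2 not2) (¬core2 not2)) (cong ind lone)))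
        where
        w≢2 : 2 ≢ deg w
        w≢2 e′ = w≢x (count≡1⁻ (λ y → adj G v y & deg y ≐ 2) (≤-reflexive p) (&⁺ vw (≐⁺ (sym e′))) e)

    balanced-free3 : ∀ {v} → U v ≡ false → deg v ≡ 3 → Balanced v
    balanced-free3 {v} Fv three = by (pairs v ℕ.≟ 1)
      where
      open Free Fv (≤-reflexive (sym three)) (≤-trans (≤-reflexive three) (m≤m+n 3 4))
      lt : deg v < 17
      lt = ≤-trans (s≤s (≤-reflexive three)) (m≤m+n 4 13)
      by : Dec (pairs v ≡ 1) → Balanced v
      by (yes p) = balance-by {v} lt {2} (≤-trans (+-monoʳ-≤ 30 (≤-trans free-sent (≤-reflexive (cong₂ _*_ (gift2-lone three Fv p) p))))
        (≤-reflexive (cong (λ d → 10 * d + 2) (sym three)))) (≤-trans (lone-income Fv three p) (m≤m+n _ _))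
      by (no p) = balance-by {v} lt {0} (≤-trans (+-monoʳ-≤ 30 (≤-trans free-sent (≤-reflexive (cong (_* pairs v) (gift2-none three Fv p)))))
        (≤-reflexive (cong (λ d → 10 * d + 0) (sym three)))) z≤n

    balanced-free : ∀ {v} → U v ≡ false → 4 ≤ deg v → deg v ≤ 7 → Balanced v
    balanced-free {v} Fv ≥4 ≤7 = balance-by {v} (≤-trans (s≤s ≤7) (m≤m+n 8 9)) {0} (≤-trans (by (deg v ℕ.≟ 4)) (≤-reflexive (sym (+-identityʳ (10 * deg v))))) z≤n
      where
      open Free Fv (≤-trans (m≤m+n 3 1) ≥4) ≤7
      sent≤ : sent v ≤ gift2 v * deg v
      sent≤ = ≤-trans free-sent (*-monoʳ-≤ (gift2 v) (count-mono (λ _ → proj₁ ∘ &⁻)))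
      by : Dec (deg v ≡ 4) → 30 + sent v ≤ 10 * deg v
      by (yes four) = ≤-trans (+-monoʳ-≤ 30 (≤-trans sent≤ (≤-reflexive (cong₂ _*_ (gift2-4 four) four))))
        (≤-trans (m≤m+n 38 2) (≤-reflexive (cong (10 *_) (sym four))))
      by (no ne) = ≤-trans (+-monoʳ-≤ 30 (≤-trans sent≤ (*-monoˡ-≤ (deg v) (gift2≤3 v))))
        (≤-trans (+-monoˡ-≤ (3 * deg v) (≤-trans (m≤m+n 30 5) (*-monoʳ-≤ 7 (≤∧≢⇒< ≥4 (ne ∘ sym)))))
          (≤-reflexive (solve 1 (λ d → con 7 :* d :+ con 3 :* d := con 10 :* d) refl (deg v))))

    star-gives : ∀ {v} (s : star v ≡ true) (S : Star v) →
      give v (Star.p S) + (give v (Star.x S) + give v (Star.x′ S)) ≡ 8 + (ind (linked v (Star.x S)) + ind (linked v (Star.x′ S)))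
    star-gives {v} s S = trans (cong₂ _+_ none (cong₂ _+_ (give-star fx s) (give-star fx′ s)))
      (solve 2 (λ a b → (con 4 :+ a) :+ (con 4 :+ b) := con 8 :+ (a :+ b)) refl (ind (linked v x)) (ind (linked v x′)))
      where
      open Star S
      three : deg v ≡ 3
      three = ≐⁻ (proj₁ (&⁻ s))
      open Small {v} (≤-reflexive (sym three)) (≤-trans (≤-reflexive three) (m≤m+n 3 4))
      p≥17 : 17 ≤ deg p
      p≥17 = ≤-trans 17≤k (≤-reflexive (trans (sym (hub-deg bad)) (cong deg hub≡p)))
      p≢ : ∀ {d} → d < 17 → deg p ≢ d
      p≢ lt e = <⇒≱ lt (≤-trans p≥17 (≤-reflexive e))
      none : give v p ≡ 0
      none = trans (give-rest (¬free2 (p≢ (m≤m+n 3 14))) (¬core2 (p≢ (m≤m+n 3 14)))) (cong ind (¬lone3 (p≢ (m≤m+n 4 13))))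

    balanced-star : ∀ {v} → star v ≡ true → Star v → Balanced v
    balanced-star {v} s S = balance-by {v} (≤-trans (s≤s (≤-reflexive three)) (m≤m+n 4 13)) {8 + (ind (linked v x) + ind (linked v x′))}
      (≤-reflexive (cong₂ _+_ (cong (10 *_) (sym three)) (trans sum≡ (star-gives s S))))
      (+-mono-≤ (≤-trans (give≥8 {p} (≤-trans (≤-trans (m≤m+n 15 2) 17≤k) (≤-reflexive (trans (sym (hub-deg bad)) (cong deg hub≡p)))))
        (≤∑⟨⟩ (adj G v) (λ w → give w v) vp)) (star-links S))
      where
      open Star S
      three : deg v ≡ 3
      three = ≐⁻ (proj₁ (&⁻ s))
      sum≡ : sent v ≡ give v p + (give v x + give v x′)
      sum≡ = ∑⟨⟩-triple (adj G v) (give v) three vp vx vx′ (x≢p ∘ sym) (x′≢p ∘ sym) x≢x′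

    -- Contributions are capped at 19, the total required, because those of the largest neighbours
    -- have no bound but `k`.
    kind : ∀ {v} → 3 ≤ deg v → deg v ≤ 7 → star v ≡ false → ∀ {g} → gift2 v ≤ g → 1 ≤ g → ∀ {w} → adj G v w ≡ true →
      ∃ λ i → give v w ≤ gives g i × receives i ≤ give w v × contr v w ⊓ 19 ≤ capacity i × ind (free2 w) ≡ isFree i
    kind {v} ≥3 ≤7 s {g} gift≤ g≥1 {w} vw = by (bool? (free2 w)) (bool? (core2 w)) (bool? (lone3 w)) (8 ≤? deg w) (10 ≤? deg w) (15 ≤? deg w)
      where
      open Small {v} ≥3 ≤7
      by : free2 w ≡ true ⊎ free2 w ≡ false → core2 w ≡ true ⊎ core2 w ≡ false → lone3 w ≡ true ⊎ lone3 w ≡ false →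
        Dec (8 ≤ deg w) → Dec (10 ≤ deg w) → Dec (15 ≤ deg w) →
        ∃ λ i → give v w ≤ gives g i × receives i ≤ give w v × contr v w ⊓ 19 ≤ capacity i × ind (free2 w) ≡ isFree i
      by (inj₁ f) _ _ _ _ _ = 0F , ≤-reflexive (give-free f s) , z≤n
        , ≤-trans (m⊓n≤m (contr v w) 19) (s≤s⁻¹ (≤-trans (contr-free vw (proj₁ (free2⁻ f))) (≤-reflexive (proj₂ (free2⁻ f))))) , cong ind f
      by (inj₂ f) (inj₁ c) _ _ _ _ = 1F , ≤-trans (≤-reflexive (give-core2 c)) gift≤ , z≤n
        , ≤-trans (m⊓n≤m (contr v w) 19) (≤-trans (contr≤deg (adj-swap vw)) (≤-reflexive (≐⁻ (proj₂ (&⁻ c))))) , cong ind f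
      by (inj₂ f) (inj₂ c) (inj₁ l) _ _ _ = 1F , ≤-trans (≤-reflexive (trans (give-rest f c) (cong ind l))) g≥1 , z≤n
        , ≤-trans (m⊓n≤m (contr v w) 19) (s≤s⁻¹ (≤-trans (contr-free vw (!⁻ (proj₁ (&⁻ l)))) (≤-reflexive (≐⁻ (proj₁ (&⁻ (proj₂ (&⁻ l)))))))) , cong ind f
      by (inj₂ f) (inj₂ c) (inj₂ l) (no small) _ _ = 2F , ≤-reflexive (trans (give-rest f c) (cong ind l)) , z≤n
        , ≤-trans (m⊓n≤m (contr v w) 19) (≤-trans (contr≤deg (adj-swap vw)) (s≤s⁻¹ (≰⇒> small))) , cong ind f
      by (inj₂ f) (inj₂ c) (inj₂ l) (yes big) (no small) _ = 3F , ≤-reflexive (trans (give-rest f c) (cong ind l)) , give≥6 {w} big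
        , ≤-trans (m⊓n≤m (contr v w) 19) (≤-trans (contr≤deg (adj-swap vw)) (s≤s⁻¹ (≰⇒> small))) , cong ind f
      by (inj₂ f) (inj₂ c) (inj₂ l) (yes _) (yes big) (no small) = 4F , ≤-reflexive (trans (give-rest f c) (cong ind l)) , give≥7 {w} big
        , ≤-trans (m⊓n≤m (contr v w) 19) (≤-trans (contr≤deg (adj-swap vw)) (s≤s⁻¹ (≰⇒> small))) , cong ind f
      by (inj₂ f) (inj₂ c) (inj₂ l) (yes _) (yes _) (yes big) = 5F , ≤-reflexive (trans (give-rest f c) (cong ind l)) , give≥8 {w} big
        , m⊓n≤n (contr v w) 19 , cong ind f

    cap-3 : ∀ a b c → 19 ≤ a + (b + c) → 19 ≤ a ⊓ 19 + (b ⊓ 19 + c ⊓ 19)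
    cap-3 a b c le with ≤-total 19 a | ≤-total 19 b | ≤-total 19 c
    ... | inj₁ x | _ | _ = ≤-trans (≤-reflexive (sym (m≥n⇒m⊓n≡n x))) (m≤m+n (a ⊓ 19) _)
    ... | _ | inj₁ x | _ = ≤-trans (≤-reflexive (sym (m≥n⇒m⊓n≡n x))) (≤-trans (m≤m+n (b ⊓ 19) _) (m≤n+m _ (a ⊓ 19)))
    ... | _ | _ | inj₁ x = ≤-trans (≤-reflexive (sym (m≥n⇒m⊓n≡n x))) (≤-trans (m≤n+m (c ⊓ 19) (b ⊓ 19)) (m≤n+m _ (a ⊓ 19)))
    ... | inj₂ x | inj₂ y | inj₂ z = ≤-trans le (≤-reflexive (sym (cong₂ _+_ (m≤n⇒m⊓n≡m x) (cong₂ _+_ (m≤n⇒m⊓n≡m y) (m≤n⇒m⊓n≡m z)))))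

    balanced-core3 : ∀ {v} → U v ≡ true → deg v ≡ 3 → star v ≡ false → Balanced v
    balanced-core3 {v} Uv three s with count>2⁻ (adj G v) (≤-reflexive (sym three))
    ... | a , b , c , va , vb , vc , ab , ac , bc
      with kind (≤-reflexive (sym three)) (≤-trans (≤-reflexive three) (m≤m+n 3 4)) s {2} (gift2-≤4 (≤-trans (≤-reflexive three) (m≤m+n 3 1))) (s≤s z≤n) va
         | kind (≤-reflexive (sym three)) (≤-trans (≤-reflexive three) (m≤m+n 3 4)) s {2} (gift2-≤4 (≤-trans (≤-reflexive three) (m≤m+n 3 1))) (s≤s z≤n) vb
         | kind (≤-reflexive (sym three)) (≤-trans (≤-reflexive three) (m≤m+n 3 4)) s {2} (gift2-≤4 (≤-trans (≤-reflexive three) (m≤m+n 3 1))) (s≤s z≤n) vc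
    ... | i , o₁ , h₁ , c₁ , f₁ | j , o₂ , h₂ , c₂ , f₂ | l , o₃ , h₃ , c₃ , f₃ =
      balance-by {v} (≤-trans (s≤s (≤-reflexive three)) (m≤m+n 4 13)) {received v}
        (+-mono-≤ (≤-reflexive (cong (10 *_) (sym three))) flow) (m≤m+n _ _)
      where
      sum-of : ∀ f → ∑⟨ adj G v ⟩ f ≡ f a + (f b + f c)
      sum-of f = ∑⟨⟩-triple (adj G v) f three va vb vc ab ac bc
      not-star : isFree i + (isFree j + isFree l) ≢ 2
      not-star e = true≢false (&⁺ (≐⁺ three) (≐⁺ (trans (sym (∑⟨⟩-ind (adj G v) free2))
        (trans (sum-of (λ w → ind (free2 w))) (trans (cong₂ _+_ f₁ (cong₂ _+_ f₂ f₃)) e))))) s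
      flow : sent v ≤ received v
      flow = ≤-trans (≤-reflexive (sum-of (give v))) (≤-trans (+-mono-≤ o₁ (+-mono-≤ o₂ o₃)) (≤-trans
        (kinds-3 i j l not-star (≤-trans (cap-3 (contr v a) (contr v b) (contr v c) (≤-trans (core-sum Uv) (≤-reflexive (sum-of (contr v)))))
          (+-mono-≤ c₁ (+-mono-≤ c₂ c₃))))
        (≤-trans (+-mono-≤ h₁ (+-mono-≤ h₂ h₃)) (≤-reflexive (sym (sum-of (λ w → give w v)))))))

    -- A linear bound per neighbour, so that the degrees 4 to 7 are settled by one summation rather
    -- than by enumeration.
    line : ∀ {v} → 4 ≤ deg v → deg v ≤ 7 → ∀ {w} → adj G v w ≡ true →
      15 * give v w + 14 * (contr v w ⊓ 16) ≤ 15 * give w v + 104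
    line {v} ≥4 ≤7 {w} vw with kind (≤-trans (m≤m+n 3 1) ≥4) ≤7 (&-falseˡ (≐-no (λ e → <⇒≱ (≤-reflexive (cong suc e)) ≥4))) {3} (gift2≤3 v) (s≤s z≤n) vw
    ... | i , o , h , c , _ = ≤-trans (+-mono-≤ (*-monoʳ-≤ 15 o) (*-monoʳ-≤ 14 cap))
        (≤-trans (kinds-line i) (+-monoˡ-≤ 104 (*-monoʳ-≤ 15 h)))
      where
      cap : contr v w ⊓ 16 ≤ capacity i ⊓ 16
      cap = ⊓-glb (≤-trans (⊓-monoʳ-≤ (contr v w) (m≤m+n 16 3)) c) (m⊓n≤n (contr v w) 16)

    balanced-core : ∀ {v} → U v ≡ true → 4 ≤ deg v → deg v ≤ 7 → Balanced v
    balanced-core {v} Uv ≥4 ≤7 = balance-by {v} (≤-trans (s≤s ≤7) (m≤m+n 8 9)) {received v}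
        (*-cancelˡ-≤ 15 (+-cancelʳ-≤ 266 _ _ scaled)) (m≤m+n _ _)
      where
      open ≤-Reasoning
      C : ℕ
      C = ∑⟨ adj G v ⟩ (λ w → contr v w ⊓ 16)
      C≥19 : 19 ≤ C
      C≥19 = ∑⟨⟩-cap (adj G v) (contr v) ≥4 (λ w → contr≥1) (core-sum Uv)
      summed : 15 * sent v + 14 * C ≤ 15 * received v + 104 * deg v
      summed = subst₂ _≤_ (trans (∑⟨⟩-+ (adj G v) (λ w → 15 * give v w) (λ w → 14 * (contr v w ⊓ 16)))
          (cong₂ _+_ (∑⟨⟩-* (adj G v) 15 (give v)) (∑⟨⟩-* (adj G v) 14 (λ w → contr v w ⊓ 16))))
        (trans (∑⟨⟩-+ (adj G v) (λ w → 15 * give w v) (λ _ → 104)) (cong₂ _+_ (∑⟨⟩-* (adj G v) 15 (λ w → give w v)) (∑⟨⟩-const (adj G v) 104)))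
        (∑⟨⟩-mono (adj G v) (λ w → 15 * give v w + 14 * (contr v w ⊓ 16)) (λ w → 15 * give w v + 104) (λ w → line ≥4 ≤7))
      -- Here `266 = 14 * 19`, `46 = 150 - 104` and `450 = 46 * 4 + 266`; the last identity is where
      -- degree at least 4 is used.
      scaled : 15 * (30 + sent v) + 266 ≤ 15 * (10 * deg v + received v) + 266
      scaled = begin
        15 * (30 + sent v) + 266             ≡⟨ solve 1 (λ s → con 15 :* (con 30 :+ s) :+ con 266 := con 450 :+ (con 15 :* s :+ con 14 :* con 19)) refl (sent v) ⟩
        450 + (15 * sent v + 14 * 19)        ≤⟨ +-monoʳ-≤ 450 (≤-trans (+-monoʳ-≤ (15 * sent v) (*-monoʳ-≤ 14 C≥19)) summed) ⟩
        450 + (15 * received v + 104 * deg v) ≡⟨ solve 2 (λ h d → con 450 :+ (con 15 :* h :+ con 104 :* d) := (con 46 :* con 4 :+ (con 15 :* h :+ con 104 :* d)) :+ con 266) refl (received v) (deg v) ⟩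
        (46 * 4 + (15 * received v + 104 * deg v)) + 266 ≤⟨ +-monoˡ-≤ 266 (+-monoˡ-≤ (15 * received v + 104 * deg v) (*-monoʳ-≤ 46 ≥4)) ⟩
        (46 * deg v + (15 * received v + 104 * deg v)) + 266 ≡⟨ cong (_+ 266) (solve 2 (λ h d → con 46 :* d :+ (con 15 :* h :+ con 104 :* d) := con 15 :* (con 10 :* d :+ h)) refl (received v) (deg v)) ⟩
        15 * (10 * deg v + received v) + 266 ∎

    balanced : ∀ v → Balanced v
    balanced v = by (8 ≤? deg v) (4 ≤? deg v) (deg v ℕ.≟ 3) (deg v ℕ.≟ 2) (bool? (U v)) (bool? (star v))
      where
      by : Dec (8 ≤ deg v) → Dec (4 ≤ deg v) → Dec (deg v ≡ 3) → Dec (deg v ≡ 2) → U v ≡ true ⊎ U v ≡ false →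
        star v ≡ true ⊎ star v ≡ false → Balanced v
      by (yes big) _ _ _ _ _ = balanced-big {v} big
      by (no b) (yes ≥4) _ _ (inj₁ Uv) _ = balanced-core Uv ≥4 (s≤s⁻¹ (≰⇒> b))
      by (no b) (yes ≥4) _ _ (inj₂ Fv) _ = balanced-free Fv ≥4 (s≤s⁻¹ (≰⇒> b))
      by _ _ (yes three) _ _ (inj₁ s) = balanced-star s (star-shape s)
      by _ _ (yes three) _ (inj₁ Uv) (inj₂ s) = balanced-core3 Uv three s
      by _ _ (yes three) _ (inj₂ Fv) (inj₂ s) = balanced-free3 Fv three
      by _ _ _ (yes two) _ _ = balanced-2 two
      by _ (no ≱4) (no ≢3) (no ≢2) _ _ = balanced-0 {v} (none (search (adj G v)))
        where
        none : (∃ λ w → adj G v w ≡ true) ⊎ (∀ w → adj G v w ≡ false) → deg v ≡ 0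
        none (inj₂ h) = count≡0 h
        none (inj₁ (w , a)) = ⊥-elim (<⇒≱ (≤∧≢⇒< (s≤s⁻¹ (≤∧≢⇒< (s≤s⁻¹ (≰⇒> ≱4)) ≢3)) ≢2) (deg≥2 a))

    -- In the sum over all vertices the gifts cancel, and `pot` bounds the shares by the deposits of
    -- the `k`-vertices.
    dense : 3 * count (λ v → 1 ≼ deg v) ≤ ∑ deg
    dense = *-cancelˡ-≤ 10 (+-cancelʳ-≤ (∑ sent + 4 * hubs) _ _ (begin
      10 * (3 * active) + (∑ sent + 4 * hubs)        ≡⟨ cong (_+ (∑ sent + 4 * hubs)) (sym (*-assoc 10 3 active)) ⟩
      30 * active + (∑ sent + 4 * hubs)              ≡⟨ sym left ⟩
      ∑ (λ v → 30 * ind (1 ≼ deg v) + (sent v + 4 * ind (deg v ≐ k))) ≤⟨ ∑-mono _ _ balanced ⟩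
      ∑ (λ v → 10 * deg v + (received v + share v))   ≡⟨ right ⟩
      10 * ∑ deg + (∑ received + ∑ share)             ≤⟨ +-monoʳ-≤ (10 * ∑ deg) (+-mono-≤ (≤-reflexive exchange) (≤-trans (≤-reflexive (sym (∑⟨⟩-def Bad (r Bad)))) pot)) ⟩
      10 * ∑ deg + (∑ sent + 4 * hubs)                ∎))
      where
      open ≤-Reasoning
      active hubs : ℕ
      active = count (λ v → 1 ≼ deg v)
      hubs = count (λ v → deg v ≐ k)
      left : ∑ (λ v → 30 * ind (1 ≼ deg v) + (sent v + 4 * ind (deg v ≐ k))) ≡ 30 * active + (∑ sent + 4 * hubs)
      left = trans (∑-+ (λ v → 30 * ind (1 ≼ deg v)) (λ v → sent v + 4 * ind (deg v ≐ k))) (cong₂ _+_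
        (trans (∑-*ˡ 30 (λ v → ind (1 ≼ deg v))) (cong (30 *_) (sym (count-def (λ v → 1 ≼ deg v)))))
        (trans (∑-+ sent (λ v → 4 * ind (deg v ≐ k))) (cong (∑ sent +_) (trans (∑-*ˡ 4 (λ v → ind (deg v ≐ k))) (cong (4 *_) (sym (count-def (λ v → deg v ≐ k))))))))
      right : ∑ (λ v → 10 * deg v + (received v + share v)) ≡ 10 * ∑ deg + (∑ received + ∑ share)
      right = trans (∑-+ (λ v → 10 * deg v) (λ v → received v + share v)) (cong₂ _+_ (∑-*ˡ 10 deg) (∑-+ received share))
      exchange : ∑ received ≡ ∑ sent
      exchange = trans (∑-cong (λ v → ∑⟨⟩-def (adj G v) (λ w → give w v))) (trans (∑-swap (λ v w → guard (adj G v w) (give w v)))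
        (∑-cong (λ w → trans (∑-cong (λ v → cong (λ b → guard b (give w v)) (adj-sym G v w))) (sym (∑⟨⟩-def (adj G w) (give w))))))

-- Maximum average degree and the induction on edges

T⁺ : {b : Bool} → b ≡ true → T b
T⁺ = T-≡ .Equivalence.from

T⁻ : {b : Bool} → T b → b ≡ true
T⁻ = T-≡ .Equivalence.to

countB≡count : (p : Fin n → Bool) → countB p ≡ count p
countB≡count p = trans (sum-allFin (λ u → ind (p u))) (sym (count-def p))

mad-deleteEdge : (G : Graph n) (p q : Fin n) → madLessThan3 G → madLessThan3 (deleteEdge G p q)
mad-deleteEdge G p q mad K = mad record
  { vert = vert K ; edge = edge K ; edge-sym = edge-sym K
  ; edge-adj = λ u v e → T⁺ (Deletion.delete⁻ G p q (T⁻ (edge-adj K u v e)))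
  ; edge-vl = edge-vl K ; edge-vr = edge-vr K }

-- The hypothesis is applied to the subgraph without the isolated vertices, which keeps all edges.
mad-sparse : (G : Graph n) → madLessThan3 G → 0 < count (λ v → 1 ≼ count (adj G v)) →
  ∑ (λ v → count (adj G v)) < 3 * count (λ v → 1 ≼ count (adj G v))
mad-sparse {n} G mad pos = ≤-trans (≤-reflexive (cong suc (sym degrees)))
  (≤-trans (mad active (≤-trans pos (≤-reflexive (sym (countB≡count (vert active))))))
    (≤-reflexive (cong (3 *_) (countB≡count (vert active)))))
  where
  active : Subgraph G
  active = record
    { vert = λ v → 1 ≼ count (adj G v) ; edge = adj G ; edge-sym = adj-sym G ; edge-adj = λ _ _ → id
    ; edge-vl = λ u v e → T⁺ (≼⁺ (count>0⁺ (adj G u) (T⁻ e)))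
    ; edge-vr = λ u v e → T⁺ (≼⁺ (count>0⁺ (adj G v) (trans (adj-sym G v u) (T⁻ e)))) }
  degrees : twiceNumEdges active ≡ ∑ (λ v → count (adj G v))
  degrees = trans (sum-allFin (λ u → countB (adj G u))) (∑-cong (λ u → countB≡count (adj G u)))

degree≤maxDegree : (G : Graph n) (v : Fin n) → degree G v ≤ maxDegree G
degree≤maxDegree {n} G v = below (∈-allFin v)
  where
  below : {vs : List (Fin n)} → v ∈ vs → degree G v ≤ foldr (λ w m → degree G w ⊔ m) 0 vs
  below (here refl) = m≤m⊔n (degree G v) _
  below {w ∷ _} (there i) = ≤-trans (below i) (m≤n⊔m (degree G w) _)

module _ (k : ℕ) (17≤k : 17 ≤ k) (L : Fin n → List ℕ) (L-unique : ∀ v → Unique (L v))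
  (L-length : ∀ v → length (L v) ≡ k + 2) where

  colourable : ∀ fuel (G : Graph n) → ∑ (λ v → count (adj G v)) ≤ fuel → (∀ v → count (adj G v) ≤ k) →
    madLessThan3 G → Colouring.Lists.Colourable G k L L-unique L-length
  colourable fuel G le deg≤k mad with Colouring.Lists.colourable? G k L L-unique L-length
  ... | yes c = c
  ... | no critical = ⊥-elim (contradictory (search (λ v → 1 ≼ count (adj G v))))
    where
    open Colouring G

    fewer : ∀ {p q} → adj G p q ≡ true →
      ∑ (λ v → count (adj (deleteEdge G p q) v)) < ∑ (λ v → count (adj G v))
    fewer {p} {q} a = ∑-mono-< _ _ (λ v → count-mono (λ w → Deletion.delete⁻ G p q)) p
      (count-mono-< (λ w → Deletion.delete⁻ G p q) q (Deletion.deleted G p q) a)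

    reduced : ∀ fuel → ∑ (λ v → count (adj G v)) ≤ fuel → ∀ {p q} → adj G p q ≡ true →
      Colouring.Lists.Colourable (deleteEdge G p q) k L L-unique L-length
    reduced zero le a = ⊥-elim (n≮0 (≤-trans (fewer a) le))
    reduced (suc fuel) le {p} {q} a = colourable fuel (deleteEdge G p q) (s≤s⁻¹ (≤-trans (fewer a) le))
      (λ v → ≤-trans (count-mono (λ w → Deletion.delete⁻ G p q)) (deg≤k v)) (mad-deleteEdge G p q mad)

    contradictory : (∃ λ v → 1 ≼ count (adj G v) ≡ true) ⊎ (∀ v → 1 ≼ count (adj G v) ≡ false) → ⊥
    contradictory (inj₁ (v , e)) = <⇒≱ (mad-sparse G mad (count>0⁺ (λ v → 1 ≼ count (adj G v)) e))
      (Discharging.dense G k 17≤k L L-unique L-length deg≤k critical (reduced fuel le))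
    -- Without edges that subgraph is empty and says nothing; but then every choice from the lists
    -- is proper.
    contradictory (inj₂ none) = critical ((λ v → proj₁ (first v)) , (λ v → proj₁ (proj₂ (first v))) , λ u v e → ⊥-elim (isolated u (proj₂ (nb⁻ e))))
      where
      first : ∀ v → ∃ λ i → i ∈ L v × ¬ (i ∈ [])
      first v = avoid (L-unique v) [] (≤-trans (≤-trans (s≤s z≤n) (m≤n+m 2 k)) (≤-reflexive (sym (L-length v))))
      no-neighbour : ∀ u {w} → adj G u w ≡ true → ⊥
      no-neighbour u a = true≢false (≼⁺ (count>0⁺ (adj G u) a)) (none u)
      isolated : ∀ u {v} → adj G u v ≡ true ⊎ (∃ λ w → adj G u w ≡ true × adj G w v ≡ true) → ⊥
      isolated u (inj₁ a) = no-neighbour u a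
      isolated u (inj₂ (w , a , _)) = no-neighbour u a

theorem4 : ∀ (n : ℕ) (G : Graph n) → 17 ≤ maxDegree G → madLessThan3 G →
    ∀ (L : Fin n → List ℕ) →
    (∀ v → Unique (L v)) → (∀ v → length (L v) ≡ maxDegree G + 2) →
    Σ (Fin n → ℕ) (λ c → (∀ v → c v ∈ L v) ×
      (∀ u v → ¬ (u ≡ v) → close G u v → ¬ (c u ≡ c v)))
theorem4 n G 17≤Δ mad L L-unique L-length
  with colourable (maxDegree G) 17≤Δ L L-unique L-length _ G ≤-refl
    (λ v → ≤-trans (≤-reflexive (sym (countB≡count (adj G v)))) (degree≤maxDegree G v)) mad
... | c , listed , proper = c , listed , λ u v ne near → proper u v (close⇒nb ne near)
  where
  open Colouring G
  close⇒nb : ∀ {u v} → u ≢ v → close G u v → nb u v ≡ true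
  close⇒nb ne (inj₁ a) = nb-adj ne (T⁻ a)
  close⇒nb ne (inj₂ (w , a , b)) = nb-common w ne (T⁻ a) (T⁻ b)
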